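{- Let $\mathcal{H}=(V(\mathcal{H}),E(\mathcal{H}))$ be an $m$-uniform hypergraph with $n$ vertices and let $j\in V(\mathcal{H})$. Then the subgraph centrality of $j$ in $\mathcal{H}$ is $$C(j)=\sum_{d=0}^{\infty}\frac{\mu_{d}(j)}{d!},$$ where $\mu_0(j)=(m-1)^{n-1}$ and, for every integer $d\geq 1$, $$\mu_{d}(j)=(m-1)^{n-1}\sum_{F\in\mathcal{F}_{d}^{(j)}(\mathcal{H})}\frac{t(F)}{\prod_{v\in V(\widetilde{E}(F))\setminus\{j\}}d^{+}(v)}.$$ Here $d^{+}(v)$ is the outdegree of the vertex $v$ in $D(F)$, $V(\widetilde{E}(F))$ is the vertex set of $D(F)$, and $t(F)$ is the number of arborescences of $D(F)$.
   Context: Write $[n]=\{1,\dots,n\}$. A hypergraph $\mathcal{H}=(V(\mathcal{H}),E(\mathcal{H}))$ (here with $V(\mathcal{H})=[n]$, and $E(\mathcal{H})$ a set of subsets of $V(\mathcal{H})$) is $m$-uniform if $|e|=m\geq 2$ for every $e\in E(\mathcal{H})$; a word $i_1i_2\cdots i_m$ is said to belong to $E(\mathcal{H})$ if $\{i_1,\dots,i_m\}\in E(\mathcal{H})$. Its adjacency tensor $\mathcal{A}_{\mathcal{H}}=(h_{\alpha})_{\alpha\in[n]^m}$ has $h_\alpha=\frac{1}{(m-1)!}$ if $\alpha\in E(\mathcal{H})$ and $h_\alpha=0$ otherwise. Definition of $\mu_d(j)$ and $C(j)$. Let $A=(a_{ij})$ be an $n\times n$ auxiliary matrix whose entries are independent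 variables, and for $i\in[n]$, $\alpha=i_2\cdots i_m\in[n]^{m-1}$ put $\frac{\partial}{\partial a_{i\alpha}}=\frac{\partial}{\partial a_{ii_2}}\cdots\frac{\partial}{\partial a_{ii_m}}$. For $j\in[n]$ and an integer $d\ge 0$, $$\mu_{d}(j)=(m-1)^{n-1}\sum_{d_1+\cdots+d_n=d}\ \prod_{i=1}^{n}\frac{1}{(d_i(m-1))!}\Big(\sum_{\alpha_i\in[n]^{m-1}}h_{i\alpha_i}\frac{\partial}{\partial a_{i\alpha_i}}\Big)^{d_i}\,(A^{d(m-1)})_{jj},$$ the sum being over nonnegative integers $d_1,\dots,d_n$. The subgraph centrality of the vertex $j$ is $C(j)=\sum_{d=0}^{\infty}\frac{\mu_d(j)}{d!}$ with this $\mu_d(j)$. Multi-digraphs. For $d\geq 1$ let $\mathcal{F}_d=\{(i_1\alpha_1,\dots,i_d\alpha_d)\mid 1\le i_1\le\cdots\le i_d\le n,\ \alpha_k\in[n]^{m-1},\ k=1,\dots,d\}$. For $F=(i_1\alpha_1,\dots,i_d\alpha_d)\in\mathcal{F}_d$ with $\alpha_k=j_1^{(k)}\cdots j_{m-1}^{(k)}$, let $\widetilde{E}(F)$ be the multiset of arcs consisting of $(i_k,j_1^{(k)}),\dots,(i_k,j_{m-1}^{(k)})$ for $k=1,\dots,d$ (multiplicities added), let $V(\widetilde{E}(F))$ be the set of endpoints of these arcs, and let $D(F)=(V(\widetilde{E}(F)),\widetilde{E}(F))$ be the corresponding multi-digraph. Outdegrees in $D(F)$ count arcs with multiplicity. Let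 $\omega(u,v)$ be the multiplicity of the arc $(u,v)$ in $D(F)$, and let $\widehat{D}(F)$ be the digraph obtained from $D(F)$ by removing duplicate arcs. An Eulerian closed walk of $D(F)$ is a closed walk that uses each arc $(u,v)$ of $\widehat{D}(F)$ exactly $\omega(u,v)$ times. $D(F)$ is Eulerian if it has Eulerian closed walks. A word $i_1\cdots i_s$ is in ascending order if $i_1\le\cdots\le i_s$. Let $\mathcal{F}_d(\mathcal{H})$ be the set of $(i_1\alpha_1,\dots,i_d\alpha_d)\in\mathcal{F}_d$ such that $i_k\alpha_k\in E(\mathcal{H})$ and $\alpha_k$ is in ascending order for all $k=1,\dots,d$, and let $\mathcal{F}_d^{(j)}(\mathcal{H})$ be the set of $F\in\mathcal{F}_d(\mathcal{H})$ such that $D(F)$ is Eulerian and contains the vertex $j$. For Eulerian $D(F)$, $t(F)$ denotes the number of spanning arborescences of $D(F)$ with a fixed root vertex, parallel arcs being regarded as distinct (as in the BEST theorem); for an Eulerian multi-digraph this number does not depend on the choice of the root. -}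

module Defs where

open import Data.Bool using (if_then_else_)
open import Data.Empty using (⊥-elim)
open import Data.Fin using (Fin; zero; suc; toℕ; fromℕ<)
import Data.Fin as Fin
import Data.Fin.Properties as FinP
open import Data.Fin.Subset using (Subset; inside; outside; ⁅_⁆; _∪_; ⋃; ∣_∣)
  renaming (_∈_ to _∈ₛ_)
open import Data.Fin.Subset.Properties using () renaming (_∈?_ to _∈ₛ?_)
open import Data.Integer using (+_)
open import Data.List using
  (List; []; _∷_; _++_; map; foldr; filter; length; lookup; concatMap; allFin; upTo; cartesianProduct)
open import Data.List.Membership.Propositional using (_∈_)
open import Data.List.Membership.Propositional.Properties using (∈-filter⁻; ∈-∃++)
open import Data.List.Relation.Unary.Any using (here)
open import Data.Nat using (ℕ; zero; suc; _∸_; _^_; _!; _≤_; _<_; z≤n)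
import Data.Nat as ℕ
import Data.Nat.Properties as ℕP
open import Data.Nat.Properties using (_!≢0)
open import Data.Product using (∃; ∃₂; _×_; _,_; proj₁; proj₂; ∃-syntax)
open import Data.Product.Properties using () renaming (≡-dec to ×-≡-dec)
open import Data.Rational using (ℚ; 0ℚ; 1ℚ; _/_; _*_)
import Data.Rational as ℚ
open import Data.Sum using (_⊎_; inj₁; inj₂)
open import Data.Vec using (Vec; []; _∷_; toList; fromList; zipWith; replicate; updateAt)
import Data.Vec as Vec
open import Data.Vec.Properties using () renaming (≡-dec to Vec-≡-dec)
open import Data.Vec.Relation.Unary.All using (All; all?)
open import Data.Vec.Relation.Unary.Linked using (Linked; linked?)
open import Function using (_on_)
open import Function.Endo.Propositional using () renaming (_^_ to iter)
open import Relation.Binary using (DecidableEquality; Rel)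
import Relation.Binary as B
open import Relation.Binary.Construct.Closure.ReflexiveTransitive using (Star; ε; _◅_; _◅◅_)
open import Relation.Binary.PropositionalEquality
open import Relation.Nullary using (Dec; yes; no; does; ¬_)
open import Relation.Nullary.Decidable using (map′; _×-dec_; _⊎-dec_; _→-dec_; ¬?)
open import Relation.Unary using (Pred; Decidable)
open import Level using (0ℓ)

------------------------------------------------------------------------
-- Finite sums, products and enumerations

ℕ→ℚ : ℕ → ℚ
ℕ→ℚ k = + k / 1

1/_! : ℕ → ℚ
1/ k ! = (+ 1 / (k !)) {{ k !≢0 }}

∑ : ∀ {A : Set} → List A → (A → ℚ) → ℚ
∑ xs f = foldr (λ x s → f x ℚ.+ s) 0ℚ xs

∏ℕ : ∀ {A : Set} → List A → (A → ℕ) → ℕ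
∏ℕ xs f = foldr (λ x s → f x ℕ.* s) 1 xs

-- Multiplicity of x in the multiset listed by xs.
count : ∀ {A : Set} → DecidableEquality A → A → List A → ℕ
count _≟_ x xs = length (filter (x ≟_) xs)

-- All words of length s over the alphabet listed by xs.
words : ∀ {A : Set} → List A → (s : ℕ) → List (Vec A s)
words xs zero    = [] ∷ []
words xs (suc s) = concatMap (λ x → map (x ∷_) (words xs s)) xs

-- All (d₁ , … , dₙ) of nonnegative integers with d₁ + ⋯ + dₙ = d.
weakCompositions : (n d : ℕ) → List (Vec ℕ n)
weakCompositions zero    zero    = [] ∷ []
weakCompositions zero    (suc d) = []
weakCompositions (suc n) d       =
  concatMap (λ k → map (k ∷_) (weakCompositions n (d ∸ k))) (upTo (suc d))

------------------------------------------------------------------------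
-- Real numbers as Cauchy sequences of rationals

IsCauchy : (ℕ → ℚ) → Set
IsCauchy s = ∀ (e : ℚ) → 0ℚ ℚ.< e →
  ∃[ N ] (∀ k l → N ≤ k → N ≤ l → ℚ.∣ s k ℚ.- s l ∣ ℚ.< e)

record ℝ : Set where
  field
    seq    : ℕ → ℚ
    cauchy : IsCauchy seq

open ℝ public

partialSum : (ℕ → ℚ) → ℕ → ℚ
partialSum a k = ∑ (upTo k) a

-- The series ∑_{d ≥ 0} a d converges to x.
HasSum : (ℕ → ℚ) → ℝ → Set
HasSum a x = ∀ (e : ℚ) → 0ℚ ℚ.< e →
  ∃[ N ] (∀ k → N ≤ k → ℚ.∣ partialSum a k ℚ.- seq x k ∣ ℚ.< e)

------------------------------------------------------------------------
-- Polynomials over ℚ in the n² variables a_{kl}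

-- The exponent of a_{kl} is entry (k , l).
Monomial : ℕ → Set
Monomial n = Vec (Vec ℕ n) n

-- A formal sum of terms; a monomial may occur in several terms.
Poly : ℕ → Set
Poly n = List (ℚ × Monomial n)

module _ {n : ℕ} where

  _≟ᵐ_ : DecidableEquality (Monomial n)
  _≟ᵐ_ = Vec-≡-dec (Vec-≡-dec ℕP._≟_)

  1ᵐ : Monomial n
  1ᵐ = replicate n (replicate n 0)

  exponent : Fin n → Fin n → Monomial n → ℕ
  exponent k l e = Vec.lookup (Vec.lookup e k) l

  modifyExponent : Fin n → Fin n → (ℕ → ℕ) → Monomial n → Monomial n
  modifyExponent k l f e = updateAt e k (λ row → updateAt row l f)

  coefficient : Monomial n → Poly n → ℚ
  coefficient e p = ∑ (filter (λ t → e ≟ᵐ proj₂ t) p) proj₁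

  0ᵖ 1ᵖ : Poly n
  0ᵖ = []
  1ᵖ = (1ℚ , 1ᵐ) ∷ []

  infixl 6 _⊕_
  infixl 7 _⊗_

  _⊕_ _⊗_ : Poly n → Poly n → Poly n
  p ⊕ q = p ++ q
  p ⊗ q = map (λ ((c , e) , (c′ , e′)) → c * c′ , zipWith (zipWith ℕ._+_) e e′)
              (cartesianProduct p q)

  scale : ℚ → Poly n → Poly n
  scale c = map (λ (c′ , e) → c * c′ , e)

  ∑ᵖ : ∀ {A : Set} → List A → (A → Poly n) → Poly n
  ∑ᵖ xs f = foldr (λ x s → f x ⊕ s) 0ᵖ xs

  var : Fin n → Fin n → Poly n
  var k l = (1ℚ , modifyExponent k l suc 1ᵐ) ∷ []

  -- When a_{kl} does not occur, the factor ℕ→ℚ 0 kills the term.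
  ∂ : Fin n → Fin n → Poly n → Poly n
  ∂ k l = map (λ (c , e) → ℕ→ℚ (exponent k l e) * c , modifyExponent k l (_∸ 1) e)

  -- ∂/∂a_{kα}, the composite of the ∂/∂a_{kl} over the letters l of α.
  ∂-word : ∀ {s} → Fin n → Vec (Fin n) s → Poly n → Poly n
  ∂-word k α p = Vec.foldr′ (∂ k) p α

Matrix : ℕ → Set
Matrix n = Fin n → Fin n → Poly n

identity : ∀ {n} → Matrix n
identity k l = if does (k FinP.≟ l) then 1ᵖ else 0ᵖ

matMul : ∀ {n} → Matrix n → Matrix n → Matrix n
matMul M N k l = ∑ᵖ (allFin _) (λ i → M k i ⊗ N i l)

matPow : ∀ {n} → Matrix n → ℕ → Matrix n
matPow M zero    = identity
matPow M (suc s) = matMul M (matPow M s)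

------------------------------------------------------------------------
-- Hypergraphs on the vertex set Fin n

record Hypergraph (n : ℕ) : Set₁ where
  field
    Edge  : Pred (Subset n) 0ℓ
    edge? : Decidable Edge

open Hypergraph public

Uniform : ∀ {n} → ℕ → Hypergraph n → Set
Uniform m H = 2 ≤ m × (∀ e → Edge H e → ∣ e ∣ ≡ m)

letters : ∀ {n s} → Vec (Fin n) s → Subset n
letters w = ⋃ (map ⁅_⁆ (toList w))

_∈E_ : ∀ {n s} → Vec (Fin n) s → Hypergraph n → Set
w ∈E H = Edge H (letters w)

_∈E?_ : ∀ {n s} (w : Vec (Fin n) s) (H : Hypergraph n) → Dec (w ∈E H)
w ∈E? H = edge? H (letters w)

adjacencyTensor : ∀ {n} (m : ℕ) → Hypergraph n → Vec (Fin n) m → ℚ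
adjacencyTensor m H w = if does (w ∈E? H) then 1/ (m ∸ 1) ! else 0ℚ

------------------------------------------------------------------------
-- μ_d(j) and the subgraph centrality
--
-- A word in [n]^m is written k ∷ α with k : Fin n and α : Vec (Fin n) (m ∸ 1);
-- its length suc (m ∸ 1) is m because m ≥ 2.

module _ {n : ℕ} (m : ℕ) (H : Hypergraph n) where

  edgeOperator : Fin n → Poly n → Poly n
  edgeOperator k p =
    ∑ᵖ (words (allFin n) (m ∸ 1))
       (λ α → scale (adjacencyTensor (suc (m ∸ 1)) H (k ∷ α)) (∂-word k α p))

  vertexOperator : Fin n → ℕ → Poly n → Poly n
  vertexOperator k dₖ p =
    scale (1/ (dₖ ℕ.* (m ∸ 1)) !) (iter (Poly n) (edgeOperator k) dₖ p)

  μᵖ : ℕ → Fin n → Poly n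
  μᵖ d j =
    scale (ℕ→ℚ ((m ∸ 1) ^ (n ∸ 1)))
      (∑ᵖ (weakCompositions n d) (λ ds →
        foldr (λ k p → vertexOperator k (Vec.lookup ds k) p)
              (matPow var (d ℕ.* (m ∸ 1)) j j)
              (allFin n)))

  -- An operator of order d(m - 1) is applied to a form of degree d(m - 1), so
  -- μᵖ d j is a constant polynomial; its value is its constant term.
  μ : ℕ → Fin n → ℚ
  μ d j = coefficient 1ᵐ (μᵖ d j)

  IsSubgraphCentrality : Fin n → ℝ → Set
  IsSubgraphCentrality j C = HasSum (λ d → μ d j * 1/ d !) C

------------------------------------------------------------------------
-- The multi-digraphs D(F)

-- A tuple (i₁α₁ , … , i_dα_d) with |α_k| = s, each i_kα_k stored as (i_k , α_k).
Tuple : (n s d : ℕ) → Set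
Tuple n s d = Vec (Fin n × Vec (Fin n) s) d

Arc : ℕ → Set
Arc n = Fin n × Fin n

_≟ᵃ_ : ∀ {n} → DecidableEquality (Arc n)
_≟ᵃ_ = ×-≡-dec FinP._≟_ FinP._≟_

Ascending : ∀ {n s} → Vec (Fin n) s → Set
Ascending = Linked Fin._≤_

-- The arcs of the walk u → w₁ → w₂ → ⋯.
walkArcs : ∀ {n} → Fin n → List (Fin n) → List (Arc n)
walkArcs u []       = []
walkArcs u (w ∷ ws) = (u , w) ∷ walkArcs w ws

walkEnd : ∀ {n} → Fin n → List (Fin n) → Fin n
walkEnd u []       = u
walkEnd u (w ∷ ws) = walkEnd w ws

module _ {n s d : ℕ} (F : Tuple n s d) where

  -- Ẽ(F), listed with multiplicity.
  arcs : List (Arc n)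
  arcs = concatMap (λ (i , α) → map (i ,_) (toList α)) (toList F)

  ω : Arc n → ℕ
  ω a = count _≟ᵃ_ a arcs

  vertices : Subset n
  vertices = ⋃ (map (λ (u , v) → ⁅ u ⁆ ∪ ⁅ v ⁆) arcs)

  outdegree : Fin n → ℕ
  outdegree v = count FinP._≟_ v (map proj₁ arcs)

  -- Quantifying over all pairs, not only the arcs of D̂(F), also says that the
  -- walk uses arcs of D(F) only, since ω vanishes elsewhere.
  IsEulerianClosedWalk : Fin n → List (Fin n) → Set
  IsEulerianClosedWalk u ws =
    walkEnd u ws ≡ u × (∀ a b → count _≟ᵃ_ (a , b) (walkArcs u ws) ≡ ω (a , b))

  Eulerian : Set
  Eulerian = ∃₂ IsEulerianClosedWalk

  -- Arcs are labelled by their positions in the list, so that parallel arcs are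
  -- distinct, and T is a set of labels.
  ArcOf : Subset (length arcs) → Fin n → Fin n → Set
  ArcOf T u v = ∃[ k ] (k ∈ₛ T × lookup arcs k ≡ (u , v))

  outdegreeIn : Subset (length arcs) → Fin n → ℕ
  outdegreeIn T v =
    length (filter (λ k → (k ∈ₛ? T) ×-dec (proj₁ (lookup arcs k) FinP.≟ v))
                   (allFin (length arcs)))

  -- Spanning trees of D(F) with all arcs directed towards the root r, as in the
  -- BEST theorem.
  IsArborescence : Fin n → Subset (length arcs) → Set
  IsArborescence r T =
      outdegreeIn T r ≡ 0
    × (∀ v → v ∈ₛ vertices → v ≢ r → outdegreeIn T v ≡ 1)
    × (∀ v → v ∈ₛ vertices → Star (ArcOf T) v r)

  InFamily : Hypergraph n → Fin n → Set
  InFamily H j =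
      Linked (Fin._≤_ on proj₁) F
    × All (λ (i , α) → (i ∷ α) ∈E H × Ascending α) F
    × Eulerian
    × j ∈ₛ vertices

------------------------------------------------------------------------
-- Decidability of being Eulerian

private
  indicator : ∀ {A : Set} → DecidableEquality A → A → A → ℕ
  indicator _≟_ y x = if does (y ≟ x) then 1 else 0

  count-∷ : ∀ {A : Set} (_≟_ : DecidableEquality A) y x xs →
    count _≟_ y (x ∷ xs) ≡ indicator _≟_ y x ℕ.+ count _≟_ y xs
  count-∷ _≟_ y x xs with y ≟ x
  ... | yes _ = refl
  ... | no _  = refl

  count-split : ∀ {A : Set} (_≟_ : DecidableEquality A) y x as bs →
    count _≟_ y (as ++ x ∷ bs) ≡ count _≟_ y (x ∷ as ++ bs)
  count-split _≟_ y x []       bs = refl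
  count-split _≟_ y x (a ∷ as) bs = begin
    count _≟_ y (a ∷ as ++ x ∷ bs)          ≡⟨ count-∷ _≟_ y a _ ⟩
    [a] ℕ.+ count _≟_ y (as ++ x ∷ bs)      ≡⟨ cong ([a] ℕ.+_) (count-split _≟_ y x as bs) ⟩
    [a] ℕ.+ count _≟_ y (x ∷ as ++ bs)      ≡⟨ cong ([a] ℕ.+_) (count-∷ _≟_ y x _) ⟩
    [a] ℕ.+ ([x] ℕ.+ rest)                  ≡⟨ sym (ℕP.+-assoc [a] [x] rest) ⟩
    [a] ℕ.+ [x] ℕ.+ rest                    ≡⟨ cong (ℕ._+ rest) (ℕP.+-comm [a] [x]) ⟩
    [x] ℕ.+ [a] ℕ.+ rest                    ≡⟨ ℕP.+-assoc [x] [a] rest ⟩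
    [x] ℕ.+ ([a] ℕ.+ rest)                  ≡⟨ cong ([x] ℕ.+_) (sym (count-∷ _≟_ y a _)) ⟩
    [x] ℕ.+ count _≟_ y (a ∷ as ++ bs)      ≡⟨ sym (count-∷ _≟_ y x _) ⟩
    count _≟_ y (x ∷ a ∷ as ++ bs)          ∎
    where
    open ≡-Reasoning
    [a] = indicator _≟_ y a
    [x] = indicator _≟_ y x
    rest = count _≟_ y (as ++ bs)

  length-split : ∀ {A : Set} (x : A) as bs →
    length (as ++ x ∷ bs) ≡ suc (length (as ++ bs))
  length-split x []       bs = refl
  length-split x (a ∷ as) bs = cong suc (length-split x as bs)

  count-tail : ∀ {A : Set} (_≟_ : DecidableEquality A) y x xs ys →
    count _≟_ y (x ∷ xs) ≡ count _≟_ y (x ∷ ys) → count _≟_ y xs ≡ count _≟_ y ys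
  count-tail _≟_ y x xs ys eq with y ≟ x
  ... | yes _ = ℕP.suc-injective eq
  ... | no _  = eq

  count-head : ∀ {A : Set} (_≟_ : DecidableEquality A) x xs →
    count _≟_ x (x ∷ xs) ≡ suc (count _≟_ x xs)
  count-head _≟_ x xs with x ≟ x
  ... | yes _ = refl
  ... | no ¬p = ⊥-elim (¬p refl)

  count-∈ : ∀ {A : Set} (_≟_ : DecidableEquality A) x ys {k} →
    count _≟_ x ys ≡ suc k → x ∈ ys
  count-∈ _≟_ x ys eq with filter (x ≟_) ys in eq′
  ... | z ∷ zs with ∈-filter⁻ (x ≟_) {xs = ys} (subst (z ∈_) (sym eq′) (here refl))
  ... | z∈ys , refl = z∈ys

  count⇒length : ∀ {A : Set} (_≟_ : DecidableEquality A) (xs ys : List A) →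
    (∀ x → count _≟_ x xs ≡ count _≟_ x ys) → length xs ≡ length ys
  count⇒length _≟_ []       []       eq = refl
  count⇒length _≟_ []       (y ∷ ys) eq with trans (eq y) (count-head _≟_ y ys)
  ... | ()
  count⇒length _≟_ (x ∷ xs) ys       eq
    with ∈-∃++ (count-∈ _≟_ x ys (trans (sym (eq x)) (count-head _≟_ x xs)))
  ... | as , bs , refl = trans
    (cong suc (count⇒length _≟_ xs (as ++ bs) λ y →
      count-tail _≟_ y x xs (as ++ bs) (trans (eq y) (count-split _≟_ y x as bs))))
    (sym (length-split x as bs))

  length-walkArcs : ∀ {n} (u : Fin n) ws → length (walkArcs u ws) ≡ length ws
  length-walkArcs u []       = refl
  length-walkArcs u (w ∷ ws) = cong suc (length-walkArcs w ws)

  anyVec? : ∀ {n} s {P : Pred (Vec (Fin n) s) 0ℓ} → Decidable P → Dec (∃ P)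
  anyVec? zero    P? = map′ ([] ,_) (λ { ([] , p) → p }) (P? [])
  anyVec? (suc s) P? =
    map′ (λ (x , w , p) → x ∷ w , p) (λ { (x ∷ w , p) → x , w , p })
         (FinP.any? (λ x → anyVec? s (λ w → P? (x ∷ w))))

  anyList? : ∀ {n} s {P : Pred (List (Fin n)) 0ℓ} → Decidable P →
    (∀ {ws} → P ws → length ws ≡ s) → Dec (∃ P)
  anyList? {n} s {P} P? len =
    map′ (λ (w , p) → toList w , p) (λ (ws , p) → from ws p (len p))
         (anyVec? s (λ w → P? (toList w)))
    where
    toList∘fromList : (ws : List (Fin n)) → toList (fromList ws) ≡ ws
    toList∘fromList []       = refl
    toList∘fromList (w ∷ ws) = cong (w ∷_) (toList∘fromList ws)

    from : ∀ ws → P ws → length ws ≡ s → ∃ λ (w : Vec (Fin n) s) → P (toList w)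
    from ws p refl = fromList ws , subst P (sym (toList∘fromList ws)) p

isEulerianClosedWalk? : ∀ {n s d} (F : Tuple n s d) (u : Fin n) ws →
  Dec (IsEulerianClosedWalk F u ws)
isEulerianClosedWalk? F u ws =
  (walkEnd u ws FinP.≟ u) ×-dec
  FinP.all? (λ a → FinP.all? (λ b →
    count _≟ᵃ_ (a , b) (walkArcs u ws) ℕP.≟ ω F (a , b)))

eulerian? : ∀ {n s d} (F : Tuple n s d) → Dec (Eulerian F)
eulerian? F = FinP.any? λ u →
  anyList? (length (arcs F)) (isEulerianClosedWalk? F u) λ {ws} (_ , eq) →
    trans (sym (length-walkArcs u ws))
          (count⇒length _≟ᵃ_ (walkArcs u ws) (arcs F) (λ (a , b) → eq a b))

------------------------------------------------------------------------
-- Decidability of reachability (Warshall's algorithm)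

private
  module Warshall {n : ℕ} {R : Rel (Fin n) 0ℓ} (R? : B.Decidable R) where

    -- Reachable k u v: v is reached from u through vertices below k only.
    Reachable : ∀ k → k ≤ n → Rel (Fin n) 0ℓ
    Reachable zero    _   u v = u ≡ v ⊎ R u v
    Reachable (suc k) k<n u v =
      Reachable k k≤n u v ⊎
      (Reachable k k≤n u (fromℕ< k<n) × Reachable k k≤n (fromℕ< k<n) v)
      where k≤n = ℕP.<⇒≤ k<n

    reachable? : ∀ k k≤n → B.Decidable (Reachable k k≤n)
    reachable? zero    _   u v = (u FinP.≟ v) ⊎-dec R? u v
    reachable? (suc k) k<n u v =
      reachable? k _ u v ⊎-dec
      (reachable? k _ u (fromℕ< k<n) ×-dec reachable? k _ (fromℕ< k<n) v)

    sound : ∀ k k≤n {u v} → Reachable k k≤n u v → Star R u v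
    sound zero    _   (inj₁ refl)    = ε
    sound zero    _   (inj₂ r)       = r ◅ ε
    sound (suc k) k<n (inj₁ p)       = sound k _ p
    sound (suc k) k<n (inj₂ (p , q)) = sound k _ p ◅◅ sound k _ q

    base : ∀ k k≤n {u v} → Reachable 0 z≤n u v → Reachable k k≤n u v
    base zero    z≤n p = p
    base (suc k) k<n p = inj₁ (base k _ p)

    through : ∀ k k≤n {u w v} → toℕ w < k →
      Reachable k k≤n u w → Reachable k k≤n w v → Reachable k k≤n u v
    through (suc k) k<n {w = w} w<k p q with ℕP.m≤n⇒m<n∨m≡n (ℕP.≤-pred w<k)
    through (suc k) k<n _ (inj₁ p)        (inj₁ q)        | inj₁ lt = inj₁ (through k _ lt p q)
    through (suc k) k<n _ (inj₁ p)        (inj₂ (q , q′)) | inj₁ lt = inj₂ (through k _ lt p q , q′)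
    through (suc k) k<n _ (inj₂ (p , p′)) (inj₁ q)        | inj₁ lt = inj₂ (p , through k _ lt p′ q)
    through (suc k) k<n _ (inj₂ (p , p′)) (inj₂ (q , q′)) | inj₁ lt = inj₂ (p , q′)
    through (suc k) k<n {u} {w} {v} _ p q | inj₂ eq = inj₂ (left p , right q)
      where
      w≡k : w ≡ fromℕ< k<n
      w≡k = FinP.toℕ-injective (trans eq (sym (FinP.toℕ-fromℕ< k<n)))
      left : Reachable (suc k) k<n u w → Reachable k _ u (fromℕ< k<n)
      left (inj₁ a)       = subst (Reachable k _ u) w≡k a
      left (inj₂ (a , _)) = a
      right : Reachable (suc k) k<n w v → Reachable k _ (fromℕ< k<n) v
      right (inj₁ a)       = subst (λ x → Reachable k _ x v) w≡k a
      right (inj₂ (_ , b)) = b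

    complete : ∀ {u v} → Star R u v → Reachable n ℕP.≤-refl u v
    complete ε               = base n _ (inj₁ refl)
    complete (_◅_ {j = w} r rs) =
      through n _ (FinP.toℕ<n w) (base n _ (inj₂ r)) (complete rs)

    star? : B.Decidable (Star R)
    star? u v = map′ (sound n _) complete (reachable? n ℕP.≤-refl u v)

------------------------------------------------------------------------
-- t(F) and the family 𝓕_d^{(j)}(H)

isArborescence? : ∀ {n s d} (F : Tuple n s d) r → Decidable (IsArborescence F r)
isArborescence? F r T =
  (outdegreeIn F T r ℕP.≟ 0) ×-dec
  FinP.all? (λ v → (v ∈ₛ? V) →-dec (¬? (v FinP.≟ r) →-dec (outdegreeIn F T v ℕP.≟ 1))) ×-dec
  FinP.all? (λ v → (v ∈ₛ? V) →-dec Warshall.star? arcOf? v r)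
  where
  V = vertices F
  arcOf? : B.Decidable (ArcOf F T)
  arcOf? u v = FinP.any? (λ k → (k ∈ₛ? T) ×-dec (lookup (arcs F) k ≟ᵃ (u , v)))

-- The number of spanning arborescences of D(F) with root r.
t : ∀ {n s d} → Tuple n s d → Fin n → ℕ
t F r = length (filter (isArborescence? F r) (words (outside ∷ inside ∷ []) _))

inFamily? : ∀ {n s d} (H : Hypergraph n) (j : Fin n) →
  Decidable (λ (F : Tuple n s d) → InFamily F H j)
inFamily? H j F =
  linked? (λ x y → proj₁ x FinP.≤? proj₁ y) F ×-dec
  all? (λ (i , α) → ((i ∷ α) ∈E? H) ×-dec linked? FinP._≤?_ α) F ×-dec
  eulerian? F ×-dec
  (j ∈ₛ? vertices F)

family : ∀ {n} (m d : ℕ) → Hypergraph n → Fin n → List (Tuple n (m ∸ 1) d)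
family {n} m d H j =
  filter (inFamily? H j)
         (words (cartesianProduct (allFin n) (words (allFin n) (m ∸ 1))) d)

-- a / b, with a / 0 = 0.  Below b is a product of outdegrees of vertices of an
-- Eulerian multi-digraph, which are positive.
ratio : ℕ → ℕ → ℚ
ratio a zero    = 0ℚ
ratio a (suc b) = + a / suc b

∏-outdegrees : ∀ {n s d} → Tuple n s d → Subset n → ℕ
∏-outdegrees {n} F S = ∏ℕ (filter (_∈ₛ? S) (allFin n)) (outdegree F)

{-# OPTIONS --safe #-}

-- Let D be a multiset of arcs with d s elements, where s = m ∸ 1.  Differentiating
-- (A^{ds})_{jj} by the arcs of D gives the number of trails from j to j through
-- all arcs of D, parallel arcs being labelled.  By the BEST theorem this is
-- t_j(D) d⁺(j)! ∏_{v ≠ j} (d⁺(v) − 1)!.  The blocks of F with first letter v account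
-- for 1/d⁺(v)!, and the weights 1/s! identify the orders of the words α_k, so that
-- t_j(D) / ∏_{v ≠ j} d⁺(v) remains.
--
-- The BEST theorem is proved for trails from u to r by induction along the first
-- arc: deleting the arcs that leave u one at a time counts every arborescence
-- d⁺(u) − 1 times, or d⁺(u) times if u = r; and if u ≠ r has a single outgoing arc,
-- then it has no incoming one and is a leaf of every arborescence.  Counting closed
-- trails at v by their last arc instead gives
-- d⁺(v) t_v = ∑ t_u over the arcs u → v, whence ∑ (t_u − t_v)² = 0 over all arcs
-- u → v, and t does not depend on the root.
--
-- The number of trails is at most ∏ d⁺(v)!, so that each tuple contributes at most 1
-- to μ_d(j) and the series is dominated by an exponential one.

module Submission where

open import Defs
open import Data.Nat using (ℕ; _≤_; _∸_; _^_)
open import Data.Fin using (Fin)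
open import Data.Fin.Subset using (_∈_; _-_)
open import Data.Product using (∃-syntax; _×_)
open import Data.Rational using (_*_)
open import Relation.Binary.PropositionalEquality using (_≡_)

open import Data.Bool using (if_then_else_)
open import Data.Empty using (⊥; ⊥-elim)
open import Data.Fin using (zero; suc; toℕ)
import Data.Fin as Fin
import Data.Fin.Properties as FinP
open import Data.Fin.Subset using (Subset; inside; outside; ⁅_⁆; _∪_; ⋃; ∣_∣)
import Data.Fin.Subset.Properties as SubP
import Data.Integer as ℤ
import Data.Integer.Properties as ℤP
open import Data.List using (List; []; _∷_; _++_; map; foldr; filter; length; lookup; concatMap; allFin; tabulate; upTo; applyUpTo; cartesianProduct)
import Data.List.Properties as ListP
open import Data.List.Membership.Propositional using () renaming (_∈_ to _∈ˡ_)
import Data.List.Membership.Propositional.Properties as ∈P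
open import Data.List.Relation.Unary.Any using (here; there)
open import Data.List.Relation.Binary.Permutation.Propositional using (_↭_; prep; swap; ↭-refl; ↭-sym; ↭-trans; ↭-reflexive)
import Data.List.Relation.Binary.Permutation.Propositional as Perm
import Data.List.Relation.Binary.Permutation.Propositional.Properties as PermP
open import Data.Nat using (zero; suc; _!; _<_; z≤n; s≤s)
import Data.Nat as ℕ
import Data.Nat.Properties as ℕP
open import Data.Product using (∃; _,_; proj₁; proj₂)
open import Data.Rational using (ℚ; 0ℚ; 1ℚ; _+_; toℚᵘ)
import Data.Rational as ℚ
import Data.Rational.Properties as ℚP
import Data.Rational.Unnormalised as ℚᵘ
import Data.Rational.Unnormalised.Properties as ℚᵘP
open import Data.Rational.Solver using (module +-*-Solver)
open import Data.Sum using (_⊎_; inj₁; inj₂)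
open import Data.Vec using (Vec; []; _∷_; toList)
import Data.Vec as Vec
import Data.Vec.Properties as VecP
open import Data.Vec.Relation.Unary.All using (All; []; _∷_; all?)
open import Data.Vec.Relation.Unary.Linked using (Linked; []; [-]; _∷_; linked?)
open import Function using (_∘_; _on_; id; const)
open import Function.Endo.Propositional using () renaming (_^_ to iter)
open import Relation.Binary using (DecidableEquality; tri<; tri≈; tri>)
open import Relation.Binary.Construct.Closure.ReflexiveTransitive using (Star; ε; _◅_; _◅◅_)
import Relation.Binary.Construct.Closure.ReflexiveTransitive as Star
open import Relation.Binary.PropositionalEquality using (refl; sym; trans; cong; cong₂; subst; _≢_; module ≡-Reasoning)
open import Relation.Nullary using (Dec; yes; no; does; ¬_)
open import Relation.Nullary.Decidable using (map′; _×-dec_; _⊎-dec_; _→-dec_; ¬?)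
open import Relation.Unary using (Decidable)
open +-*-Solver using (solve; _:+_; _:*_; _:-_; :-_; _:=_; con)

-- Rational arithmetic

-- The BEST theorem is proved without assuming connectedness: for balanced arcs that no trail can
-- use up both sides vanish, so no step has to show that the remaining arcs hang together. In return
-- the vertices to be spanned change as arcs are deleted. They are taken to be those of nonzero
-- outdegree, and `Arborescence` carries this outdegree `D` separately from the tree, so that
-- arborescences of `as` can be counted inside a sublist of it. A vertex left for good then drops
-- out by itself. The orders of each word α_k carry total weight 1 because a word kα that is an edge
-- has as many letters as the edge has elements: no letter repeats, and each set of letters has
-- exactly s! orders. The operators attached to the vertices act as often as a composition of d
-- prescribes. A composition lists the run lengths of a tuple with ascending first letters, and sums
-- over compositions become sums over such tuples by comparing the removal of a whole run with that
-- of a single letter. All counts live in ℚ, and quotients of factorials are compared after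
-- multiplication by nonzero factors.

ℕ→ℚ-toℚᵘ : ∀ k → toℚᵘ (ℕ→ℚ k) ℚᵘ.≃ ℚᵘ.mkℚᵘ (ℤ.+ k) 0
ℕ→ℚ-toℚᵘ k = ℚP.toℚᵘ-fromℚᵘ (ℚᵘ.mkℚᵘ (ℤ.+ k) 0)

ℕ→ℚ-+ : ∀ k l → ℕ→ℚ (k ℕ.+ l) ≡ ℕ→ℚ k + ℕ→ℚ l
ℕ→ℚ-+ k l = ℚP.toℚᵘ-injective (begin
  toℚᵘ (ℕ→ℚ (k ℕ.+ l))                       ≈⟨ ℕ→ℚ-toℚᵘ (k ℕ.+ l) ⟩
  ℚᵘ.mkℚᵘ (ℤ.+ (k ℕ.+ l)) 0                    ≈⟨ ℚᵘ.*≡* (cong (ℤ._* (ℤ.+ 1)) (sym (cong₂ ℤ._+_ (ℤP.*-identityʳ (ℤ.+ k)) (ℤP.*-identityʳ (ℤ.+ l))))) ⟩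
  ℚᵘ.mkℚᵘ (ℤ.+ k) 0 ℚᵘ.+ ℚᵘ.mkℚᵘ (ℤ.+ l) 0       ≈⟨ ℚᵘP.+-cong (ℚᵘP.≃-sym (ℕ→ℚ-toℚᵘ k)) (ℚᵘP.≃-sym (ℕ→ℚ-toℚᵘ l)) ⟩
  toℚᵘ (ℕ→ℚ k) ℚᵘ.+ toℚᵘ (ℕ→ℚ l)             ≈⟨ ℚᵘP.≃-sym (ℚP.toℚᵘ-homo-+ (ℕ→ℚ k) (ℕ→ℚ l)) ⟩
  toℚᵘ (ℕ→ℚ k + ℕ→ℚ l)                       ∎)
  where open ℚᵘP.≃-Reasoning

fraction-*-denominator : ∀ a b .{{_ : ℕ.NonZero b}} → (ℤ.+ a ℚ./ b) * ℕ→ℚ b ≡ ℕ→ℚ a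
fraction-*-denominator a b@(suc b-1) = ℚP.toℚᵘ-injective (begin
  toℚᵘ ((ℤ.+ a ℚ./ b) * ℕ→ℚ b)                 ≈⟨ ℚP.toℚᵘ-homo-* (ℤ.+ a ℚ./ b) (ℕ→ℚ b) ⟩
  toℚᵘ (ℤ.+ a ℚ./ b) ℚᵘ.* toℚᵘ (ℕ→ℚ b)         ≈⟨ ℚᵘP.*-cong (ℚP.toℚᵘ-fromℚᵘ (ℚᵘ.mkℚᵘ (ℤ.+ a) b-1)) (ℕ→ℚ-toℚᵘ b) ⟩
  ℚᵘ.mkℚᵘ (ℤ.+ a) b-1 ℚᵘ.* ℚᵘ.mkℚᵘ (ℤ.+ b) 0     ≈⟨ ℚᵘ.*≡* (trans (ℤP.*-identityʳ _) (cong (ℤ.+ a ℤ.*_) (cong ℤ.+_ (sym (ℕP.*-identityʳ b))))) ⟩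
  ℚᵘ.mkℚᵘ (ℤ.+ a) 0                            ≈⟨ ℚᵘP.≃-sym (ℕ→ℚ-toℚᵘ a) ⟩
  toℚᵘ (ℕ→ℚ a)                               ∎)
  where open ℚᵘP.≃-Reasoning

ℕ→ℚ-suc : ∀ k → ℕ→ℚ (suc k) ≡ 1ℚ + ℕ→ℚ k
ℕ→ℚ-suc = ℕ→ℚ-+ 1

ℕ→ℚ-* : ∀ k l → ℕ→ℚ (k ℕ.* l) ≡ ℕ→ℚ k * ℕ→ℚ l
ℕ→ℚ-* zero    l = sym (ℚP.*-zeroˡ (ℕ→ℚ l))
ℕ→ℚ-* (suc k) l = begin
  ℕ→ℚ (l ℕ.+ k ℕ.* l)       ≡⟨ ℕ→ℚ-+ l (k ℕ.* l) ⟩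
  ℕ→ℚ l + ℕ→ℚ (k ℕ.* l)     ≡⟨ cong (ℕ→ℚ l +_) (ℕ→ℚ-* k l) ⟩
  ℕ→ℚ l + ℕ→ℚ k * ℕ→ℚ l     ≡⟨ solve 2 (λ x y → x :+ y :* x := (con 1ℚ :+ y) :* x) refl (ℕ→ℚ l) (ℕ→ℚ k) ⟩
  (1ℚ + ℕ→ℚ k) * ℕ→ℚ l      ≡⟨ cong (_* ℕ→ℚ l) (sym (ℕ→ℚ-suc k)) ⟩
  ℕ→ℚ (suc k) * ℕ→ℚ l       ∎
  where open ≡-Reasoning

0≤ℕ→ℚ : ∀ k → 0ℚ ℚ.≤ ℕ→ℚ k
0≤ℕ→ℚ k = ℚP.nonNegative⁻¹ (ℕ→ℚ k) {{ℚP.normalize-nonNeg k 1}}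

0<ℕ→ℚ : ∀ k .{{_ : ℕ.NonZero k}} → 0ℚ ℚ.< ℕ→ℚ k
0<ℕ→ℚ k = ℚP.positive⁻¹ (ℕ→ℚ k) {{ℚP.normalize-pos k 1}}

ℕ→ℚ-mono-≤ : ∀ {k l} → k ≤ l → ℕ→ℚ k ℚ.≤ ℕ→ℚ l
ℕ→ℚ-mono-≤ {k} {l} k≤l = subst (ℕ→ℚ k ℚ.≤_)
  (trans (sym (ℕ→ℚ-+ k (l ∸ k))) (cong ℕ→ℚ (ℕP.m+[n∸m]≡n k≤l)))
  (subst (ℚ._≤ ℕ→ℚ k + ℕ→ℚ (l ∸ k)) (ℚP.+-identityʳ (ℕ→ℚ k)) (ℚP.+-monoʳ-≤ (ℕ→ℚ k) (0≤ℕ→ℚ (l ∸ k))))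

*-mono-≤-nonNeg : ∀ {w x y z} → 0ℚ ℚ.≤ w → 0ℚ ℚ.≤ z → w ℚ.≤ x → y ℚ.≤ z → w * y ℚ.≤ x * z
*-mono-≤-nonNeg {w} {x} {y} {z} 0≤w 0≤z w≤x y≤z = ℚP.≤-trans
  (ℚP.*-monoˡ-≤-nonNeg w {{ℚ.nonNegative 0≤w}} y≤z)
  (ℚP.*-monoʳ-≤-nonNeg z {{ℚ.nonNegative 0≤z}} w≤x)

0≤* : ∀ {x y} → 0ℚ ℚ.≤ x → 0ℚ ℚ.≤ y → 0ℚ ℚ.≤ x * y
0≤* {x} {y} 0≤x 0≤y = subst (ℚ._≤ x * y) (ℚP.*-zeroʳ x)
  (ℚP.*-monoˡ-≤-nonNeg x {{ℚ.nonNegative 0≤x}} 0≤y)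

*-cancelʳ-≢0 : ∀ z {x y} → z ≢ 0ℚ → x * z ≡ y * z → x ≡ y
*-cancelʳ-≢0 z {x} {y} z≢0 eq = begin
  x               ≡⟨ sym (ℚP.*-identityʳ x) ⟩
  x * 1ℚ          ≡⟨ cong (x *_) (sym (ℚP.*-inverseʳ z)) ⟩
  x * (z * z⁻¹)   ≡⟨ sym (ℚP.*-assoc x z z⁻¹) ⟩
  x * z * z⁻¹     ≡⟨ cong (_* z⁻¹) eq ⟩
  y * z * z⁻¹     ≡⟨ ℚP.*-assoc y z z⁻¹ ⟩
  y * (z * z⁻¹)   ≡⟨ cong (y *_) (ℚP.*-inverseʳ z) ⟩
  y * 1ℚ          ≡⟨ ℚP.*-identityʳ y ⟩
  y               ∎
  where
  open ≡-Reasoning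
  instance z-nonZero : ℚ.NonZero z
           z-nonZero = ℚ.≢-nonZero z≢0
  z⁻¹ = ℚ.1/ z

ℕ→ℚ-≢0 : ∀ k .{{_ : ℕ.NonZero k}} → ℕ→ℚ k ≢ 0ℚ
ℕ→ℚ-≢0 k eq = ℚP.<⇒≢ (0<ℕ→ℚ k) (sym eq)

!≢0 : ∀ k → ℕ→ℚ (k !) ≢ 0ℚ
!≢0 k = ℕ→ℚ-≢0 (k !) {{k ℕP.!≢0}}

1/!-*-! : ∀ k → 1/ k ! * ℕ→ℚ (k !) ≡ 1ℚ
1/!-*-! k = fraction-*-denominator 1 (k !) {{k ℕP.!≢0}}

1/!-≥0 : ∀ k → 0ℚ ℚ.≤ 1/ k !
1/!-≥0 k = ℚP.nonNegative⁻¹ (1/ k !) {{ℚP.normalize-nonNeg 1 (k !) {{k ℕP.!≢0}}}}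

-- Indicators and finite sums

⟦_⟧ : ∀ {P : Set} → Dec P → ℚ
⟦ P? ⟧ = if does P? then 1ℚ else 0ℚ

module _ {P : Set} where

  ⟦⟧-yes : (P? : Dec P) → P → ⟦ P? ⟧ ≡ 1ℚ
  ⟦⟧-yes (yes _) _ = refl
  ⟦⟧-yes (no ¬p) p = ⊥-elim (¬p p)

  ⟦⟧-no : (P? : Dec P) → ¬ P → ⟦ P? ⟧ ≡ 0ℚ
  ⟦⟧-no (yes p) ¬p = ⊥-elim (¬p p)
  ⟦⟧-no (no _)  _  = refl

  ⟦⟧-*-cong : (P? : Dec P) {x y : ℚ} → (P → x ≡ y) → ⟦ P? ⟧ * x ≡ ⟦ P? ⟧ * y
  ⟦⟧-*-cong (yes p) eq = cong (1ℚ *_) (eq p)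
  ⟦⟧-*-cong (no _) {x} {y} _ = trans (ℚP.*-zeroˡ x) (sym (ℚP.*-zeroˡ y))

  ⟦⟧-≥0 : (P? : Dec P) → 0ℚ ℚ.≤ ⟦ P? ⟧
  ⟦⟧-≥0 (yes _) = ℚP.nonNegative⁻¹ 1ℚ
  ⟦⟧-≥0 (no _)  = ℚP.≤-refl

  ⟦⟧-≤1 : (P? : Dec P) → ⟦ P? ⟧ ℚ.≤ 1ℚ
  ⟦⟧-≤1 (yes _) = ℚP.≤-refl
  ⟦⟧-≤1 (no _)  = ℚP.nonNegative⁻¹ 1ℚ

⟦⟧-cong : ∀ {P Q : Set} (P? : Dec P) (Q? : Dec Q) → (P → Q) → (Q → P) → ⟦ P? ⟧ ≡ ⟦ Q? ⟧
⟦⟧-cong (yes p) Q? f g = sym (⟦⟧-yes Q? (f p))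
⟦⟧-cong (no ¬p) Q? f g = sym (⟦⟧-no Q? (¬p ∘ g))

⟦⟧-× : ∀ {P Q : Set} (P? : Dec P) (Q? : Dec Q) → ⟦ P? ×-dec Q? ⟧ ≡ ⟦ P? ⟧ * ⟦ Q? ⟧
⟦⟧-× (yes _) (yes _) = refl
⟦⟧-× (yes _) (no _)  = refl
⟦⟧-× (no _)  Q?      = sym (ℚP.*-zeroˡ ⟦ Q? ⟧)

module _ {A : Set} where

  ∑-cong-∈ : ∀ (xs : List A) {f g : A → ℚ} → (∀ {x} → x ∈ˡ xs → f x ≡ g x) → ∑ xs f ≡ ∑ xs g
  ∑-cong-∈ []       eq = refl
  ∑-cong-∈ (x ∷ xs) eq = cong₂ _+_ (eq (here refl)) (∑-cong-∈ xs (eq ∘ there))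

  ∑-cong : ∀ (xs : List A) {f g : A → ℚ} → (∀ x → f x ≡ g x) → ∑ xs f ≡ ∑ xs g
  ∑-cong xs eq = ∑-cong-∈ xs (λ {x} _ → eq x)

  ∑-zero : ∀ (xs : List A) {f : A → ℚ} → (∀ {x} → x ∈ˡ xs → f x ≡ 0ℚ) → ∑ xs f ≡ 0ℚ
  ∑-zero []       eq = refl
  ∑-zero (x ∷ xs) eq = cong₂ _+_ (eq (here refl)) (∑-zero xs (eq ∘ there))

  ∑-+ : ∀ (xs : List A) (f g : A → ℚ) → ∑ xs (λ x → f x + g x) ≡ ∑ xs f + ∑ xs g
  ∑-+ []       f g = refl
  ∑-+ (x ∷ xs) f g = trans (cong (_+_ (f x + g x)) (∑-+ xs f g))
    (solve 4 (λ a b c d → (a :+ b) :+ (c :+ d) := (a :+ c) :+ (b :+ d)) refl (f x) (g x) (∑ xs f) (∑ xs g))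

  ∑-*ˡ : ∀ (xs : List A) c (f : A → ℚ) → ∑ xs (λ x → c * f x) ≡ c * ∑ xs f
  ∑-*ˡ []       c f = sym (ℚP.*-zeroʳ c)
  ∑-*ˡ (x ∷ xs) c f = trans (cong (_+_ (c * f x)) (∑-*ˡ xs c f)) (sym (ℚP.*-distribˡ-+ c (f x) (∑ xs f)))

  ∑-++ : ∀ (xs ys : List A) (f : A → ℚ) → ∑ (xs ++ ys) f ≡ ∑ xs f + ∑ ys f
  ∑-++ []       ys f = sym (ℚP.+-identityˡ _)
  ∑-++ (x ∷ xs) ys f = trans (cong (f x +_) (∑-++ xs ys f)) (sym (ℚP.+-assoc (f x) _ _))

  ∑-filter : ∀ {P : A → Set} (P? : Decidable P) (xs : List A) (f : A → ℚ) →
    ∑ (filter P? xs) f ≡ ∑ xs (λ x → ⟦ P? x ⟧ * f x)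
  ∑-filter P? []       f = refl
  ∑-filter P? (x ∷ xs) f with P? x
  ... | yes _ = cong₂ _+_ (sym (ℚP.*-identityˡ (f x))) (∑-filter P? xs f)
  ... | no _  = trans (∑-filter P? xs f) (sym (trans (cong (_+ ∑ xs (λ x → ⟦ P? x ⟧ * f x)) (ℚP.*-zeroˡ (f x))) (ℚP.+-identityˡ _)))

  length-filter : ∀ {P : A → Set} (P? : Decidable P) (xs : List A) →
    ℕ→ℚ (length (filter P? xs)) ≡ ∑ xs (λ x → ⟦ P? x ⟧)
  length-filter P? []       = refl
  length-filter P? (x ∷ xs) with P? x
  ... | yes _ = trans (ℕ→ℚ-suc (length (filter P? xs))) (cong (1ℚ +_) (length-filter P? xs))
  ... | no _  = trans (length-filter P? xs) (sym (ℚP.+-identityˡ _))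

  ∑-mono-≤-∈ : ∀ (xs : List A) {f g : A → ℚ} → (∀ {x} → x ∈ˡ xs → f x ℚ.≤ g x) → ∑ xs f ℚ.≤ ∑ xs g
  ∑-mono-≤-∈ []       le = ℚP.≤-refl
  ∑-mono-≤-∈ (x ∷ xs) le = ℚP.+-mono-≤ (le (here refl)) (∑-mono-≤-∈ xs (le ∘ there))

  ∑-const : ∀ (xs : List A) c → ∑ xs (const c) ≡ ℕ→ℚ (length xs) * c
  ∑-const []       c = sym (ℚP.*-zeroˡ c)
  ∑-const (x ∷ xs) c = trans (cong (c +_) (∑-const xs c))
    (trans (solve 2 (λ c l → c :+ l :* c := (con 1ℚ :+ l) :* c) refl c (ℕ→ℚ (length xs)))
           (cong (_* c) (sym (ℕ→ℚ-suc (length xs)))))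

  ∑-≥0 : ∀ (xs : List A) {f : A → ℚ} → (∀ x → 0ℚ ℚ.≤ f x) → 0ℚ ℚ.≤ ∑ xs f
  ∑-≥0 []       le = ℚP.≤-refl
  ∑-≥0 (x ∷ xs) le = ℚP.+-mono-≤ (le x) (∑-≥0 xs le)

module _ {A B : Set} where

  ∑-map : ∀ (g : A → B) (xs : List A) (f : B → ℚ) → ∑ (map g xs) f ≡ ∑ xs (f ∘ g)
  ∑-map g []       f = refl
  ∑-map g (x ∷ xs) f = cong (f (g x) +_) (∑-map g xs f)

  ∑-concatMap : ∀ (g : A → List B) (xs : List A) (f : B → ℚ) →
    ∑ (concatMap g xs) f ≡ ∑ xs (λ x → ∑ (g x) f)
  ∑-concatMap g []       f = refl
  ∑-concatMap g (x ∷ xs) f = trans (∑-++ (g x) (concatMap g xs) f) (cong (∑ (g x) f +_) (∑-concatMap g xs f))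

  ∑-swap : ∀ (xs : List A) (ys : List B) (f : A → B → ℚ) →
    ∑ xs (λ x → ∑ ys (f x)) ≡ ∑ ys (λ y → ∑ xs (λ x → f x y))
  ∑-swap []       ys f = sym (∑-zero ys (λ _ → refl))
  ∑-swap (x ∷ xs) ys f = trans (cong (∑ ys (f x) +_) (∑-swap xs ys f))
    (sym (∑-+ ys (f x) (λ y → ∑ xs (λ x → f x y))))

∑-cartesianProduct : ∀ {A B : Set} (xs : List A) (ys : List B) (f : A × B → ℚ) →
  ∑ (cartesianProduct xs ys) f ≡ ∑ xs (λ x → ∑ ys (λ y → f (x , y)))
∑-cartesianProduct []       ys f = refl
∑-cartesianProduct (x ∷ xs) ys f = trans (∑-++ (map (x ,_) ys) (cartesianProduct xs ys) f)
  (cong₂ _+_ (∑-map (x ,_) ys f) (∑-cartesianProduct xs ys f))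

∑-tabulate : ∀ {A : Set} {n} (g : Fin n → A) (f : A → ℚ) → ∑ (tabulate g) f ≡ ∑ (allFin n) (f ∘ g)
∑-tabulate {n = n} g f = trans (cong (λ xs → ∑ xs f) (sym (ListP.map-tabulate id g))) (∑-map g (allFin n) f)

∑-allFin-suc : ∀ {n} (f : Fin (suc n) → ℚ) → ∑ (allFin (suc n)) f ≡ f zero + ∑ (allFin n) (f ∘ suc)
∑-allFin-suc f = cong (f zero +_) (∑-tabulate suc f)

∑-allFin-pick : ∀ {n} (k : Fin n) (f : Fin n → ℚ) → ∑ (allFin n) (λ i → ⟦ k FinP.≟ i ⟧ * f i) ≡ f k
∑-allFin-pick {suc n} zero f = trans (∑-allFin-suc {n} (λ i → ⟦ zero FinP.≟ i ⟧ * f i))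
  (trans (cong₂ _+_ (ℚP.*-identityˡ (f zero)) (∑-zero (allFin n) (λ {i} _ → ℚP.*-zeroˡ (f (suc i)))))
         (ℚP.+-identityʳ (f zero)))
∑-allFin-pick {suc n} (suc k) f = trans (∑-allFin-suc {n} (λ i → ⟦ suc k FinP.≟ i ⟧ * f i))
  (trans (cong₂ _+_ (ℚP.*-zeroˡ (f zero)) (∑-allFin-pick k (f ∘ suc)))
         (ℚP.+-identityˡ (f (suc k))))

-- Finite products of rationals

∏ : ∀ {A : Set} → List A → (A → ℚ) → ℚ
∏ xs f = foldr (λ x s → f x * s) 1ℚ xs

module _ {A : Set} where

  ∏-cong : ∀ (xs : List A) {f g : A → ℚ} → (∀ x → f x ≡ g x) → ∏ xs f ≡ ∏ xs g
  ∏-cong []       eq = refl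
  ∏-cong (x ∷ xs) eq = cong₂ _*_ (eq x) (∏-cong xs eq)

  ∏-one : ∀ (xs : List A) {f : A → ℚ} → (∀ x → f x ≡ 1ℚ) → ∏ xs f ≡ 1ℚ
  ∏-one []       eq = refl
  ∏-one (x ∷ xs) eq = cong₂ _*_ (eq x) (∏-one xs eq)

  ∏-* : ∀ (xs : List A) (f g : A → ℚ) → ∏ xs (λ x → f x * g x) ≡ ∏ xs f * ∏ xs g
  ∏-* []       f g = refl
  ∏-* (x ∷ xs) f g = trans (cong (_*_ (f x * g x)) (∏-* xs f g))
    (solve 4 (λ a b c d → (a :* b) :* (c :* d) := (a :* c) :* (b :* d)) refl (f x) (g x) (∏ xs f) (∏ xs g))

  ∏-≢0 : ∀ (xs : List A) {f : A → ℚ} → (∀ x → f x ≢ 0ℚ) → ∏ xs f ≢ 0ℚ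
  ∏-≢0 []       neq eq = ℚP.1≢0 eq
  ∏-≢0 (x ∷ xs) {f} neq eq = neq x (*-cancelʳ-≢0 (∏ xs f) (∏-≢0 xs neq) (trans eq (sym (ℚP.*-zeroˡ (∏ xs f)))))

  ∏-≥0 : ∀ (xs : List A) {f : A → ℚ} → (∀ x → 0ℚ ℚ.≤ f x) → 0ℚ ℚ.≤ ∏ xs f
  ∏-≥0 []       le = ℚP.nonNegative⁻¹ 1ℚ
  ∏-≥0 (x ∷ xs) le = 0≤* (le x) (∏-≥0 xs le)

∏-tabulate : ∀ {A : Set} {n} (g : Fin n → A) (f : A → ℚ) → ∏ (tabulate g) f ≡ ∏ (allFin n) (f ∘ g)
∏-tabulate {n = n} g f = trans (cong (λ xs → ∏ xs f) (sym (ListP.map-tabulate id g)))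
  (ListP.foldr-map (λ x s → f x * s) g 1ℚ (allFin n))

∏-allFin-suc : ∀ {n} (f : Fin (suc n) → ℚ) → ∏ (allFin (suc n)) f ≡ f zero * ∏ (allFin n) (f ∘ suc)
∏-allFin-suc f = cong (f zero *_) (∏-tabulate suc f)

-- Stated crosswise instead of as a quotient, so that no factor has to be nonzero. This is how
-- products over all vertices are compared when a single degree changes.
∏-allFin-replace : ∀ {n} (k : Fin n) (f g : Fin n → ℚ) → (∀ i → i ≢ k → f i ≡ g i) →
  ∏ (allFin n) f * g k ≡ f k * ∏ (allFin n) g
∏-allFin-replace {suc n} zero f g eq = begin
  ∏ (allFin (suc n)) f * g zero                 ≡⟨ cong (_* g zero) (∏-allFin-suc f) ⟩
  f zero * ∏ (allFin n) (f ∘ suc) * g zero      ≡⟨ cong (λ p → f zero * p * g zero) (∏-cong (allFin n) (λ i → eq (suc i) λ ())) ⟩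
  f zero * ∏ (allFin n) (g ∘ suc) * g zero      ≡⟨ solve 3 (λ a b c → a :* b :* c := a :* (c :* b)) refl (f zero) _ (g zero) ⟩
  f zero * (g zero * ∏ (allFin n) (g ∘ suc))    ≡⟨ cong (f zero *_) (sym (∏-allFin-suc g)) ⟩
  f zero * ∏ (allFin (suc n)) g                 ∎
  where open ≡-Reasoning
∏-allFin-replace {suc n} (suc k) f g eq = begin
  ∏ (allFin (suc n)) f * g (suc k)                        ≡⟨ cong (_* g (suc k)) (∏-allFin-suc f) ⟩
  f zero * ∏ (allFin n) (f ∘ suc) * g (suc k)             ≡⟨ ℚP.*-assoc (f zero) _ _ ⟩
  f zero * (∏ (allFin n) (f ∘ suc) * g (suc k))           ≡⟨ cong₂ _*_ (eq zero λ ()) (∏-allFin-replace k (f ∘ suc) (g ∘ suc) λ i i≢k → eq (suc i) (i≢k ∘ FinP.suc-injective)) ⟩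
  g zero * (f (suc k) * ∏ (allFin n) (g ∘ suc))           ≡⟨ solve 3 (λ a b c → a :* (b :* c) := b :* (a :* c)) refl (g zero) (f (suc k)) _ ⟩
  f (suc k) * (g zero * ∏ (allFin n) (g ∘ suc))           ≡⟨ cong (f (suc k) *_) (sym (∏-allFin-suc g)) ⟩
  f (suc k) * ∏ (allFin (suc n)) g                        ∎
  where open ≡-Reasoning

-- Removing one element, and sublists

module _ {A : Set} where

  -- Equal entries are selected once per position. Parallel arcs thereby count as distinct without
  -- explicit labels; the same holds for `sublists`.
  select : List A → List (A × List A)
  select []       = []
  select (x ∷ xs) = (x , xs) ∷ map (λ (y , ys) → y , x ∷ ys) (select xs)

  sublists : List A → List (List A)
  sublists []       = [] ∷ []
  sublists (x ∷ xs) = sublists xs ++ map (x ∷_) (sublists xs)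

  ∑-select-∷ : ∀ x xs (k : A × List A → ℚ) →
    ∑ (select (x ∷ xs)) k ≡ k (x , xs) + ∑ (select xs) (λ (y , ys) → k (y , x ∷ ys))
  ∑-select-∷ x xs k = cong (k (x , xs) +_) (∑-map _ (select xs) k)

  ∑-sublists-∷ : ∀ x xs (k : List A → ℚ) →
    ∑ (sublists (x ∷ xs)) k ≡ ∑ (sublists xs) k + ∑ (sublists xs) (λ T → k (x ∷ T))
  ∑-sublists-∷ x xs k = trans (∑-++ (sublists xs) _ k) (cong (∑ (sublists xs) k +_) (∑-map (x ∷_) (sublists xs) k))

  select-↭ : ∀ xs {y ys} → (y , ys) ∈ˡ select xs → xs ↭ y ∷ ys
  select-↭ (x ∷ xs) (here refl) = ↭-refl
  select-↭ (x ∷ xs) (there p) with ∈P.∈-map⁻ _ p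
  ... | (y , ys) , q , refl = ↭-trans (prep x (select-↭ xs q)) (swap x y ↭-refl)

  sublists-⊆ : ∀ xs {T} → T ∈ˡ sublists xs → ∀ {y} → y ∈ˡ T → y ∈ˡ xs
  sublists-⊆ []       (here refl) ()
  sublists-⊆ (x ∷ xs) p y∈T with ∈P.∈-++⁻ (sublists xs) p
  ... | inj₁ q = there (sublists-⊆ xs q y∈T)
  ... | inj₂ q with ∈P.∈-map⁻ (x ∷_) q
  ...   | T , r , refl with y∈T
  ...     | here refl = here refl
  ...     | there y∈  = there (sublists-⊆ xs r y∈)

  ∑-select-proj₁ : ∀ xs (f : A → ℚ) → ∑ (select xs) (f ∘ proj₁) ≡ ∑ xs f
  ∑-select-proj₁ []       f = refl
  ∑-select-proj₁ (x ∷ xs) f = trans (∑-select-∷ x xs (f ∘ proj₁)) (cong (f x +_) (∑-select-proj₁ xs f))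

  -- Two positions can be removed in either order and leave the same list, so the ordered pairs of
  -- positions are merely renamed.
  ∑-select-select : ∀ xs (k : A → A → List A → ℚ) →
    ∑ (select xs) (λ (y , ys) → ∑ (select ys) (λ (z , zs) → k y z zs)) ≡
    ∑ (select xs) (λ (y , ys) → ∑ (select ys) (λ (z , zs) → k z y zs))
  ∑-select-select []       k = refl
  ∑-select-select (x ∷ xs) k = begin
    ∑ (select (x ∷ xs)) (λ (y , ys) → ∑ (select ys) (λ (z , zs) → k y z zs))
      ≡⟨ expand k ⟩
    a + (b + ∑ (select xs) (λ (y , ys) → ∑ (select ys) (λ (z , zs) → k y z (x ∷ zs))))
      ≡⟨ cong (λ c → a + (b + c)) (∑-select-select xs (λ y z zs → k y z (x ∷ zs))) ⟩
    a + (b + c)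
      ≡⟨ solve 3 (λ a b c → a :+ (b :+ c) := b :+ (a :+ c)) refl a b c ⟩
    b + (a + c)
      ≡⟨ sym (expand (λ y z → k z y)) ⟩
    ∑ (select (x ∷ xs)) (λ (y , ys) → ∑ (select ys) (λ (z , zs) → k z y zs)) ∎
    where
    open ≡-Reasoning
    a = ∑ (select xs) (λ (z , zs) → k x z zs)
    b = ∑ (select xs) (λ (y , ys) → k y x ys)
    c = ∑ (select xs) (λ (y , ys) → ∑ (select ys) (λ (z , zs) → k z y (x ∷ zs)))
    expand : ∀ (k : A → A → List A → ℚ) →
      ∑ (select (x ∷ xs)) (λ (y , ys) → ∑ (select ys) (λ (z , zs) → k y z zs)) ≡
      ∑ (select xs) (λ (z , zs) → k x z zs) + (∑ (select xs) (λ (y , ys) → k y x ys) +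
        ∑ (select xs) (λ (y , ys) → ∑ (select ys) (λ (z , zs) → k y z (x ∷ zs))))
    expand k = trans (∑-select-∷ x xs (λ (y , ys) → ∑ (select ys) (λ (z , zs) → k y z zs))) (cong (∑ (select xs) (λ (z , zs) → k x z zs) +_)
      (trans (∑-cong (select xs) (λ (y , ys) → ∑-select-∷ x ys (λ (z , zs) → k y z zs)))
             (∑-+ (select xs) (λ (y , ys) → k y x ys) (λ (y , ys) → ∑ (select ys) (λ (z , zs) → k y z (x ∷ zs))))))

  -- Permuting the list permutes its sets of positions, but a sublist containing two swapped entries
  -- lists them in the other order; for these `k` has to be symmetric.
  ∑-sublists-↭ : ∀ {xs ys} (k : List A → ℚ) → (∀ {T T′} → T ↭ T′ → k T ≡ k T′) →
    xs ↭ ys → ∑ (sublists xs) k ≡ ∑ (sublists ys) k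
  ∑-sublists-↭ k resp Perm.refl = refl
  ∑-sublists-↭ k resp (prep {xs} {ys} x p) = begin
    ∑ (sublists (x ∷ xs)) k                                     ≡⟨ ∑-sublists-∷ x xs k ⟩
    ∑ (sublists xs) k + ∑ (sublists xs) (λ T → k (x ∷ T))       ≡⟨ cong₂ _+_ (∑-sublists-↭ k resp p) (∑-sublists-↭ (λ T → k (x ∷ T)) (resp ∘ prep x) p) ⟩
    ∑ (sublists ys) k + ∑ (sublists ys) (λ T → k (x ∷ T))       ≡⟨ sym (∑-sublists-∷ x ys k) ⟩
    ∑ (sublists (x ∷ ys)) k                                     ∎
    where open ≡-Reasoning
  ∑-sublists-↭ k resp (swap {xs} {ys} x y p) = begin
    ∑ (sublists (x ∷ y ∷ xs)) k      ≡⟨ expand x y xs ⟩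
    S xs k + S xs (λ T → k (y ∷ T)) + (S xs (λ T → k (x ∷ T)) + S xs (λ T → k (x ∷ y ∷ T)))
      ≡⟨ cong₂ _+_ (cong₂ _+_ (∑-sublists-↭ k resp p) (∑-sublists-↭ (λ T → k (y ∷ T)) (resp ∘ prep y) p))
                   (cong₂ _+_ (∑-sublists-↭ (λ T → k (x ∷ T)) (resp ∘ prep x) p)
                              (trans (∑-sublists-↭ (λ T → k (x ∷ y ∷ T)) (resp ∘ prep x ∘ prep y) p)
                                     (∑-cong (sublists ys) (λ T → resp (swap x y ↭-refl))))) ⟩
    S ys k + S ys (λ T → k (y ∷ T)) + (S ys (λ T → k (x ∷ T)) + S ys (λ T → k (y ∷ x ∷ T)))
      ≡⟨ solve 4 (λ a b c d → a :+ b :+ (c :+ d) := a :+ c :+ (b :+ d)) refl (S ys k) _ _ _ ⟩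
    S ys k + S ys (λ T → k (x ∷ T)) + (S ys (λ T → k (y ∷ T)) + S ys (λ T → k (y ∷ x ∷ T)))
      ≡⟨ sym (expand y x ys) ⟩
    ∑ (sublists (y ∷ x ∷ ys)) k      ∎
    where
    open ≡-Reasoning
    S : List A → (List A → ℚ) → ℚ
    S zs = ∑ (sublists zs)
    expand : ∀ x y zs → S (x ∷ y ∷ zs) k ≡
      S zs k + S zs (λ T → k (y ∷ T)) + (S zs (λ T → k (x ∷ T)) + S zs (λ T → k (x ∷ y ∷ T)))
    expand x y zs = trans (∑-sublists-∷ x (y ∷ zs) k)
      (cong₂ _+_ (∑-sublists-∷ y zs k) (∑-sublists-∷ y zs (λ T → k (x ∷ T))))
  ∑-sublists-↭ k resp (Perm.trans p q) = trans (∑-sublists-↭ k resp p) (∑-sublists-↭ k resp q)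

  -- Double counting of the pairs (x , T) with x an element of xs left out by T.
  ∑-select-sublists : ∀ xs (w : A → ℚ) (k : List A → ℚ) →
    ∑ (select xs) (λ (y , ys) → w y * ∑ (sublists ys) k) ≡
    ∑ (sublists xs) (λ T → (∑ xs w ℚ.- ∑ T w) * k T)
  ∑-select-sublists [] w k = sym (trans (ℚP.+-identityʳ _) (ℚP.*-zeroˡ (k [])))
  ∑-select-sublists (x ∷ xs) w k = begin
    ∑ (select (x ∷ xs)) (λ (y , ys) → w y * ∑ (sublists ys) k)
      ≡⟨ ∑-select-∷ x xs (λ (y , ys) → w y * ∑ (sublists ys) k) ⟩
    w x * S k + ∑ (select xs) (λ (y , ys) → w y * ∑ (sublists (x ∷ ys)) k)
      ≡⟨ cong (w x * S k +_) (∑-cong (select xs) λ (y , ys) →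
           trans (cong (w y *_) (∑-sublists-∷ x ys k)) (ℚP.*-distribˡ-+ (w y) _ _)) ⟩
    w x * S k + ∑ (select xs) (λ (y , ys) → w y * ∑ (sublists ys) k + w y * ∑ (sublists ys) (λ T → k (x ∷ T)))
      ≡⟨ cong (w x * S k +_) (trans (∑-+ (select xs) (λ (y , ys) → w y * ∑ (sublists ys) k) (λ (y , ys) → w y * ∑ (sublists ys) (λ T → k (x ∷ T))))
           (cong₂ _+_ (∑-select-sublists xs w k) (∑-select-sublists xs w (λ T → k (x ∷ T))))) ⟩
    w x * S k + (S (λ T → (q ℚ.- ∑ T w) * k T) + S (λ T → (q ℚ.- ∑ T w) * k (x ∷ T)))
      ≡⟨ sym (ℚP.+-assoc (w x * S k) _ _) ⟩
    w x * S k + S (λ T → (q ℚ.- ∑ T w) * k T) + S (λ T → (q ℚ.- ∑ T w) * k (x ∷ T))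
      ≡⟨ cong₂ _+_
           (trans (cong (_+ S (λ T → (q ℚ.- ∑ T w) * k T)) (sym (∑-*ˡ (sublists xs) (w x) k)))
           (trans (sym (∑-+ (sublists xs) (λ T → w x * k T) (λ T → (q ℚ.- ∑ T w) * k T))) (∑-cong (sublists xs) λ T →
             solve 4 (λ a b c d → a :* b :+ (c :- d) :* b := (a :+ c :- d) :* b) refl (w x) (k T) q (∑ T w))))
           (∑-cong (sublists xs) λ T →
             solve 4 (λ a b c d → (c :- d) :* b := (a :+ c :- (a :+ d)) :* b) refl (w x) (k (x ∷ T)) q (∑ T w)) ⟩
    S (λ T → (w x + q ℚ.- ∑ T w) * k T) + S (λ T → (w x + q ℚ.- (w x + ∑ T w)) * k (x ∷ T))
      ≡⟨ sym (∑-sublists-∷ x xs (λ T → (w x + q ℚ.- ∑ T w) * k T)) ⟩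
    ∑ (sublists (x ∷ xs)) (λ T → (w x + q ℚ.- ∑ T w) * k T) ∎
    where
    open ≡-Reasoning
    S = ∑ (sublists xs)
    q = ∑ xs w

-- Degrees, trails and arborescences of a list of arcs

count-yes : ∀ {A : Set} (_≟_ : DecidableEquality A) {y x} xs → y ≡ x → count _≟_ y (x ∷ xs) ≡ suc (count _≟_ y xs)
count-yes _≟_ {y} {x} xs eq = cong length (ListP.filter-accept (y ≟_) eq)

count-no : ∀ {A : Set} (_≟_ : DecidableEquality A) {y x} xs → y ≢ x → count _≟_ y (x ∷ xs) ≡ count _≟_ y xs
count-no _≟_ {y} {x} xs neq = cong length (ListP.filter-reject (y ≟_) neq)

count-↭ : ∀ {A : Set} (_≟_ : DecidableEquality A) y {xs ys} → xs ↭ ys → count _≟_ y xs ≡ count _≟_ y ys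
count-↭ _≟_ y p = PermP.↭-length (PermP.filter-↭ (y ≟_) p)

count≢0⇒∈ : ∀ {A : Set} (_≟_ : DecidableEquality A) y xs → count _≟_ y xs ≢ 0 → y ∈ˡ xs
count≢0⇒∈ _≟_ y []       c≢0 = ⊥-elim (c≢0 refl)
count≢0⇒∈ _≟_ y (x ∷ xs) c≢0 with y ≟ x
... | yes y≡x = here y≡x
... | no  _   = there (count≢0⇒∈ _≟_ y xs c≢0)

∈⇒count≢0 : ∀ {A : Set} (_≟_ : DecidableEquality A) {y xs} → y ∈ˡ xs → count _≟_ y xs ≢ 0
∈⇒count≢0 _≟_ {y} {x ∷ xs} (here y≡x) eq with trans (sym (count-yes _≟_ xs y≡x)) eq
... | ()
∈⇒count≢0 _≟_ {y} {x ∷ xs} (there p) eq with y ≟ x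
... | yes _ with eq
...   | ()
∈⇒count≢0 _≟_ {y} {x ∷ xs} (there p) eq | no _ = ∈⇒count≢0 _≟_ p eq

module _ {n : ℕ} where

  src tgt : Arc n → Fin n
  src = proj₁
  tgt = proj₂

  out inn : List (Arc n) → Fin n → ℕ
  out as v = count FinP._≟_ v (map src as)
  inn as v = count FinP._≟_ v (map tgt as)

  ℕ→ℚ-out : ∀ as v → ℕ→ℚ (out as v) ≡ ∑ as (λ a → ⟦ v FinP.≟ src a ⟧)
  ℕ→ℚ-out as v = trans (length-filter (v FinP.≟_) (map src as)) (∑-map src as (λ u → ⟦ v FinP.≟ u ⟧))

  out-↭ : ∀ {as bs} → as ↭ bs → ∀ v → out as v ≡ out bs v
  out-↭ p v = count-↭ FinP._≟_ v (PermP.map⁺ src p)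

  out≢0⇒∈ : ∀ as v → out as v ≢ 0 → ∃ λ w → (v , w) ∈ˡ as
  out≢0⇒∈ as v o≢0 with ∈P.∈-map⁻ src (count≢0⇒∈ FinP._≟_ v (map src as) o≢0)
  ... | (_ , w) , p , refl = w , p

  ∈⇒out≢0 : ∀ {as v w} → (v , w) ∈ˡ as → out as v ≢ 0
  ∈⇒out≢0 p = ∈⇒count≢0 FinP._≟_ (∈P.∈-map⁺ src p)

  ∈⇒inn≢0 : ∀ {as v w} → (w , v) ∈ˡ as → inn as v ≢ 0
  ∈⇒inn≢0 p = ∈⇒count≢0 FinP._≟_ (∈P.∈-map⁺ tgt p)

  -- The number of trails from u to r that use L of the labelled arcs in as, each
  -- at most once; every arc is used when L is the length of as.
  trails : ℕ → List (Arc n) → Fin n → Fin n → ℚ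
  trails zero    as u r = ⟦ u FinP.≟ r ⟧
  trails (suc L) as u r = ∑ (select as) (λ (a , bs) → ⟦ u FinP.≟ src a ⟧ * trails L bs (tgt a) r)

  -- The first and the last arc of a trail with at least two arcs occupy different positions and can
  -- be removed in either order, by `∑-select-select`; with one arc they coincide.
  trails-last : ∀ L as u r →
    trails (suc L) as u r ≡ ∑ (select as) (λ (a , bs) → ⟦ r FinP.≟ tgt a ⟧ * trails L bs u (src a))
  trails-last zero as u r = ∑-cong (select as) (λ (a , bs) →
    trans (ℚP.*-comm ⟦ u FinP.≟ src a ⟧ ⟦ tgt a FinP.≟ r ⟧)
          (cong (_* ⟦ u FinP.≟ src a ⟧) (⟦⟧-cong (tgt a FinP.≟ r) (r FinP.≟ tgt a) sym sym)))
  trails-last (suc L) as u r = begin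
    ∑ (select as) (λ (a , bs) → ⟦ u FinP.≟ src a ⟧ * trails (suc L) bs (tgt a) r)
      ≡⟨ ∑-cong (select as) (λ (a , bs) → trans (cong (⟦ u FinP.≟ src a ⟧ *_) (trails-last L bs (tgt a) r))
           (sym (∑-*ˡ (select bs) ⟦ u FinP.≟ src a ⟧ (λ (b , cs) → ⟦ r FinP.≟ tgt b ⟧ * trails L cs (tgt a) (src b))))) ⟩
    ∑ (select as) (λ (a , bs) → ∑ (select bs) (λ (b , cs) → ⟦ u FinP.≟ src a ⟧ * (⟦ r FinP.≟ tgt b ⟧ * trails L cs (tgt a) (src b))))
      ≡⟨ ∑-select-select as (λ a b cs → ⟦ u FinP.≟ src a ⟧ * (⟦ r FinP.≟ tgt b ⟧ * trails L cs (tgt a) (src b))) ⟩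
    ∑ (select as) (λ (a , bs) → ∑ (select bs) (λ (b , cs) → ⟦ u FinP.≟ src b ⟧ * (⟦ r FinP.≟ tgt a ⟧ * trails L cs (tgt b) (src a))))
      ≡⟨ ∑-cong (select as) (λ (a , bs) → trans (∑-cong (select bs) (λ (b , cs) →
             solve 3 (λ x y z → x :* (y :* z) := y :* (x :* z)) refl ⟦ u FinP.≟ src b ⟧ ⟦ r FinP.≟ tgt a ⟧ (trails L cs (tgt b) (src a))))
           (∑-*ˡ (select bs) ⟦ r FinP.≟ tgt a ⟧ (λ (b , cs) → ⟦ u FinP.≟ src b ⟧ * trails L cs (tgt b) (src a)))) ⟩
    ∑ (select as) (λ (a , bs) → ⟦ r FinP.≟ tgt a ⟧ * trails (suc L) bs u (src a)) ∎
    where open ≡-Reasoning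

  -- Paths and spanning arborescences

  Path : List (Arc n) → Fin n → Fin n → Set
  Path T = Star (λ u v → (u , v) ∈ˡ T)

  Path-⊆ : ∀ {S T} → (∀ {a} → a ∈ˡ S → a ∈ˡ T) → ∀ {u v} → Path S u v → Path T u v
  Path-⊆ S⊆T = Star.map S⊆T

  -- Warshall's algorithm, with arcs in place of vertices.
  Reach : List (Arc n) → Fin n → Fin n → Set
  Reach []      u v = u ≡ v
  Reach (a ∷ T) u v = Reach T u v ⊎ (Reach T u (src a) × Reach T (tgt a) v)

  reach? : ∀ T u v → Dec (Reach T u v)
  reach? []      u v = u FinP.≟ v
  reach? (a ∷ T) u v = reach? T u v ⊎-dec (reach? T u (src a) ×-dec reach? T (tgt a) v)

  Reach⇒Path : ∀ T {u v} → Reach T u v → Path T u v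
  Reach⇒Path []      refl           = ε
  Reach⇒Path (a ∷ T) (inj₁ p)       = Path-⊆ there (Reach⇒Path T p)
  Reach⇒Path (a ∷ T) (inj₂ (p , q)) =
    Path-⊆ there (Reach⇒Path T p) ◅◅ (here refl ◅ Path-⊆ there (Reach⇒Path T q))

  Reach-refl : ∀ T {u} → Reach T u u
  Reach-refl []      = refl
  Reach-refl (a ∷ T) = inj₁ (Reach-refl T)

  Reach-◅ : ∀ T {u v w} → (u , v) ∈ˡ T → Reach T v w → Reach T u w
  Reach-◅ (a ∷ T) (here refl) (inj₁ p)       = inj₂ (Reach-refl T , p)
  -- The path from `v` comes back to `u` to use the arc `a` again; what follows that use already
  -- starts at `v`.
  Reach-◅ (a ∷ T) (here refl) (inj₂ (_ , q)) = inj₂ (Reach-refl T , q)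
  Reach-◅ (a ∷ T) (there e)   (inj₁ p)       = inj₁ (Reach-◅ T e p)
  Reach-◅ (a ∷ T) (there e)   (inj₂ (p , q)) = inj₂ (Reach-◅ T e p , q)

  Path⇒Reach : ∀ T {u v} → Path T u v → Reach T u v
  Path⇒Reach T ε       = Reach-refl T
  Path⇒Reach T (e ◅ p) = Reach-◅ T e (Path⇒Reach T p)

  path? : ∀ T u v → Dec (Path T u v)
  path? T u v = map′ (Reach⇒Path T) (Path⇒Reach T) (reach? T u v)

  -- D is the outdegree in the ambient multi-digraph: the vertices to be spanned
  -- are those with D v ≢ 0.
  Arborescence : Fin n → (Fin n → ℕ) → List (Arc n) → Set
  Arborescence r D T =
      out T r ≡ 0
    × (∀ v → D v ≢ 0 → v ≢ r → out T v ≡ 1)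
    × (∀ v → D v ≢ 0 → v ≢ r → Path T v r)

  arborescence? : ∀ r D → Decidable (Arborescence r D)
  arborescence? r D T =
    (out T r ℕP.≟ 0) ×-dec
    FinP.all? (λ v → ¬? (D v ℕP.≟ 0) →-dec (¬? (v FinP.≟ r) →-dec (out T v ℕP.≟ 1))) ×-dec
    FinP.all? (λ v → ¬? (D v ℕP.≟ 0) →-dec (¬? (v FinP.≟ r) →-dec path? T v r))

  arborescences : Fin n → (Fin n → ℕ) → List (Arc n) → ℚ
  arborescences r D as = ∑ (sublists as) (λ T → ⟦ arborescence? r D T ⟧)

  Arborescence-↭ : ∀ {r D S T} → S ↭ T → Arborescence r D S → Arborescence r D T
  Arborescence-↭ p (a , b , c) =
    trans (sym (out-↭ p _)) a ,
    (λ v x y → trans (sym (out-↭ p v)) (b v x y)) ,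
    (λ v x y → Path-⊆ (PermP.∈-resp-↭ p) (c v x y))

  ⟦arborescence⟧-↭ : ∀ {r D S T} → S ↭ T → ⟦ arborescence? r D S ⟧ ≡ ⟦ arborescence? r D T ⟧
  ⟦arborescence⟧-↭ {r} {D} {S} {T} p = ⟦⟧-cong (arborescence? r D S) (arborescence? r D T)
    (Arborescence-↭ {D = D} p) (Arborescence-↭ {D = D} (↭-sym p))

  -- `Arborescence` depends on `D` only through its support away from `r`. Deleting an arc keeps
  -- this support unless it is the last arc leaving a vertex other than the root.
  arborescences-cong : ∀ {r D D′} as → (∀ v → v ≢ r → D v ≢ 0 → D′ v ≢ 0) → (∀ v → v ≢ r → D′ v ≢ 0 → D v ≢ 0) →
    arborescences r D as ≡ arborescences r D′ as
  arborescences-cong {r} {D} {D′} as f g = ∑-cong (sublists as) λ T →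
    ⟦⟧-cong (arborescence? r D T) (arborescence? r D′ T)
      (λ (a , b , c) → a , (λ v x y → b v (g v y x) y) , (λ v x y → c v (g v y x) y))
      (λ (a , b , c) → a , (λ v x y → b v (f v y x) y) , (λ v x y → c v (f v y x) y))

  -- Summing over the arcs a leaving u counts the pairs of an arborescence and an
  -- arc leaving u outside of it.
  ∑-select-arborescences : ∀ r D as u δ → (∀ T → Arborescence r D T → out T u ≡ δ) →
    ∑ (select as) (λ (a , bs) → ⟦ u FinP.≟ src a ⟧ * arborescences r D bs) ≡
    (ℕ→ℚ (out as u) ℚ.- ℕ→ℚ δ) * arborescences r D as
  ∑-select-arborescences r D as u δ outδ = begin
    ∑ (select as) (λ (a , bs) → ⟦ u FinP.≟ src a ⟧ * arborescences r D bs)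
      ≡⟨ ∑-select-sublists as (λ a → ⟦ u FinP.≟ src a ⟧) (λ T → ⟦ arborescence? r D T ⟧) ⟩
    ∑ (sublists as) (λ T → (∑ as (λ a → ⟦ u FinP.≟ src a ⟧) ℚ.- ∑ T (λ a → ⟦ u FinP.≟ src a ⟧)) * ⟦ arborescence? r D T ⟧)
      ≡⟨ ∑-cong (sublists as) (λ T → trans (ℚP.*-comm _ ⟦ arborescence? r D T ⟧) (trans
           (⟦⟧-*-cong (arborescence? r D T) (λ arb → cong₂ ℚ._-_ (sym (ℕ→ℚ-out as u))
             (trans (sym (ℕ→ℚ-out T u)) (cong ℕ→ℚ (outδ T arb))))) (ℚP.*-comm ⟦ arborescence? r D T ⟧ _))) ⟩
    ∑ (sublists as) (λ T → (ℕ→ℚ (out as u) ℚ.- ℕ→ℚ δ) * ⟦ arborescence? r D T ⟧)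
      ≡⟨ ∑-*ˡ (sublists as) (ℕ→ℚ (out as u) ℚ.- ℕ→ℚ δ) (λ T → ⟦ arborescence? r D T ⟧) ⟩
    (ℕ→ℚ (out as u) ℚ.- ℕ→ℚ δ) * arborescences r D as ∎
    where open ≡-Reasoning

  arborescences-∷ : ∀ r D {as a bs} → as ↭ a ∷ bs →
    arborescences r D as ≡ arborescences r D bs + ∑ (sublists bs) (λ T → ⟦ arborescence? r D (a ∷ T) ⟧)
  arborescences-∷ r D {as} {a} {bs} p = trans
    (∑-sublists-↭ (λ T → ⟦ arborescence? r D T ⟧) (⟦arborescence⟧-↭ {r} {D}) p)
    (∑-sublists-∷ a bs (λ T → ⟦ arborescence? r D T ⟧))

  -- An arborescence has no arc leaving its root, so those containing `a` contribute nothing in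
  -- `arborescences-∷`.
  arborescences-root-arc : ∀ r D {as a bs} → as ↭ a ∷ bs → src a ≡ r →
    arborescences r D as ≡ arborescences r D bs
  arborescences-root-arc r D {as} {a} {bs} p refl = trans (arborescences-∷ r D p)
    (trans (cong (arborescences r D bs +_) (∑-zero (sublists bs) λ {T} _ →
      ⟦⟧-no (arborescence? r D (a ∷ T)) (λ arb → ∈⇒out≢0 {a ∷ T} (here refl) (proj₁ arb))))
      (ℚP.+-identityʳ _))

  -- A vertex u ≢ r with a single outgoing arc and no incoming one is a leaf of
  -- every arborescence.
  arborescences-leaf : ∀ {r as a bs} → as ↭ a ∷ bs → src a ≢ r → out bs (src a) ≡ 0 →
    (∀ {v} → (v , src a) ∈ˡ as → ⊥) → (tgt a ≢ r → out bs (tgt a) ≢ 0) →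
    arborescences r (out bs) bs ≡ arborescences r (out as) as
  arborescences-leaf {r} {as} {a@(u , w)} {bs} p u≢r out-u no-in out-w = sym (begin
    arborescences r (out as) as
      ≡⟨ arborescences-∷ r (out as) p ⟩
    arborescences r (out as) bs + ∑ (sublists bs) (λ T → ⟦ arborescence? r (out as) (a ∷ T) ⟧)
      ≡⟨ cong₂ _+_
           (∑-zero (sublists bs) λ {T} T⊂bs → ⟦⟧-no (arborescence? r (out as) T) λ (_ , one , _) →
             let q = proj₂ (out≢0⇒∈ T u (λ eq → ℕP.1+n≢0 (trans (sym (one u out-as-u u≢r)) eq)))
             in ∈⇒out≢0 (sublists-⊆ bs T⊂bs q) out-u)
           (∑-cong-∈ (sublists bs) λ {T} T⊂bs →
             ⟦⟧-cong (arborescence? r (out as) (a ∷ T)) (arborescence? r (out bs) T) (to T T⊂bs) (from T T⊂bs)) ⟩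
    0ℚ + arborescences r (out bs) bs
      ≡⟨ ℚP.+-identityˡ _ ⟩
    arborescences r (out bs) bs ∎)
    where
    open ≡-Reasoning
    out-as-u : out as u ≢ 0
    out-as-u = ∈⇒out≢0 (PermP.∈-resp-↭ (↭-sym p) (here refl))
    out-as : ∀ v → v ≢ u → out as v ≡ out bs v
    out-as v v≢u = trans (out-↭ p v) (count-no FinP._≟_ (map src bs) v≢u)
    out-∷ : ∀ T v → v ≢ u → out (a ∷ T) v ≡ out T v
    out-∷ T v v≢u = count-no FinP._≟_ (map src T) v≢u
    v≢u : ∀ {v} → out bs v ≢ 0 → v ≢ u
    v≢u o refl = o out-u
    module _ (T : List (Arc n)) (T⊂bs : T ∈ˡ sublists bs) where
      -- Using `a` requires standing at `u`, and no arc leads there; a path that starts elsewhere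
      -- stays inside `T`.
      avoid : ∀ {v} → Path (a ∷ T) v r → v ≢ u → Path T v r
      avoid ε               _   = ε
      avoid (here refl ◅ q) v≢u = ⊥-elim (v≢u refl)
      avoid (there e ◅ q)   _   = e ◅ avoid q λ where
        refl → no-in (PermP.∈-resp-↭ (↭-sym p) (there (sublists-⊆ bs T⊂bs e)))
      to : Arborescence r (out as) (a ∷ T) → Arborescence r (out bs) T
      to (root , one , path) =
        trans (sym (out-∷ T r (u≢r ∘ sym))) root ,
        (λ v o v≢r → trans (sym (out-∷ T v (v≢u o))) (one v (o ∘ trans (sym (out-as v (v≢u o)))) v≢r)) ,
        (λ v o v≢r → avoid (path v (o ∘ trans (sym (out-as v (v≢u o)))) v≢r) (v≢u o))
      out-T-u : out T u ≡ 0
      out-T-u with out T u ℕP.≟ 0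
      ... | yes eq = eq
      ... | no neq = ⊥-elim (∈⇒out≢0 (sublists-⊆ bs T⊂bs (proj₂ (out≢0⇒∈ T u neq))) out-u)
      from : Arborescence r (out bs) T → Arborescence r (out as) (a ∷ T)
      from (root , one , path) = trans (out-∷ T r (u≢r ∘ sym)) root , one′ , path′
        where
        one-by-cases : ∀ v → Dec (v ≡ u) → out as v ≢ 0 → v ≢ r → out (a ∷ T) v ≡ 1
        one-by-cases v (yes refl) o v≢r = trans (count-yes FinP._≟_ (map src T) refl) (cong suc out-T-u)
        one-by-cases v (no v≢u)   o v≢r = trans (out-∷ T v v≢u) (one v (o ∘ trans (out-as v v≢u)) v≢r)
        one′ : ∀ v → out as v ≢ 0 → v ≢ r → out (a ∷ T) v ≡ 1
        one′ v = one-by-cases v (v FinP.≟ u)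
        -- The leaf `u` hangs on `w`, which either is the root or still has an outgoing arc in `bs`
        -- and hence is spanned by `T`.
        path-w : Path T w r
        path-w with w FinP.≟ r
        ... | yes refl = ε
        ... | no w≢r   = path w (out-w w≢r) w≢r
        path′ : ∀ v → out as v ≢ 0 → v ≢ r → Path (a ∷ T) v r
        path′ v o v≢r with v FinP.≟ u
        ... | yes refl = here refl ◅ Path-⊆ there path-w
        ... | no v≢u   = Path-⊆ there (path v (o ∘ trans (out-as v v≢u)) v≢r)

-- The BEST theorem

-- The degree condition for a trail from `u` to `r` through all arcs: every visit but the last is
-- the source of an arc, every visit but the first a target. As a permutation it covers `u ≡ r` as
-- well, and removing an arc at either end of the trail is a cancellation.
Balanced : ∀ {n} → List (Arc n) → Fin n → Fin n → Set
Balanced as u r = r ∷ map src as ↭ u ∷ map tgt as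

Balanced-rest : ∀ {n} {as a} {bs : List (Arc n)} {r} → as ↭ a ∷ bs → Balanced as (src a) r → Balanced bs (tgt a) r
Balanced-rest {r = r} p bal = PermP.drop-∷ (↭-trans (swap _ r ↭-refl)
  (↭-trans (prep r (PermP.map⁺ src (↭-sym p))) (↭-trans bal (prep _ (PermP.map⁺ tgt p)))))

Balanced-restʳ : ∀ {n} {as a} {bs : List (Arc n)} {u} → as ↭ a ∷ bs → Balanced as u (tgt a) → Balanced bs u (src a)
Balanced-restʳ {u = u} p bal = PermP.drop-∷ (↭-trans (prep _ (PermP.map⁺ src (↭-sym p)))
  (↭-trans bal (↭-trans (prep u (PermP.map⁺ tgt p)) (swap u _ ↭-refl))))

module _ {n : ℕ} where

  -- Exits from v in a trail ending at r, not counting the arborescence arc at v.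
  exits : Fin n → Fin n → ℕ → ℕ
  exits r v k = if does (v FinP.≟ r) then k else k ∸ 1

  exits-root : ∀ r {v} k → v ≡ r → exits r v k ≡ k
  exits-root r {v} k v≡r with v FinP.≟ r
  ... | yes _  = refl
  ... | no v≢r = ⊥-elim (v≢r v≡r)

  exits-other : ∀ r {v} k → v ≢ r → exits r v k ≡ k ∸ 1
  exits-other r {v} k v≢r with v FinP.≟ r
  ... | yes v≡r = ⊥-elim (v≢r v≡r)
  ... | no _    = refl

  exitOrders : Fin n → List (Arc n) → ℚ
  exitOrders r as = ∏ (allFin n) (λ v → ℕ→ℚ (exits r v (out as v) !))

  exitOrders-∷ : ∀ r {as a bs} → as ↭ a ∷ bs → let u = src a in
    exitOrders r as * ℕ→ℚ (exits r u (out bs u) !) ≡ ℕ→ℚ (exits r u (out as u) !) * exitOrders r bs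
  exitOrders-∷ r {as} {a} {bs} p = ∏-allFin-replace (src a)
    (λ v → ℕ→ℚ (exits r v (out as v) !)) (λ v → ℕ→ℚ (exits r v (out bs v) !))
    (λ v v≢u → cong (λ k → ℕ→ℚ (exits r v k !)) (trans (out-↭ p v) (count-no FinP._≟_ (map src bs) v≢u)))

  out-src : ∀ {as : List (Arc n)} {a bs} → as ↭ a ∷ bs → out as (src a) ≡ suc (out bs (src a))
  out-src {a = a} {bs} p = trans (out-↭ p (src a)) (count-yes FinP._≟_ (map src bs) refl)

  -- The two products differ only in the factorial at the source of `a`, which loses its top factor.
  exitOrders-step : ∀ r {as a bs} → as ↭ a ∷ bs → let u = src a in ∀ k →
    exits r u (out as u) ≡ suc k → exits r u (out bs u) ≡ k →
    ℕ→ℚ (suc k) * exitOrders r bs ≡ exitOrders r as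
  exitOrders-step r {as} {a} {bs} p k eq₁ eq₂ = sym (*-cancelʳ-≢0 (ℕ→ℚ (k !)) (!≢0 k) (begin
    exitOrders r as * ℕ→ℚ (k !)                              ≡⟨ cong (λ l → exitOrders r as * ℕ→ℚ (l !)) (sym eq₂) ⟩
    exitOrders r as * ℕ→ℚ (exits r (src a) (out bs (src a)) !) ≡⟨ exitOrders-∷ r p ⟩
    ℕ→ℚ (exits r (src a) (out as (src a)) !) * exitOrders r bs ≡⟨ cong (λ l → ℕ→ℚ (l !) * exitOrders r bs) eq₁ ⟩
    ℕ→ℚ (suc k !) * exitOrders r bs                          ≡⟨ cong (_* exitOrders r bs) (ℕ→ℚ-* (suc k) (k !)) ⟩
    ℕ→ℚ (suc k) * ℕ→ℚ (k !) * exitOrders r bs                ≡⟨ solve 3 (λ x y z → x :* y :* z := x :* z :* y) refl (ℕ→ℚ (suc k)) (ℕ→ℚ (k !)) (exitOrders r bs) ⟩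
    ℕ→ℚ (suc k) * exitOrders r bs * ℕ→ℚ (k !)                ∎))
    where open ≡-Reasoning

  -- The only arc leaving `src a` is its arborescence arc, which `exits` leaves out; truncated
  -- subtraction makes the exits 0 both before and after the deletion.
  exitOrders-last : ∀ r {as a bs} → as ↭ a ∷ bs → src a ≢ r → out bs (src a) ≡ 0 →
    exitOrders r bs ≡ exitOrders r as
  exitOrders-last r {as} {a} {bs} p u≢r o = sym (*-cancelʳ-≢0 (ℕ→ℚ (exits r u (out bs u) !)) (!≢0 (exits r u (out bs u)))
    (trans (exitOrders-∷ r p) (trans (cong (λ l → ℕ→ℚ (l !) * exitOrders r bs) eq)
      (ℚP.*-comm _ (exitOrders r bs)))))
    where
    u = src a
    eq : exits r u (out as u) ≡ exits r u (out bs u)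
    eq = trans (exits-other r (out as u) u≢r)
      (trans (trans (cong (_∸ 1) (out-src p)) (trans o (sym (cong (_∸ 1) o))))
             (sym (exits-other r (out bs u) u≢r)))

  -- If `Balanced as u r` holds, then every endpoint of an arc other than `r` has an outgoing arc,
  -- so these arborescences span all endpoints.
  tree : Fin n → List (Arc n) → ℚ
  tree r as = arborescences r (out as) as

  module _ (L : ℕ) (as : List (Arc n)) (u r : Fin n)
    (IH : ∀ {a bs} → (a , bs) ∈ˡ select as → u ≡ src a → trails L bs (tgt a) r ≡ tree r bs * exitOrders r bs) where

    -- The case in which bs has the same vertices other than r to be spanned as as.
    best-branching : ∀ k δ → ℕ→ℚ (out as u) ℚ.- ℕ→ℚ δ ≡ ℕ→ℚ (suc k) →
      (∀ T → Arborescence r (out as) T → out T u ≡ δ) →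
      (∀ {a bs} → as ↭ a ∷ bs → u ≡ src a → tree r bs ≡ arborescences r (out as) bs) →
      (∀ {a bs} → as ↭ a ∷ bs → u ≡ src a → ℕ→ℚ (suc k) * exitOrders r bs ≡ exitOrders r as) →
      trails (suc L) as u r ≡ tree r as * exitOrders r as
    -- Here `δ` is the number of arcs by which an arborescence leaves `u`, and `suc k` the number of
    -- arcs leaving `u` outside of it. The latter is both the multiplicity in the double counting
    -- and the factor that `exitOrders` loses, which is why the two cancel.
    best-branching k δ eq outδ tree-eq orders-eq = *-cancelʳ-≢0 s (ℕ→ℚ-≢0 (suc k)) (begin
      trails (suc L) as u r * s
        ≡⟨ ℚP.*-comm _ s ⟩
      s * trails (suc L) as u r
        ≡⟨ sym (∑-*ˡ (select as) s (λ (a , bs) → ⟦ u FinP.≟ src a ⟧ * trails L bs (tgt a) r)) ⟩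
      ∑ (select as) (λ (a , bs) → s * (⟦ u FinP.≟ src a ⟧ * trails L bs (tgt a) r))
        ≡⟨ ∑-cong-∈ (select as) (λ {(a , bs)} sel → term sel) ⟩
      ∑ (select as) (λ (a , bs) → exitOrders r as * (⟦ u FinP.≟ src a ⟧ * arborescences r (out as) bs))
        ≡⟨ ∑-*ˡ (select as) (exitOrders r as) (λ (a , bs) → ⟦ u FinP.≟ src a ⟧ * arborescences r (out as) bs) ⟩
      exitOrders r as * ∑ (select as) (λ (a , bs) → ⟦ u FinP.≟ src a ⟧ * arborescences r (out as) bs)
        ≡⟨ cong (exitOrders r as *_) (trans (∑-select-arborescences r (out as) as u δ outδ) (cong (_* tree r as) eq)) ⟩
      exitOrders r as * (s * tree r as)
        ≡⟨ solve 3 (λ x y z → x :* (y :* z) := z :* x :* y) refl (exitOrders r as) s (tree r as) ⟩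
      tree r as * exitOrders r as * s ∎)
      where
      open ≡-Reasoning
      s = ℕ→ℚ (suc k)
      term : ∀ {a bs} → (a , bs) ∈ˡ select as →
        s * (⟦ u FinP.≟ src a ⟧ * trails L bs (tgt a) r) ≡
        exitOrders r as * (⟦ u FinP.≟ src a ⟧ * arborescences r (out as) bs)
      term {a} {bs} sel = begin
        s * (i * trails L bs (tgt a) r)
          ≡⟨ cong (s *_) (⟦⟧-*-cong (u FinP.≟ src a) λ u≡ → trans (IH sel u≡) (cong (_* exitOrders r bs) (tree-eq (select-↭ as sel) u≡))) ⟩
        s * (i * (arborescences r (out as) bs * exitOrders r bs))
          ≡⟨ solve 4 (λ s i x y → s :* (i :* (x :* y)) := i :* ((s :* y) :* x)) refl s i (arborescences r (out as) bs) (exitOrders r bs) ⟩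
        i * ((s * exitOrders r bs) * arborescences r (out as) bs)
          ≡⟨ ⟦⟧-*-cong (u FinP.≟ src a) (λ u≡ → cong (_* arborescences r (out as) bs) (orders-eq (select-↭ as sel) u≡)) ⟩
        i * (exitOrders r as * arborescences r (out as) bs)
          ≡⟨ solve 3 (λ i x y → i :* (x :* y) := x :* (i :* y)) refl i (exitOrders r as) (arborescences r (out as) bs) ⟩
        exitOrders r as * (i * arborescences r (out as) bs) ∎
        where i = ⟦ u FinP.≟ src a ⟧

    best-root : u ≡ r → Balanced as u r → length as ≡ suc L → trails (suc L) as u r ≡ tree r as * exitOrders r as
    best-root refl bal len = by-cases (out as r) refl
      where
      by-cases : ∀ k → out as r ≡ k → trails (suc L) as u r ≡ tree r as * exitOrders r as
      -- The trail has to start at `r`, but no arc leaves it although arcs remain. By balance none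
      -- enters it either, so the remaining arcs lie apart from `r` and both sides are 0.
      by-cases zero o = trans no-trails (sym (trans (cong (_* exitOrders r as) no-trees) (ℚP.*-zeroˡ (exitOrders r as))))
        where
        no-trails : trails (suc L) as u r ≡ 0ℚ
        no-trails = ∑-zero (select as) λ { {(a , bs)} sel → trans
          (cong (_* trails L bs (tgt a) r) (⟦⟧-no (u FinP.≟ src a) λ { refl →
            ∈⇒out≢0 (PermP.∈-resp-↭ (↭-sym (select-↭ as sel)) (here refl)) o }))
          (ℚP.*-zeroˡ (trails L bs (tgt a) r)) }
        no-in : ∀ {v} → (v , r) ∈ˡ as → ⊥
        no-in e = ∈⇒inn≢0 e (trans (sym (count-↭ FinP._≟_ r (PermP.drop-∷ bal))) o)
        no-path : ∀ {T v} → T ∈ˡ sublists as → Path T v r → v ≢ r → ⊥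
        no-path T⊂as ε       v≢r = v≢r refl
        no-path T⊂as (_◅_ {j = w} e q) v≢r with w FinP.≟ r
        ... | yes refl = no-in (sublists-⊆ as T⊂as e)
        ... | no w≢r   = no-path T⊂as q w≢r
        start : ∀ {as} → length as ≡ suc L → ∃ λ (a : Arc n) → a ∈ˡ as
        start {a ∷ _} _ = a , here refl
        no-trees : tree r as ≡ 0ℚ
        no-trees with start {as} len
        ... | (v , w) , e = ∑-zero (sublists as) λ {T} T⊂as → ⟦⟧-no (arborescence? r (out as) T) λ (_ , _ , path) →
          no-path T⊂as (path v (∈⇒out≢0 e) v≢r) v≢r
          where
          v≢r : v ≢ r
          v≢r refl = ∈⇒out≢0 e o
      by-cases (suc k) o = best-branching k 0
        (trans (ℚP.+-identityʳ _) (cong ℕ→ℚ o))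
        (λ T arb → proj₁ arb)
        (λ {a} {bs} p u≡ → arborescences-cong bs
          (λ v v≢r → subst (_≢ 0) (sym (trans (out-↭ p v) (count-no FinP._≟_ (map src bs) (λ v≡ → v≢r (trans v≡ (sym u≡)))))))
          (λ v v≢r → subst (_≢ 0) (trans (out-↭ p v) (count-no FinP._≟_ (map src bs) (λ v≡ → v≢r (trans v≡ (sym u≡)))))))
        (λ { {a} {bs} p refl → exitOrders-step r p k
          (trans (exits-root r (out as r) refl) o)
          (trans (exits-root r (out bs r) refl) (ℕP.suc-injective (trans (sym (out-src p)) o))) })

    best-non-root : u ≢ r → Balanced as u r → trails (suc L) as u r ≡ tree r as * exitOrders r as
    best-non-root u≢r bal = by-cases (inn as u) refl
      where
      out-u : out as u ≡ suc (inn as u)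
      out-u = trans (sym (count-no FinP._≟_ (map src as) u≢r))
        (trans (count-↭ FinP._≟_ u bal) (count-yes FinP._≟_ (map tgt as) refl))
      by-cases : ∀ k → inn as u ≡ k → trails (suc L) as u r ≡ tree r as * exitOrders r as
      -- Balance leaves exactly one arc out of `u`, and the trail never returns. Every arc
      -- contributes `c` times the indicator that it leaves `u`, so the sum is `c` times the
      -- outdegree 1.
      by-cases zero i = begin
        ∑ (select as) (λ (a , bs) → ⟦ u FinP.≟ src a ⟧ * trails L bs (tgt a) r)
          ≡⟨ ∑-cong-∈ (select as) (λ {(a , bs)} sel → trans
               (⟦⟧-*-cong (u FinP.≟ src a) λ u≡ → trans (IH sel u≡) (leaf (select-↭ as sel) u≡))
               (ℚP.*-comm ⟦ u FinP.≟ src a ⟧ c)) ⟩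
        ∑ (select as) (λ (a , bs) → c * ⟦ u FinP.≟ src a ⟧)
          ≡⟨ trans (∑-*ˡ (select as) c (λ (a , bs) → ⟦ u FinP.≟ src a ⟧))
                   (cong (c *_) (∑-select-proj₁ as (λ a → ⟦ u FinP.≟ src a ⟧))) ⟩
        c * ∑ as (λ a → ⟦ u FinP.≟ src a ⟧)
          ≡⟨ cong (c *_) (trans (sym (ℕ→ℚ-out as u)) (cong ℕ→ℚ (trans out-u (cong suc i)))) ⟩
        c * 1ℚ
          ≡⟨ ℚP.*-identityʳ c ⟩
        c ∎
        where
        open ≡-Reasoning
        c = tree r as * exitOrders r as
        no-in : ∀ {v} → (v , u) ∈ˡ as → ⊥
        no-in e = ∈⇒inn≢0 e i
        leaf : ∀ {a bs} → as ↭ a ∷ bs → u ≡ src a → tree r bs * exitOrders r bs ≡ c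
        leaf {a} {bs} p refl = cong₂ _*_
          (arborescences-leaf p u≢r out-bs-u no-in out-w)
          (exitOrders-last r p u≢r out-bs-u)
          where
          out-bs-u : out bs u ≡ 0
          out-bs-u = ℕP.suc-injective (trans (sym (out-src p)) (trans out-u (cong suc i)))
          -- The rest of the trail starts at `tgt a`; unless it ends there too, balance of `bs`
          -- provides an outgoing arc.
          out-w : tgt a ≢ r → out bs (tgt a) ≢ 0
          out-w w≢r eq = ℕP.1+n≢0 {inn bs (tgt a)} (trans
            (sym (trans (count-↭ FinP._≟_ (tgt a) (Balanced-rest p bal)) (count-yes FinP._≟_ (map tgt bs) refl)))
            (trans (count-no FinP._≟_ (map src bs) w≢r) eq))
      -- `u` is entered again, so after the deletion `suc k` arcs still leave it and the vertices to
      -- be spanned are unchanged.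
      by-cases (suc k) i = best-branching k 1
        (trans (cong (ℚ._- 1ℚ) (trans (cong ℕ→ℚ o) (ℕ→ℚ-suc (suc k))))
               (solve 1 (λ x → con 1ℚ :+ x :- con 1ℚ := x) refl (ℕ→ℚ (suc k))))
        (λ T (_ , one , _) → one u (λ eq → ℕP.1+n≢0 (trans (sym o) eq)) u≢r)
        (λ { {a} {bs} p refl → arborescences-cong bs (λ v v≢r → weaken p v) (λ v v≢r → strengthen p v) })
        (λ { {a} {bs} p refl → exitOrders-step r p k
          (trans (exits-other r (out as u) u≢r) (cong (_∸ 1) o))
          (trans (exits-other r (out bs u) u≢r) (cong (_∸ 1) (out-bs p))) })
        where
        o : out as u ≡ suc (suc k)
        o = trans out-u (cong suc i)
        out-bs : ∀ {w bs} → as ↭ (u , w) ∷ bs → out bs u ≡ suc k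
        out-bs p = ℕP.suc-injective (trans (sym (out-src p)) o)
        weaken : ∀ {w bs} → as ↭ (u , w) ∷ bs → ∀ v → out bs v ≢ 0 → out as v ≢ 0
        weaken {bs = bs} p v b = ∈⇒out≢0 (PermP.∈-resp-↭ (↭-sym p) (there (proj₂ (out≢0⇒∈ bs v b))))
        strengthen : ∀ {w bs} → as ↭ (u , w) ∷ bs → ∀ v → out as v ≢ 0 → out bs v ≢ 0
        strengthen {w} {bs} p v a with v FinP.≟ u
        ... | yes refl = λ eq → ℕP.1+n≢0 (trans (sym (out-bs p)) eq)
        ... | no v≢u   = subst (_≢ 0) (trans (out-↭ p v) (count-no FinP._≟_ (map src bs) v≢u)) a

  best : ∀ L (as : List (Arc n)) u r → length as ≡ L → Balanced as u r →
    trails L as u r ≡ tree r as * exitOrders r as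
  best zero [] u r refl bal with PermP.↭-singleton-inv (↭-sym bal)
  ... | refl = begin
    ⟦ u FinP.≟ u ⟧                             ≡⟨ ⟦⟧-yes (u FinP.≟ u) refl ⟩
    1ℚ * 1ℚ                                    ≡⟨ sym (cong₂ _*_ (trans (ℚP.+-identityʳ _) (⟦⟧-yes (arborescence? u (out []) []) empty)) (∏-one (allFin n) exits-0)) ⟩
    tree u [] * exitOrders u []                ∎
    where
    open ≡-Reasoning
    empty : Arborescence u (out []) []
    empty = refl , (λ v o → ⊥-elim (o refl)) , (λ v o → ⊥-elim (o refl))
    exits-0 : ∀ v → ℕ→ℚ (exits u v 0 !) ≡ 1ℚ
    exits-0 v with v FinP.≟ u
    ... | yes _ = refl
    ... | no _  = refl
  best (suc L) as u r len bal = by-cases (u FinP.≟ r)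
    where
    IH : ∀ {a bs} → (a , bs) ∈ˡ select as → u ≡ src a → trails L bs (tgt a) r ≡ tree r bs * exitOrders r bs
    IH {a} {bs} sel refl = best L bs (tgt a) r
      (ℕP.suc-injective (trans (sym (PermP.↭-length (select-↭ as sel))) len)) (Balanced-rest (select-↭ as sel) bal)
    by-cases : Dec (u ≡ r) → trails (suc L) as u r ≡ tree r as * exitOrders r as
    by-cases (yes u≡r) = best-root L as u r IH u≡r bal len
    by-cases (no u≢r)  = best-non-root L as u r IH u≢r bal

-- Independence of the root, and trails versus walks

∑-↭ : ∀ {A : Set} {xs ys : List A} (f : A → ℚ) → xs ↭ ys → ∑ xs f ≡ ∑ ys f
∑-↭ f Perm.refl = refl
∑-↭ f (prep x p) = cong (f x +_) (∑-↭ f p)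
∑-↭ f (swap x y p) = trans (cong (λ s → f x + (f y + s)) (∑-↭ f p))
  (solve 3 (λ a b c → a :+ (b :+ c) := b :+ (a :+ c)) refl (f x) (f y) _)
∑-↭ f (Perm.trans p q) = trans (∑-↭ f p) (∑-↭ f q)

0≤square : ∀ x → 0ℚ ℚ.≤ x * x
0≤square x with ℚP.≤-total 0ℚ x
... | inj₁ 0≤x = 0≤* 0≤x 0≤x
... | inj₂ x≤0 = subst (0ℚ ℚ.≤_) (solve 1 (λ x → :- x :* :- x := x :* x) refl x)
  (0≤* (ℚP.neg-antimono-≤ x≤0) (ℚP.neg-antimono-≤ x≤0))

square≡0 : ∀ x → x * x ≡ 0ℚ → x ≡ 0ℚ
square≡0 x eq with x ℚP.≟ 0ℚ
... | yes x≡0 = x≡0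
... | no x≢0  = *-cancelʳ-≢0 x x≢0 (trans eq (sym (ℚP.*-zeroˡ x)))

∑≡0⇒head≡0 : ∀ {A : Set} x (xs : List A) {f : A → ℚ} → (∀ x → 0ℚ ℚ.≤ f x) → ∑ (x ∷ xs) f ≡ 0ℚ → f x ≡ 0ℚ
∑≡0⇒head≡0 x xs {f} f≥0 eq = ℚP.≤-antisym
  (subst (f x ℚ.≤_) eq (subst (ℚ._≤ f x + ∑ xs f) (ℚP.+-identityʳ (f x)) (ℚP.+-monoʳ-≤ (f x) (∑-≥0 xs f≥0))))
  (f≥0 x)

∑≡0⇒≡0 : ∀ {A : Set} (xs : List A) {f : A → ℚ} → (∀ x → 0ℚ ℚ.≤ f x) → ∑ xs f ≡ 0ℚ → ∀ {x} → x ∈ˡ xs → f x ≡ 0ℚ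
∑≡0⇒≡0 (x ∷ xs) f≥0 eq (here refl) = ∑≡0⇒head≡0 x xs f≥0 eq
∑≡0⇒≡0 (x ∷ xs) {f} f≥0 eq (there p) = ∑≡0⇒≡0 xs f≥0
  (trans (sym (trans (cong (_+ ∑ xs f) (∑≡0⇒head≡0 x xs f≥0 eq)) (ℚP.+-identityˡ (∑ xs f)))) eq) p

⟦≟⟧-sym : ∀ {n} (u v : Fin n) → ⟦ u FinP.≟ v ⟧ ≡ ⟦ v FinP.≟ u ⟧
⟦≟⟧-sym u v = ⟦⟧-cong (u FinP.≟ v) (v FinP.≟ u) sym sym

module _ {n : ℕ} where

  ∑-src : ∀ (as : List (Arc n)) (f : Fin n → ℚ) → ∑ as (f ∘ src) ≡ ∑ (allFin n) (λ v → ℕ→ℚ (out as v) * f v)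
  ∑-src as f = begin
    ∑ as (f ∘ src)
      ≡⟨ ∑-cong as (λ a → trans (sym (∑-allFin-pick (src a) f)) (∑-cong (allFin n) λ v →
           trans (cong (_* f v) (⟦≟⟧-sym (src a) v)) (ℚP.*-comm ⟦ v FinP.≟ src a ⟧ (f v)))) ⟩
    ∑ as (λ a → ∑ (allFin n) (λ v → f v * ⟦ v FinP.≟ src a ⟧))
      ≡⟨ ∑-swap as (allFin n) (λ a v → f v * ⟦ v FinP.≟ src a ⟧) ⟩
    ∑ (allFin n) (λ v → ∑ as (λ a → f v * ⟦ v FinP.≟ src a ⟧))
      ≡⟨ ∑-cong (allFin n) (λ v → trans (∑-*ˡ as (f v) (λ a → ⟦ v FinP.≟ src a ⟧))
           (trans (cong (f v *_) (sym (ℕ→ℚ-out as v))) (ℚP.*-comm (f v) _))) ⟩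
    ∑ (allFin n) (λ v → ℕ→ℚ (out as v) * f v) ∎
    where open ≡-Reasoning

  -- The Markov chain tree theorem for a balanced multi-digraph, obtained by
  -- counting closed trails at r by their last arc.
  tree-last-arc : ∀ (as : List (Arc n)) → map src as ↭ map tgt as → ∀ r →
    ℕ→ℚ (out as r) * tree r as ≡ ∑ as (λ a → ⟦ r FinP.≟ tgt a ⟧ * tree (src a) as)
  tree-last-arc [] bal r = ℚP.*-zeroˡ (tree r [])
  tree-last-arc as@(_ ∷ as′) bal r = by-cases (out as r) refl
    where
    open ≡-Reasoning
    L = length as′
    by-cases : ∀ k → out as r ≡ k → ℕ→ℚ (out as r) * tree r as ≡ ∑ as (λ a → ⟦ r FinP.≟ tgt a ⟧ * tree (src a) as)
    by-cases zero o = trans (trans (cong (λ k → ℕ→ℚ k * tree r as) o) (ℚP.*-zeroˡ (tree r as)))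
      (sym (∑-zero as λ { {(v , w)} e → trans (cong (_* tree v as) (⟦⟧-no (r FinP.≟ w) λ { refl →
        ∈⇒inn≢0 e (trans (sym (count-↭ FinP._≟_ r bal)) o) })) (ℚP.*-zeroˡ (tree v as)) }))
    by-cases (suc k) o = *-cancelʳ-≢0 Q Q≢0 (begin
      ℕ→ℚ (out as r) * tree r as * Q
        ≡⟨ cong (λ k → ℕ→ℚ k * tree r as * Q) o ⟩
      ℕ→ℚ (suc k) * tree r as * Q
        ≡⟨ solve 3 (λ s t q → s :* t :* q := t :* (s :* q)) refl (ℕ→ℚ (suc k)) (tree r as) Q ⟩
      tree r as * (ℕ→ℚ (suc k) * Q)
        ≡⟨ cong (tree r as *_) orders-r ⟩
      tree r as * exitOrders r as
        ≡⟨ sym (best (suc L) as r r refl (prep r bal)) ⟩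
      trails (suc L) as r r
        ≡⟨ trails-last L as r r ⟩
      ∑ (select as) (λ (a , bs) → ⟦ r FinP.≟ tgt a ⟧ * trails L bs r (src a))
        ≡⟨ ∑-cong-∈ (select as) (λ {(a , bs)} sel → trans
             (⟦⟧-*-cong (r FinP.≟ tgt a) (λ { refl → term (select-↭ as sel) }))
             (solve 3 (λ i t q → i :* (t :* q) := q :* (i :* t)) refl ⟦ r FinP.≟ tgt a ⟧ (tree (src a) as) Q)) ⟩
      ∑ (select as) (λ (a , bs) → Q * (⟦ r FinP.≟ tgt a ⟧ * tree (src a) as))
        ≡⟨ ∑-select-proj₁ as (λ a → Q * (⟦ r FinP.≟ tgt a ⟧ * tree (src a) as)) ⟩
      ∑ as (λ a → Q * (⟦ r FinP.≟ tgt a ⟧ * tree (src a) as))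
        ≡⟨ ∑-*ˡ as Q (λ a → ⟦ r FinP.≟ tgt a ⟧ * tree (src a) as) ⟩
      Q * ∑ as (λ a → ⟦ r FinP.≟ tgt a ⟧ * tree (src a) as)
        ≡⟨ ℚP.*-comm Q _ ⟩
      ∑ as (λ a → ⟦ r FinP.≟ tgt a ⟧ * tree (src a) as) * Q ∎)
      where
      -- The value of `exitOrders v bs` after deleting an arc `(v , r)`, whatever `v` is: the new
      -- end `v` has lost one arc, and at every other vertex `exits` subtracts one. Being
      -- independent of `v`, it cancels.
      Q = ∏ (allFin n) (λ v → ℕ→ℚ ((out as v ∸ 1) !))
      Q≢0 : Q ≢ 0ℚ
      Q≢0 = ∏-≢0 (allFin n) (λ v → !≢0 (out as v ∸ 1))
      orders-r : ℕ→ℚ (suc k) * Q ≡ exitOrders r as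
      orders-r = *-cancelʳ-≢0 (ℕ→ℚ (k !)) (!≢0 k) (sym (begin
        exitOrders r as * ℕ→ℚ (k !)
          ≡⟨ cong (λ l → exitOrders r as * ℕ→ℚ ((l ∸ 1) !)) (sym o) ⟩
        exitOrders r as * ℕ→ℚ ((out as r ∸ 1) !)
          ≡⟨ ∏-allFin-replace r (λ v → ℕ→ℚ (exits r v (out as v) !)) (λ v → ℕ→ℚ ((out as v ∸ 1) !))
               (λ v v≢r → cong (λ l → ℕ→ℚ (l !)) (exits-other r (out as v) v≢r)) ⟩
        ℕ→ℚ (exits r r (out as r) !) * Q
          ≡⟨ cong (λ l → ℕ→ℚ (l !) * Q) (trans (exits-root r (out as r) refl) o) ⟩
        ℕ→ℚ (suc k !) * Q
          ≡⟨ cong (_* Q) (ℕ→ℚ-* (suc k) (k !)) ⟩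
        ℕ→ℚ (suc k) * ℕ→ℚ (k !) * Q
          ≡⟨ solve 3 (λ x y z → x :* y :* z := x :* z :* y) refl (ℕ→ℚ (suc k)) (ℕ→ℚ (k !)) Q ⟩
        ℕ→ℚ (suc k) * Q * ℕ→ℚ (k !) ∎))
      term : ∀ {v bs} → as ↭ (v , r) ∷ bs → trails L bs r v ≡ tree v as * Q
      term {v} {bs} p = trans (best L bs r v (ℕP.suc-injective (sym (PermP.↭-length p))) (Balanced-restʳ p (prep r bal)))
        (cong₂ _*_
          -- The deleted arc leaves `v`, which is now the root: the vertices to be spanned besides
          -- `v` and the arborescences themselves stay the same.
          (trans (arborescences-cong bs (λ w w≢v → subst (_≢ 0) (sym (out-other w w≢v))) (λ w w≢v → subst (_≢ 0) (out-other w w≢v)))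
                 (sym (arborescences-root-arc v (out as) p refl)))
          (∏-cong (allFin n) (λ w → cong (λ l → ℕ→ℚ (l !)) (exits-bs w (w FinP.≟ v)))))
        where
        out-other : ∀ w → w ≢ v → out as w ≡ out bs w
        out-other w w≢v = trans (out-↭ p w) (count-no FinP._≟_ (map src bs) w≢v)
        exits-bs : ∀ w → Dec (w ≡ v) → exits v w (out bs w) ≡ out as w ∸ 1
        exits-bs w (yes refl) = trans (exits-root v (out bs v) refl) (sym (cong (_∸ 1) (out-src p)))
        exits-bs w (no w≢v)   = trans (exits-other v (out bs w) w≢v) (cong (_∸ 1) (sym (out-other w w≢v)))

  -- By tree-last-arc, ∑ (tree (src a) − tree (tgt a))² over the arcs a vanishes.
  tree-arc : ∀ (as : List (Arc n)) → map src as ↭ map tgt as → ∀ {u v} → (u , v) ∈ˡ as → tree u as ≡ tree v as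
  tree-arc as bal {u} {v} e = begin
    x u                 ≡⟨ solve 2 (λ a b → a := a :- b :+ b) refl (x u) (x v) ⟩
    x u ℚ.- x v + x v   ≡⟨ cong (_+ x v) (square≡0 (x u ℚ.- x v) (∑≡0⇒≡0 as (λ a → 0≤square (x (src a) ℚ.- x (tgt a))) squares e)) ⟩
    0ℚ + x v            ≡⟨ ℚP.+-identityˡ (x v) ⟩
    x v                 ∎
    where
    open ≡-Reasoning
    x : Fin n → ℚ
    x v = tree v as
    S = ∑ as (λ a → x (src a) * x (src a))
    tgt-tgt : ∑ as (λ a → x (tgt a) * x (tgt a)) ≡ S
    tgt-tgt = trans (sym (∑-map tgt as (λ v → x v * x v))) (trans (∑-↭ (λ v → x v * x v) (↭-sym bal)) (∑-map src as (λ v → x v * x v)))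
    -- Grouped by targets, `tree-last-arc` turns the sum of `x (src a)` over the arcs into `v` into
    -- the outdegree of `v` times `x v`. The cross terms therefore add up to the sum of squares over
    -- the sources.
    src-tgt : ∑ as (λ a → x (src a) * x (tgt a)) ≡ S
    src-tgt = begin
      ∑ as (λ a → x (src a) * x (tgt a))
        ≡⟨ ∑-cong as (λ a → trans (sym (∑-allFin-pick (tgt a) (λ v → x (src a) * x v))) (∑-cong (allFin n) λ v →
             trans (cong (_* (x (src a) * x v)) (⟦≟⟧-sym (tgt a) v))
                   (solve 3 (λ i a b → i :* (a :* b) := b :* (i :* a)) refl ⟦ v FinP.≟ tgt a ⟧ (x (src a)) (x v)))) ⟩
      ∑ as (λ a → ∑ (allFin n) (λ v → x v * (⟦ v FinP.≟ tgt a ⟧ * x (src a))))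
        ≡⟨ ∑-swap as (allFin n) (λ a v → x v * (⟦ v FinP.≟ tgt a ⟧ * x (src a))) ⟩
      ∑ (allFin n) (λ v → ∑ as (λ a → x v * (⟦ v FinP.≟ tgt a ⟧ * x (src a))))
        ≡⟨ ∑-cong (allFin n) (λ v → trans (∑-*ˡ as (x v) (λ a → ⟦ v FinP.≟ tgt a ⟧ * x (src a)))
             (trans (cong (x v *_) (sym (tree-last-arc as bal v)))
                    (solve 2 (λ o y → y :* (o :* y) := o :* (y :* y)) refl (ℕ→ℚ (out as v)) (x v)))) ⟩
      ∑ (allFin n) (λ v → ℕ→ℚ (out as v) * (x v * x v))
        ≡⟨ sym (∑-src as (λ v → x v * x v)) ⟩
      S ∎
    squares : ∑ as (λ a → (x (src a) ℚ.- x (tgt a)) * (x (src a) ℚ.- x (tgt a))) ≡ 0ℚ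
    squares = begin
      ∑ as (λ a → (x (src a) ℚ.- x (tgt a)) * (x (src a) ℚ.- x (tgt a)))
        ≡⟨ ∑-cong as (λ a → solve 2 (λ a b → (a :- b) :* (a :- b) := a :* a :+ (b :* b :+ con (ℚ.- (1ℚ + 1ℚ)) :* (a :* b))) refl (x (src a)) (x (tgt a))) ⟩
      ∑ as (λ a → x (src a) * x (src a) + (x (tgt a) * x (tgt a) + κ * (x (src a) * x (tgt a))))
        ≡⟨ trans (∑-+ as (λ a → x (src a) * x (src a)) (λ a → x (tgt a) * x (tgt a) + κ * (x (src a) * x (tgt a))))
             (cong (S +_) (∑-+ as (λ a → x (tgt a) * x (tgt a)) (λ a → κ * (x (src a) * x (tgt a))))) ⟩
      S + (∑ as (λ a → x (tgt a) * x (tgt a)) + ∑ as (λ a → κ * (x (src a) * x (tgt a))))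
        ≡⟨ cong (S +_) (cong₂ _+_ tgt-tgt (trans (∑-*ˡ as κ (λ a → x (src a) * x (tgt a))) (cong (κ *_) src-tgt))) ⟩
      S + (S + κ * S)
        ≡⟨ solve 1 (λ s → s :+ (s :+ con (ℚ.- (1ℚ + 1ℚ)) :* s) := con 0ℚ) refl S ⟩
      0ℚ ∎
      where κ = ℚ.- (1ℚ + 1ℚ)

  walkArcs-balanced : ∀ (u : Fin n) ws → walkEnd u ws ∷ map src (walkArcs u ws) ↭ u ∷ map tgt (walkArcs u ws)
  walkArcs-balanced u []       = ↭-refl
  walkArcs-balanced u (w ∷ ws) = ↭-trans (swap _ u ↭-refl) (prep u (walkArcs-balanced w ws))

  closedWalk-balanced : ∀ {u : Fin n} {ws as} → walkEnd u ws ≡ u → walkArcs u ws ↭ as → map src as ↭ map tgt as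
  closedWalk-balanced {u} {ws} end p = ↭-trans (PermP.map⁺ src (↭-sym p)) (↭-trans
    (PermP.drop-∷ (subst (λ v → v ∷ map src (walkArcs u ws) ↭ u ∷ map tgt (walkArcs u ws)) end (walkArcs-balanced u ws)))
    (PermP.map⁺ tgt p))

  constant-on-walk : ∀ {A : Set} (x : Fin n → A) u ws → (∀ {v w} → (v , w) ∈ˡ walkArcs u ws → x v ≡ x w) →
    ∀ {v w} → (v , w) ∈ˡ walkArcs u ws → x v ≡ x u × x w ≡ x u
  constant-on-walk x u (w ∷ ws) eq (here refl) = refl , sym (eq (here refl))
  constant-on-walk x u (w ∷ ws) eq (there e) with constant-on-walk x w ws (eq ∘ there) e
  ... | p , q = trans p (sym (eq (here refl))) , trans q (sym (eq (here refl)))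

  _IsEndpointOf_ : Fin n → List (Arc n) → Set
  v IsEndpointOf as = ∃ λ w → (v , w) ∈ˡ as ⊎ (w , v) ∈ˡ as

  -- Connectedness enters here: `tree-arc` only compares the two ends of an arc, and a single closed
  -- walk through all arcs carries the equality from one endpoint to any other.
  tree-root : ∀ {u : Fin n} {ws as} → walkEnd u ws ≡ u → walkArcs u ws ↭ as →
    ∀ {v w} → v IsEndpointOf as → w IsEndpointOf as → tree v as ≡ tree w as
  tree-root {u} {ws} {as} end p v∈ w∈ = trans (const-u v∈) (sym (const-u w∈))
    where
    arc : ∀ {v w} → (v , w) ∈ˡ as → tree v as ≡ tree u as × tree w as ≡ tree u as
    arc e = constant-on-walk (λ v → tree v as) u ws
      (λ e′ → tree-arc as (closedWalk-balanced end p) (PermP.∈-resp-↭ p e′)) (PermP.∈-resp-↭ (↭-sym p) e)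
    const-u : ∀ {v} → v IsEndpointOf as → tree v as ≡ tree u as
    const-u (_ , inj₁ e) = proj₁ (arc e)
    const-u (_ , inj₂ e) = proj₂ (arc e)

  -- A walk through the arcs left after a first arc extends by that arc to a walk through `as`, so
  -- the absence of walks passes to every term with a nonzero indicator.
  trails-no-walk : ∀ L (as : List (Arc n)) u r → length as ≡ L →
    (∀ ws → walkEnd u ws ≡ r → walkArcs u ws ↭ as → ⊥) → trails L as u r ≡ 0ℚ
  trails-no-walk zero    [] u r len no-walk = ⟦⟧-no (u FinP.≟ r) (λ end → no-walk [] end ↭-refl)
  trails-no-walk (suc L) as u r len no-walk = ∑-zero (select as) λ {(a , bs)} sel → trans
    (⟦⟧-*-cong (u FinP.≟ src a) λ { refl → trails-no-walk L bs (tgt a) r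
      (ℕP.suc-injective (trans (sym (PermP.↭-length (select-↭ as sel))) len))
      (λ ws end p → no-walk (tgt a ∷ ws) end (↭-trans (prep a p) (↭-sym (select-↭ as sel)))) })
    (ℚP.*-zeroʳ ⟦ u FinP.≟ src a ⟧)

  trails-≥0 : ∀ L (as : List (Arc n)) u r → 0ℚ ℚ.≤ trails L as u r
  trails-≥0 zero    as u r = ⟦⟧-≥0 (u FinP.≟ r)
  trails-≥0 (suc L) as u r = ∑-≥0 (select as) λ (a , bs) → 0≤* (⟦⟧-≥0 (u FinP.≟ src a)) (trails-≥0 L bs (tgt a) r)

  outOrders : List (Arc n) → ℚ
  outOrders as = ∏ (allFin n) (λ v → ℕ→ℚ (out as v !))

  outOrders-∷ : ∀ {as a bs} → as ↭ a ∷ bs → outOrders as ≡ ℕ→ℚ (out as (src a)) * outOrders bs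
  outOrders-∷ {as} {a} {bs} p = *-cancelʳ-≢0 (ℕ→ℚ (out bs u !)) (!≢0 (out bs u)) (begin
    outOrders as * ℕ→ℚ (out bs u !)
      ≡⟨ ∏-allFin-replace u (λ v → ℕ→ℚ (out as v !)) (λ v → ℕ→ℚ (out bs v !))
           (λ v v≢u → cong (λ k → ℕ→ℚ (k !)) (trans (out-↭ p v) (count-no FinP._≟_ (map src bs) v≢u))) ⟩
    ℕ→ℚ (out as u !) * outOrders bs
      ≡⟨ cong (λ k → ℕ→ℚ (k !) * outOrders bs) (out-src p) ⟩
    ℕ→ℚ (suc (out bs u) !) * outOrders bs
      ≡⟨ cong (_* outOrders bs) (ℕ→ℚ-* (suc (out bs u)) (out bs u !)) ⟩
    ℕ→ℚ (suc (out bs u)) * ℕ→ℚ (out bs u !) * outOrders bs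
      ≡⟨ solve 3 (λ x y z → x :* y :* z := x :* z :* y) refl (ℕ→ℚ (suc (out bs u))) (ℕ→ℚ (out bs u !)) (outOrders bs) ⟩
    ℕ→ℚ (suc (out bs u)) * outOrders bs * ℕ→ℚ (out bs u !)
      ≡⟨ cong (λ k → ℕ→ℚ k * outOrders bs * ℕ→ℚ (out bs u !)) (sym (out-src p)) ⟩
    ℕ→ℚ (out as u) * outOrders bs * ℕ→ℚ (out bs u !) ∎)
    where
    open ≡-Reasoning
    u = src a

  -- A trail is determined by the order in which it uses the arcs leaving each vertex.
  trails-≤-outOrders : ∀ L (as : List (Arc n)) u r → length as ≡ L → trails L as u r ℚ.≤ outOrders as
  trails-≤-outOrders zero [] u r len = subst (trails zero [] u r ℚ.≤_) (sym (∏-one (allFin n) λ _ → refl)) (⟦⟧-≤1 (u FinP.≟ r))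
  trails-≤-outOrders (suc L) as u r len = by-cases (out as u) refl
    where
    by-cases : ∀ k → out as u ≡ k → trails (suc L) as u r ℚ.≤ outOrders as
    by-cases zero o = subst (ℚ._≤ outOrders as) (sym (∑-zero (select as) λ { {(a , bs)} sel → trans
        (cong (_* trails L bs (tgt a) r) (⟦⟧-no (u FinP.≟ src a) λ { refl →
          ℕP.1+n≢0 (trans (sym (out-src (select-↭ as sel))) o) })) (ℚP.*-zeroˡ (trails L bs (tgt a) r)) }))
      (∏-≥0 (allFin n) (λ v → 0≤ℕ→ℚ (out as v !)))
    -- Each of the `suc k` arcs leaving `u` leaves at most `outOrders bs` continuations, and `suc k`
    -- times this bound is `outOrders as`.
    by-cases (suc k) o = ℚP.*-cancelˡ-≤-pos s {{ℚ.positive (0<ℕ→ℚ (suc k))}} (begin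
      s * trails (suc L) as u r
        ≡⟨ sym (∑-*ˡ (select as) s (λ (a , bs) → ⟦ u FinP.≟ src a ⟧ * trails L bs (tgt a) r)) ⟩
      ∑ (select as) (λ (a , bs) → s * (⟦ u FinP.≟ src a ⟧ * trails L bs (tgt a) r))
        ≤⟨ ∑-mono-≤-∈ (select as) (λ {(a , bs)} sel → term (select-↭ as sel)) ⟩
      ∑ (select as) (λ (a , bs) → outOrders as * ⟦ u FinP.≟ src a ⟧)
        ≡⟨ trans (∑-select-proj₁ as (λ a → outOrders as * ⟦ u FinP.≟ src a ⟧))
             (trans (∑-*ˡ as (outOrders as) (λ a → ⟦ u FinP.≟ src a ⟧)) (cong (outOrders as *_) (sym (ℕ→ℚ-out as u)))) ⟩
      outOrders as * ℕ→ℚ (out as u)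
        ≡⟨ trans (cong (λ k → outOrders as * ℕ→ℚ k) o) (ℚP.*-comm (outOrders as) s) ⟩
      s * outOrders as ∎)
      where
      open ℚP.≤-Reasoning
      s = ℕ→ℚ (suc k)
      term : ∀ {a bs} → as ↭ a ∷ bs → s * (⟦ u FinP.≟ src a ⟧ * trails L bs (tgt a) r) ℚ.≤ outOrders as * ⟦ u FinP.≟ src a ⟧
      term {a} {bs} p = begin
        s * (i * trails L bs (tgt a) r)
          ≤⟨ ℚP.*-monoˡ-≤-nonNeg s {{ℚ.nonNegative (0≤ℕ→ℚ (suc k))}} (ℚP.*-monoˡ-≤-nonNeg i {{ℚ.nonNegative (⟦⟧-≥0 (u FinP.≟ src a))}}
               (trails-≤-outOrders L bs (tgt a) r (ℕP.suc-injective (trans (sym (PermP.↭-length p)) len)))) ⟩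
        s * (i * outOrders bs)
          ≡⟨ solve 3 (λ s i x → s :* (i :* x) := i :* (s :* x)) refl s i (outOrders bs) ⟩
        i * (s * outOrders bs)
          ≡⟨ ⟦⟧-*-cong (u FinP.≟ src a) (λ { refl → trans (cong (λ k → ℕ→ℚ k * outOrders bs) (sym o)) (sym (outOrders-∷ p)) }) ⟩
        i * outOrders as
          ≡⟨ ℚP.*-comm i (outOrders as) ⟩
        outOrders as * i ∎
        where i = ⟦ u FinP.≟ src a ⟧

-- Differentiating forms down to constants

module _ {n : ℕ} where

  exponentᵃ : Arc n → Monomial n → ℕ
  exponentᵃ (k , l) = exponent k l

  modifyᵃ : Arc n → (ℕ → ℕ) → Monomial n → Monomial n
  modifyᵃ (k , l) = modifyExponent k l

  exponent-modify : ∀ a {f} e → exponentᵃ a (modifyᵃ a f e) ≡ f (exponentᵃ a e)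
  exponent-modify (k , l) {f} e = trans
    (cong (λ row → Vec.lookup row l) (VecP.lookup∘updateAt k e))
    (VecP.lookup∘updateAt l (Vec.lookup e k))

  exponent-modify′ : ∀ a b {f} e → a ≢ b → exponentᵃ a (modifyᵃ b f e) ≡ exponentᵃ a e
  exponent-modify′ (k , l) (k′ , l′) e a≢b with k FinP.≟ k′
  ... | no k≢k′ = cong (λ row → Vec.lookup row l) (VecP.lookup∘updateAt′ k k′ k≢k′ e)
  ... | yes refl = trans (cong (λ row → Vec.lookup row l) (VecP.lookup∘updateAt k e))
    (VecP.lookup∘updateAt′ l l′ (λ l≡l′ → a≢b (cong (k ,_) l≡l′)) (Vec.lookup e k))

  modify-commute : ∀ a b {f g} e → a ≢ b → modifyᵃ a f (modifyᵃ b g e) ≡ modifyᵃ b g (modifyᵃ a f e)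
  modify-commute (k , l) (k′ , l′) e a≢b with k FinP.≟ k′
  ... | no k≢k′ = VecP.updateAt-commutes k k′ k≢k′ e
  ... | yes refl = trans (VecP.updateAt-updateAt k e) (trans
    (VecP.updateAt-cong k (VecP.updateAt-commutes l l′ (λ l≡l′ → a≢b (cong (k ,_) l≡l′))) e)
    (sym (VecP.updateAt-updateAt k e)))

  modify-inverse : ∀ a {f g} e → f (g (exponentᵃ a e)) ≡ exponentᵃ a e → modifyᵃ a f (modifyᵃ a g e) ≡ e
  modify-inverse (k , l) e eq = trans (VecP.updateAt-updateAt k e) (VecP.updateAt-id-local k e
    (trans (VecP.updateAt-updateAt l (Vec.lookup e k)) (VecP.updateAt-id-local l (Vec.lookup e k) eq)))

  -- The constant term of the iterated derivative of a monomial.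
  ⟨_∣_⟩ : List (Arc n) → Monomial n → ℚ
  ⟨ []     ∣ e ⟩ = ⟦ 1ᵐ ≟ᵐ e ⟧
  ⟨ a ∷ as ∣ e ⟩ = ℕ→ℚ (exponentᵃ a e) * ⟨ as ∣ modifyᵃ a (_∸ 1) e ⟩

  derivative-swap : ∀ a b as e → ⟨ a ∷ b ∷ as ∣ e ⟩ ≡ ⟨ b ∷ a ∷ as ∣ e ⟩
  derivative-swap a b as e with a ≟ᵃ b
  ... | yes refl = refl
  ... | no a≢b = begin
    x * (ℕ→ℚ (exponentᵃ b (modifyᵃ a (_∸ 1) e)) * ⟨ as ∣ modifyᵃ b (_∸ 1) (modifyᵃ a (_∸ 1) e) ⟩)
      ≡⟨ cong₂ (λ k e′ → x * (ℕ→ℚ k * ⟨ as ∣ e′ ⟩)) (exponent-modify′ b a e (a≢b ∘ sym)) (modify-commute b a e (a≢b ∘ sym)) ⟩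
    x * (y * z)
      ≡⟨ solve 3 (λ x y z → x :* (y :* z) := y :* (x :* z)) refl x y z ⟩
    y * (x * z)
      ≡⟨ cong (λ k → y * (ℕ→ℚ k * z)) (sym (exponent-modify′ a b e a≢b)) ⟩
    y * (ℕ→ℚ (exponentᵃ a (modifyᵃ b (_∸ 1) e)) * z) ∎
    where
    open ≡-Reasoning
    x = ℕ→ℚ (exponentᵃ a e)
    y = ℕ→ℚ (exponentᵃ b e)
    z = ⟨ as ∣ modifyᵃ a (_∸ 1) (modifyᵃ b (_∸ 1) e) ⟩

  derivative-↭ : ∀ {as bs} → as ↭ bs → ∀ e → ⟨ as ∣ e ⟩ ≡ ⟨ bs ∣ e ⟩
  derivative-↭ Perm.refl e = refl
  derivative-↭ (prep a p) e = cong (ℕ→ℚ (exponentᵃ a e) *_) (derivative-↭ p _)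
  derivative-↭ (swap {as} a b p) e = trans (derivative-swap a b as e)
    (cong (ℕ→ℚ (exponentᵃ b e) *_) (cong (ℕ→ℚ (exponentᵃ a (modifyᵃ b (_∸ 1) e)) *_) (derivative-↭ p _)))
  derivative-↭ (Perm.trans p q) e = trans (derivative-↭ p e) (derivative-↭ q e)

  -- The product rule for multiplication by a single variable: one of the derivations equal to `a`
  -- removes the new factor and is used up. With no derivation left the new factor keeps the
  -- monomial from being constant.
  leibniz : ∀ a as e → ⟨ as ∣ modifyᵃ a suc e ⟩ ≡ ∑ (select as) (λ (b , bs) → ⟦ a ≟ᵃ b ⟧ * ⟨ bs ∣ e ⟩)
  leibniz a [] e = ⟦⟧-no (1ᵐ ≟ᵐ modifyᵃ a suc e) λ eq → ℕP.1+n≢0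
    (trans (sym (exponent-modify a e)) (trans (cong (exponentᵃ a) (sym eq)) exponent-1))
    where
    exponent-1 : exponentᵃ a 1ᵐ ≡ 0
    exponent-1 = trans (cong (λ row → Vec.lookup row (tgt a)) (VecP.lookup-replicate (src a) (Vec.replicate n 0)))
      (VecP.lookup-replicate (tgt a) 0)
  leibniz a (b ∷ as) e = trans (by-cases (a ≟ᵃ b)) (sym (∑-select-∷ b as (λ (c , bs) → ⟦ a ≟ᵃ c ⟧ * ⟨ bs ∣ e ⟩)))
    where
    open ≡-Reasoning
    S = ∑ (select as) (λ (c , bs) → ⟦ a ≟ᵃ c ⟧ * ⟨ b ∷ bs ∣ e ⟩)
    pull : ∑ (select as) (λ (c , bs) → ⟦ a ≟ᵃ c ⟧ * ⟨ b ∷ bs ∣ e ⟩) ≡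
      ℕ→ℚ (exponentᵃ b e) * ∑ (select as) (λ (c , bs) → ⟦ a ≟ᵃ c ⟧ * ⟨ bs ∣ modifyᵃ b (_∸ 1) e ⟩)
    pull = trans (∑-cong (select as) (λ (c , bs) → solve 3 (λ i x y → i :* (x :* y) := x :* (i :* y)) refl
             ⟦ a ≟ᵃ c ⟧ (ℕ→ℚ (exponentᵃ b e)) ⟨ bs ∣ modifyᵃ b (_∸ 1) e ⟩))
           (∑-*ˡ (select as) (ℕ→ℚ (exponentᵃ b e)) (λ (c , bs) → ⟦ a ≟ᵃ c ⟧ * ⟨ bs ∣ modifyᵃ b (_∸ 1) e ⟩))
    -- Lowering an exponent and raising it again is the identity only if it is positive; at exponent
    -- 0 the coefficient is already 0.
    restore : ∀ k → exponentᵃ b e ≡ k →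
      ℕ→ℚ k * ⟨ as ∣ e ⟩ ≡ ℕ→ℚ k * ⟨ as ∣ modifyᵃ b suc (modifyᵃ b (_∸ 1) e) ⟩
    restore zero    eq = trans (ℚP.*-zeroˡ ⟨ as ∣ e ⟩) (sym (ℚP.*-zeroˡ ⟨ as ∣ modifyᵃ b suc (modifyᵃ b (_∸ 1) e) ⟩))
    restore (suc k) eq = cong (λ e′ → ℕ→ℚ (suc k) * ⟨ as ∣ e′ ⟩)
      (sym (modify-inverse b e (trans (cong (λ k → suc (k ∸ 1)) eq) (sym eq))))
    by-cases : Dec (a ≡ b) → ⟨ b ∷ as ∣ modifyᵃ a suc e ⟩ ≡ ⟦ a ≟ᵃ b ⟧ * ⟨ as ∣ e ⟩ + S
    by-cases (yes refl) = begin
      ℕ→ℚ (exponentᵃ a (modifyᵃ a suc e)) * ⟨ as ∣ modifyᵃ a (_∸ 1) (modifyᵃ a suc e) ⟩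
        ≡⟨ cong₂ (λ k e′ → ℕ→ℚ k * ⟨ as ∣ e′ ⟩) (exponent-modify a e) (modify-inverse a e refl) ⟩
      ℕ→ℚ (suc (exponentᵃ a e)) * ⟨ as ∣ e ⟩
        ≡⟨ cong (_* ⟨ as ∣ e ⟩) (ℕ→ℚ-suc (exponentᵃ a e)) ⟩
      (1ℚ + ℕ→ℚ (exponentᵃ a e)) * ⟨ as ∣ e ⟩
        ≡⟨ ℚP.*-distribʳ-+ ⟨ as ∣ e ⟩ 1ℚ (ℕ→ℚ (exponentᵃ a e)) ⟩
      1ℚ * ⟨ as ∣ e ⟩ + ℕ→ℚ (exponentᵃ a e) * ⟨ as ∣ e ⟩
        ≡⟨ cong₂ _+_ (cong (_* ⟨ as ∣ e ⟩) (sym (⟦⟧-yes (a ≟ᵃ a) refl)))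
             (trans (restore (exponentᵃ a e) refl)
               (trans (cong (ℕ→ℚ (exponentᵃ a e) *_) (leibniz a as (modifyᵃ a (_∸ 1) e))) (sym pull))) ⟩
      ⟦ a ≟ᵃ a ⟧ * ⟨ as ∣ e ⟩ + S ∎
    by-cases (no a≢b) = begin
      ℕ→ℚ (exponentᵃ b (modifyᵃ a suc e)) * ⟨ as ∣ modifyᵃ b (_∸ 1) (modifyᵃ a suc e) ⟩
        ≡⟨ cong₂ (λ k e′ → ℕ→ℚ k * ⟨ as ∣ e′ ⟩) (exponent-modify′ b a e (a≢b ∘ sym)) (modify-commute b a e (a≢b ∘ sym)) ⟩
      ℕ→ℚ (exponentᵃ b e) * ⟨ as ∣ modifyᵃ a suc (modifyᵃ b (_∸ 1) e) ⟩
        ≡⟨ trans (cong (ℕ→ℚ (exponentᵃ b e) *_) (leibniz a as (modifyᵃ b (_∸ 1) e))) (sym pull) ⟩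
      S
        ≡⟨ sym (trans (cong (_+ S) (trans (cong (_* ⟨ as ∣ e ⟩) (⟦⟧-no (a ≟ᵃ b) a≢b)) (ℚP.*-zeroˡ ⟨ as ∣ e ⟩))) (ℚP.+-identityˡ S)) ⟩
      ⟦ a ≟ᵃ b ⟧ * ⟨ as ∣ e ⟩ + S ∎

  constantTerm : List (Arc n) → Poly n → ℚ
  constantTerm as p = ∑ p (λ (c , e) → c * ⟨ as ∣ e ⟩)

  coefficient-constantTerm : ∀ p → coefficient 1ᵐ p ≡ constantTerm [] p
  coefficient-constantTerm p = trans (∑-filter (λ t → 1ᵐ ≟ᵐ proj₂ t) p proj₁)
    (∑-cong p (λ (c , e) → ℚP.*-comm ⟦ 1ᵐ ≟ᵐ e ⟧ c))

  constantTerm-↭ : ∀ {as bs} → as ↭ bs → ∀ p → constantTerm as p ≡ constantTerm bs p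
  constantTerm-↭ q p = ∑-cong p (λ (c , e) → cong (c *_) (derivative-↭ q e))

  constantTerm-scale : ∀ as c p → constantTerm as (scale c p) ≡ c * constantTerm as p
  constantTerm-scale as c p = trans (∑-map _ p (λ (c , e) → c * ⟨ as ∣ e ⟩))
    (trans (∑-cong p (λ (c′ , e) → ℚP.*-assoc c c′ ⟨ as ∣ e ⟩)) (∑-*ˡ p c (λ (c , e) → c * ⟨ as ∣ e ⟩)))

  constantTerm-∑ᵖ : ∀ as {A : Set} (xs : List A) (f : A → Poly n) →
    constantTerm as (∑ᵖ xs f) ≡ ∑ xs (λ x → constantTerm as (f x))
  constantTerm-∑ᵖ as []       f = refl
  constantTerm-∑ᵖ as (x ∷ xs) f = trans (∑-++ (f x) (∑ᵖ xs f) (λ (c , e) → c * ⟨ as ∣ e ⟩))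
    (cong (constantTerm as (f x) +_) (constantTerm-∑ᵖ as xs f))

  constantTerm-∂ : ∀ as k l p → constantTerm as (∂ k l p) ≡ constantTerm ((k , l) ∷ as) p
  constantTerm-∂ as k l p = trans (∑-map _ p (λ (c , e) → c * ⟨ as ∣ e ⟩))
    (∑-cong p (λ (c , e) → solve 3 (λ x c y → x :* c :* y := c :* (x :* y)) refl
      (ℕ→ℚ (exponent k l e)) c ⟨ as ∣ modifyExponent k l (_∸ 1) e ⟩))

  constantTerm-∂-word : ∀ as k {s} (α : Vec (Fin n) s) p →
    constantTerm as (∂-word k α p) ≡ constantTerm (map (k ,_) (toList α) ++ as) p
  constantTerm-∂-word as k []      p = refl
  constantTerm-∂-word as k (l ∷ α) p = trans (constantTerm-∂ as k l (∂-word k α p))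
    (trans (constantTerm-∂-word ((k , l) ∷ as) k α p)
           (constantTerm-↭ (PermP.shift (k , l) (map (k ,_) (toList α)) as) p))

  zipWith-+-zero : ∀ {s} (v : Vec ℕ s) → Vec.zipWith ℕ._+_ (Vec.replicate s 0) v ≡ v
  zipWith-+-zero []      = refl
  zipWith-+-zero (x ∷ v) = cong (x ∷_) (zipWith-+-zero v)

  zipWith-+-suc : ∀ {s} l (v : Vec ℕ s) → Vec.zipWith ℕ._+_ (Vec.updateAt (Vec.replicate s 0) l suc) v ≡ Vec.updateAt v l suc
  zipWith-+-suc zero    (x ∷ v) = cong (suc x ∷_) (zipWith-+-zero v)
  zipWith-+-suc (suc l) (x ∷ v) = cong (x ∷_) (zipWith-+-suc l v)

  zipWith²-+-zero : ∀ {r s} (e : Vec (Vec ℕ s) r) → Vec.zipWith (Vec.zipWith ℕ._+_) (Vec.replicate r (Vec.replicate s 0)) e ≡ e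
  zipWith²-+-zero []      = refl
  zipWith²-+-zero (v ∷ e) = cong₂ _∷_ (zipWith-+-zero v) (zipWith²-+-zero e)

  zipWith²-+-suc : ∀ {r s} k l (e : Vec (Vec ℕ s) r) →
    Vec.zipWith (Vec.zipWith ℕ._+_) (Vec.updateAt (Vec.replicate r (Vec.replicate s 0)) k (λ row → Vec.updateAt row l suc)) e ≡
    Vec.updateAt e k (λ row → Vec.updateAt row l suc)
  zipWith²-+-suc zero    l (v ∷ e) = cong₂ _∷_ (zipWith-+-suc l v) (zipWith²-+-zero e)
  zipWith²-+-suc (suc k) l (v ∷ e) = cong₂ _∷_ (zipWith-+-zero v) (zipWith²-+-suc k l e)

  constantTerm-var-⊗ : ∀ as k l q →
    constantTerm as (var k l ⊗ q) ≡ ∑ (select as) (λ (b , bs) → ⟦ (k , l) ≟ᵃ b ⟧ * constantTerm bs q)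
  constantTerm-var-⊗ as k l q = begin
    constantTerm as (var k l ⊗ q)
      ≡⟨ ∑-map _ (cartesianProduct (var k l) q) (λ (c , e) → c * ⟨ as ∣ e ⟩) ⟩
    ∑ (cartesianProduct (var k l) q) (λ ((c , e) , (c′ , e′)) → c * c′ * ⟨ as ∣ Vec.zipWith (Vec.zipWith ℕ._+_) e e′ ⟩)
      ≡⟨ trans (∑-cartesianProduct (var k l) q (λ ((c , e) , (c′ , e′)) → c * c′ * ⟨ as ∣ Vec.zipWith (Vec.zipWith ℕ._+_) e e′ ⟩))
               (ℚP.+-identityʳ _) ⟩
    ∑ q (λ (c , e) → 1ℚ * c * ⟨ as ∣ Vec.zipWith (Vec.zipWith ℕ._+_) (modifyExponent k l suc 1ᵐ) e ⟩)
      ≡⟨ ∑-cong q (λ (c , e) → begin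
           1ℚ * c * ⟨ as ∣ Vec.zipWith (Vec.zipWith ℕ._+_) (modifyExponent k l suc 1ᵐ) e ⟩
             ≡⟨ cong₂ (λ x e′ → x * ⟨ as ∣ e′ ⟩) (ℚP.*-identityˡ c) (zipWith²-+-suc k l e) ⟩
           c * ⟨ as ∣ modifyExponent k l suc e ⟩
             ≡⟨ cong (c *_) (leibniz (k , l) as e) ⟩
           c * ∑ (select as) (λ (b , bs) → ⟦ (k , l) ≟ᵃ b ⟧ * ⟨ bs ∣ e ⟩)
             ≡⟨ sym (∑-*ˡ (select as) c (λ (b , bs) → ⟦ (k , l) ≟ᵃ b ⟧ * ⟨ bs ∣ e ⟩)) ⟩
           ∑ (select as) (λ (b , bs) → c * (⟦ (k , l) ≟ᵃ b ⟧ * ⟨ bs ∣ e ⟩)) ∎) ⟩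
    ∑ q (λ (c , e) → ∑ (select as) (λ (b , bs) → c * (⟦ (k , l) ≟ᵃ b ⟧ * ⟨ bs ∣ e ⟩)))
      ≡⟨ ∑-swap q (select as) (λ (c , e) (b , bs) → c * (⟦ (k , l) ≟ᵃ b ⟧ * ⟨ bs ∣ e ⟩)) ⟩
    ∑ (select as) (λ (b , bs) → ∑ q (λ (c , e) → c * (⟦ (k , l) ≟ᵃ b ⟧ * ⟨ bs ∣ e ⟩)))
      ≡⟨ ∑-cong (select as) (λ (b , bs) → trans
           (∑-cong q (λ (c , e) → solve 3 (λ c i x → c :* (i :* x) := i :* (c :* x)) refl c ⟦ (k , l) ≟ᵃ b ⟧ ⟨ bs ∣ e ⟩))
           (∑-*ˡ q ⟦ (k , l) ≟ᵃ b ⟧ (λ (c , e) → c * ⟨ bs ∣ e ⟩))) ⟩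
    ∑ (select as) (λ (b , bs) → ⟦ (k , l) ≟ᵃ b ⟧ * constantTerm bs q) ∎
    where open ≡-Reasoning

  -- The first factor of a product of matrix entries must be removed by one of the derivations,
  -- whose arc becomes the first arc of a trail. Degree and order agree, so factors and arcs run out
  -- together.
  constantTerm-matPow : ∀ L as u r → length as ≡ L → constantTerm as (matPow var L u r) ≡ trails L as u r
  constantTerm-matPow zero [] u r len with u FinP.≟ r
  ... | yes _ = trans (ℚP.+-identityʳ _) (trans (ℚP.*-identityˡ _) (⟦⟧-yes (1ᵐ {n} ≟ᵐ 1ᵐ) refl))
  ... | no _  = refl
  constantTerm-matPow (suc L) as u r len = begin
    constantTerm as (matPow var (suc L) u r)
      ≡⟨ constantTerm-∑ᵖ as (allFin n) (λ i → var u i ⊗ matPow var L i r) ⟩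
    ∑ (allFin n) (λ i → constantTerm as (var u i ⊗ matPow var L i r))
      ≡⟨ ∑-cong (allFin n) (λ i → trans (constantTerm-var-⊗ as u i (matPow var L i r))
           (∑-cong-∈ (select as) λ {(b , bs)} sel → cong (⟦ (u , i) ≟ᵃ b ⟧ *_)
             (constantTerm-matPow L bs i r (ℕP.suc-injective (trans (sym (PermP.↭-length (select-↭ as sel))) len))))) ⟩
    ∑ (allFin n) (λ i → ∑ (select as) (λ (b , bs) → ⟦ (u , i) ≟ᵃ b ⟧ * trails L bs i r))
      ≡⟨ ∑-swap (allFin n) (select as) (λ i (b , bs) → ⟦ (u , i) ≟ᵃ b ⟧ * trails L bs i r) ⟩
    ∑ (select as) (λ (b , bs) → ∑ (allFin n) (λ i → ⟦ (u , i) ≟ᵃ b ⟧ * trails L bs i r))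
      ≡⟨ ∑-cong (select as) (λ (b , bs) → begin
           ∑ (allFin n) (λ i → ⟦ (u , i) ≟ᵃ b ⟧ * trails L bs i r)
             ≡⟨ ∑-cong (allFin n) (λ i → trans (cong (_* trails L bs i r) (split u i b))
                  (ℚP.*-assoc ⟦ u FinP.≟ src b ⟧ ⟦ tgt b FinP.≟ i ⟧ (trails L bs i r))) ⟩
           ∑ (allFin n) (λ i → ⟦ u FinP.≟ src b ⟧ * (⟦ tgt b FinP.≟ i ⟧ * trails L bs i r))
             ≡⟨ ∑-*ˡ (allFin n) ⟦ u FinP.≟ src b ⟧ (λ i → ⟦ tgt b FinP.≟ i ⟧ * trails L bs i r) ⟩
           ⟦ u FinP.≟ src b ⟧ * ∑ (allFin n) (λ i → ⟦ tgt b FinP.≟ i ⟧ * trails L bs i r)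
             ≡⟨ cong (⟦ u FinP.≟ src b ⟧ *_) (∑-allFin-pick (tgt b) (λ i → trails L bs i r)) ⟩
           ⟦ u FinP.≟ src b ⟧ * trails L bs (tgt b) r ∎) ⟩
    trails (suc L) as u r ∎
    where
    open ≡-Reasoning
    split : ∀ u i b → ⟦ (u , i) ≟ᵃ b ⟧ ≡ ⟦ u FinP.≟ src b ⟧ * ⟦ tgt b FinP.≟ i ⟧
    split u i b = trans (⟦⟧-cong ((u , i) ≟ᵃ b) ((u FinP.≟ src b) ×-dec (tgt b FinP.≟ i))
      (λ { refl → refl , refl }) (λ { (refl , refl) → refl })) (⟦⟧-× (u FinP.≟ src b) (tgt b FinP.≟ i))

-- Words ordered by a key

if-yes : ∀ {P A : Set} (P? : Dec P) {x y : A} → P → (if does P? then x else y) ≡ x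
if-yes (yes _) _ = refl
if-yes (no ¬p) p = ⊥-elim (¬p p)

if-no : ∀ {P A : Set} (P? : Dec P) {x y : A} → ¬ P → (if does P? then x else y) ≡ y
if-no (yes p) ¬p = ⊥-elim (¬p p)
if-no (no _)  _  = refl

∑-words-suc : ∀ {A : Set} (xs : List A) d (f : Vec A (suc d) → ℚ) →
  ∑ (words xs (suc d)) f ≡ ∑ xs (λ x → ∑ (words xs d) (λ w → f (x ∷ w)))
∑-words-suc xs d f = trans (∑-concatMap (λ x → map (x ∷_) (words xs d)) xs f)
  (∑-cong xs (λ x → ∑-map (x ∷_) (words xs d) f))

∑-applyUpTo : ∀ d (g : ℕ → ℕ) (f : ℕ → ℚ) → ∑ (applyUpTo g d) f ≡ ∑ (upTo d) (f ∘ g)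
∑-applyUpTo d g f = same d g id {f} {f ∘ g} (λ _ → refl)
  where
  same : ∀ d (g h : ℕ → ℕ) {f f′ : ℕ → ℚ} → (∀ i → f (g i) ≡ f′ (h i)) → ∑ (applyUpTo g d) f ≡ ∑ (applyUpTo h d) f′
  same zero    g h eq = refl
  same (suc d) g h {f} {f′} eq = cong₂ _+_ (eq 0) (same d (g ∘ suc) (h ∘ suc) {f} {f′} (eq ∘ suc))

∑-upTo-suc : ∀ d (f : ℕ → ℚ) → ∑ (upTo (suc d)) f ≡ f 0 + ∑ (upTo d) (f ∘ suc)
∑-upTo-suc d f = cong (f 0 +_) (∑-applyUpTo d suc f)

⟦≤⟧-split : ∀ l k → ⟦ l ℕP.≤? k ⟧ ≡ ⟦ l ℕP.≟ k ⟧ + ⟦ suc l ℕP.≤? k ⟧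
⟦≤⟧-split l k with ℕP.<-cmp l k
... | tri< l<k l≢k _ = trans (⟦⟧-yes (l ℕP.≤? k) (ℕP.<⇒≤ l<k))
  (sym (cong₂ _+_ (⟦⟧-no (l ℕP.≟ k) l≢k) (⟦⟧-yes (suc l ℕP.≤? k) l<k)))
... | tri≈ l≮k l≡k _ = trans (⟦⟧-yes (l ℕP.≤? k) (ℕP.≤-reflexive l≡k))
  (sym (cong₂ _+_ (⟦⟧-yes (l ℕP.≟ k) l≡k) (⟦⟧-no (suc l ℕP.≤? k) l≮k)))
... | tri> l≮k l≢k k<l = trans (⟦⟧-no (l ℕP.≤? k) (ℕP.<⇒≱ k<l))
  (sym (cong₂ _+_ (⟦⟧-no (l ℕP.≟ k) l≢k) (⟦⟧-no (suc l ℕP.≤? k) l≮k)))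

module _ {n : ℕ} {X : Set} (key : X → Fin n) where

  ordered : ∀ {d} → ℕ → Vec X d → ℚ
  ordered l []      = 1ℚ
  ordered l (x ∷ w) = ⟦ l ℕP.≤? toℕ (key x) ⟧ * ordered (toℕ (key x)) w

  ∑-ordered-suc : ∀ (xs : List X) d l (f : Vec X (suc d) → ℚ) →
    ∑ (words xs (suc d)) (λ w → ordered l w * f w) ≡
    ∑ xs (λ x → ⟦ l ℕP.≤? toℕ (key x) ⟧ * ∑ (words xs d) (λ w → ordered (toℕ (key x)) w * f (x ∷ w)))
  ∑-ordered-suc xs d l f = trans (∑-words-suc xs d (λ w → ordered l w * f w)) (∑-cong xs λ x → trans
    (∑-cong (words xs d) λ w → ℚP.*-assoc ⟦ l ℕP.≤? toℕ (key x) ⟧ (ordered (toℕ (key x)) w) (f (x ∷ w)))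
    (∑-*ˡ (words xs d) ⟦ l ℕP.≤? toℕ (key x) ⟧ (λ w → ordered (toℕ (key x)) w * f (x ∷ w))))

  -- The first key of an ascending word is its least one: it equals the bound, or all keys exceed
  -- the bound.
  ∑-ordered-peel : ∀ (xs : List X) d l (f : Vec X (suc d) → ℚ) →
    ∑ (words xs (suc d)) (λ w → ordered l w * f w) ≡
    ∑ xs (λ x → ⟦ l ℕP.≟ toℕ (key x) ⟧ * ∑ (words xs d) (λ w → ordered l w * f (x ∷ w))) +
    ∑ (words xs (suc d)) (λ w → ordered (suc l) w * f w)
  ∑-ordered-peel xs d l f = begin
    ∑ (words xs (suc d)) (λ w → ordered l w * f w)
      ≡⟨ ∑-ordered-suc xs d l f ⟩
    ∑ xs (λ x → ⟦ l ℕP.≤? toℕ (key x) ⟧ * S (toℕ (key x)) x)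
      ≡⟨ ∑-cong xs (λ x → trans (cong (_* S (toℕ (key x)) x) (⟦≤⟧-split l (toℕ (key x))))
           (trans (ℚP.*-distribʳ-+ (S (toℕ (key x)) x) ⟦ l ℕP.≟ toℕ (key x) ⟧ ⟦ suc l ℕP.≤? toℕ (key x) ⟧)
             (cong (_+ ⟦ suc l ℕP.≤? toℕ (key x) ⟧ * S (toℕ (key x)) x)
               (⟦⟧-*-cong (l ℕP.≟ toℕ (key x)) (λ l≡ → cong (λ k → S k x) (sym l≡)))))) ⟩
    ∑ xs (λ x → ⟦ l ℕP.≟ toℕ (key x) ⟧ * S l x + ⟦ suc l ℕP.≤? toℕ (key x) ⟧ * S (toℕ (key x)) x)
      ≡⟨ ∑-+ xs (λ x → ⟦ l ℕP.≟ toℕ (key x) ⟧ * S l x) (λ x → ⟦ suc l ℕP.≤? toℕ (key x) ⟧ * S (toℕ (key x)) x) ⟩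
    ∑ xs (λ x → ⟦ l ℕP.≟ toℕ (key x) ⟧ * S l x) + ∑ xs (λ x → ⟦ suc l ℕP.≤? toℕ (key x) ⟧ * S (toℕ (key x)) x)
      ≡⟨ cong (∑ xs (λ x → ⟦ l ℕP.≟ toℕ (key x) ⟧ * S l x) +_) (sym (∑-ordered-suc xs d (suc l) f)) ⟩
    ∑ xs (λ x → ⟦ l ℕP.≟ toℕ (key x) ⟧ * S l x) + ∑ (words xs (suc d)) (λ w → ordered (suc l) w * f w) ∎
    where
    open ≡-Reasoning
    S : ℕ → X → ℚ
    S k x = ∑ (words xs d) (λ w → ordered k w * f (x ∷ w))

  ∑-ordered-empty : ∀ (xs : List X) d l (f : Vec X (suc d) → ℚ) → n ≤ l →
    ∑ (words xs (suc d)) (λ w → ordered l w * f w) ≡ 0ℚ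
  ∑-ordered-empty xs d l f n≤l = trans (∑-ordered-suc xs d l f) (∑-zero xs λ {x} _ → trans
    (cong (_* ∑ (words xs d) (λ w → ordered (toℕ (key x)) w * f (x ∷ w)))
      (⟦⟧-no (l ℕP.≤? toℕ (key x)) (ℕP.<⇒≱ (ℕP.<-≤-trans (FinP.toℕ<n (key x)) n≤l))))
    (ℚP.*-zeroˡ (∑ (words xs d) (λ w → ordered (toℕ (key x)) w * f (x ∷ w)))))

  ordered-≥0 : ∀ {d} l (w : Vec X d) → 0ℚ ℚ.≤ ordered l w
  ordered-≥0 l []      = ℚP.nonNegative⁻¹ 1ℚ
  ordered-≥0 l (x ∷ w) = 0≤* (⟦⟧-≥0 (l ℕP.≤? toℕ (key x))) (ordered-≥0 (toℕ (key x)) w)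

  ordered-≤1 : ∀ {d} l (w : Vec X d) → ordered l w ℚ.≤ 1ℚ
  ordered-≤1 l []      = ℚP.≤-refl
  ordered-≤1 l (x ∷ w) = *-mono-≤-nonNeg (⟦⟧-≥0 (l ℕP.≤? toℕ (key x))) (ℚP.nonNegative⁻¹ 1ℚ)
    (⟦⟧-≤1 (l ℕP.≤? toℕ (key x))) (ordered-≤1 (toℕ (key x)) w)

  ordered-linked : ∀ {d} (w : Vec X d) (w? : Dec (Linked (Fin._≤_ on key) w)) → ordered 0 w ≡ ⟦ w? ⟧
  ordered-linked []      w? = sym (⟦⟧-yes w? [])
  ordered-linked (x ∷ w) w? = trans (cong (_* ordered (toℕ (key x)) w) (⟦⟧-yes (0 ℕP.≤? toℕ (key x)) z≤n))
    (trans (ℚP.*-identityˡ _) (from x w w?))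
    where
    from : ∀ {d} x (w : Vec X d) (w? : Dec (Linked (Fin._≤_ on key) (x ∷ w))) → ordered (toℕ (key x)) w ≡ ⟦ w? ⟧
    from x []      w? = sym (⟦⟧-yes w? [-])
    from x (y ∷ w) w? = begin
      ⟦ x≤y? ⟧ * ordered (toℕ (key y)) w     ≡⟨ cong (⟦ x≤y? ⟧ *_) (from y w y? ) ⟩
      ⟦ x≤y? ⟧ * ⟦ y? ⟧                       ≡⟨ sym (⟦⟧-× x≤y? y?) ⟩
      ⟦ x≤y? ×-dec y? ⟧                       ≡⟨ ⟦⟧-cong (x≤y? ×-dec y?) w? (λ (p , q) → p ∷ q) (λ { (p ∷ q) → p , q }) ⟩
      ⟦ w? ⟧                                  ∎
      where
      open ≡-Reasoning
      x≤y? = toℕ (key x) ℕP.≤? toℕ (key y)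
      y? = linked? (λ x y → key x FinP.≤? key y) (y ∷ w)

-- The operators defining μ

-- The product of 1/(r s)! over the runs of an ordered word, of lengths r; the
-- current run, of letters l, has already length c.
runWeight : ∀ {n d} → ℕ → ℕ → ℕ → Vec (Fin n) d → ℚ
runWeight s l c []       = 1/ (c ℕ.* s) !
runWeight s l c (k ∷ ks) = if does (l ℕP.≟ toℕ k)
  then runWeight s l (suc c) ks
  else 1/ (c ℕ.* s) ! * runWeight s (toℕ k) 1 ks

-- Once all further keys exceed `l`, its run is complete and its factor splits off. Starting afresh
-- with an empty run at `suc l` costs nothing, since that run contributes 1/0! if no letter joins
-- it.
runWeight-next : ∀ {n d} {X : Set} (key : X → Fin n) s l c (w : Vec X d) →
  ordered key (suc l) w * runWeight s l c (Vec.map key w) ≡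
  ordered key (suc l) w * (1/ (c ℕ.* s) ! * runWeight s (suc l) 0 (Vec.map key w))
runWeight-next key s l c []      = cong (1ℚ *_) (sym (ℚP.*-identityʳ (1/ (c ℕ.* s) !)))
runWeight-next key s l c (x ∷ w) = begin
  i * o * runWeight s l c (k ∷ ks)
    ≡⟨ ℚP.*-assoc i o (runWeight s l c (k ∷ ks)) ⟩
  i * (o * runWeight s l c (k ∷ ks))
    ≡⟨ ⟦⟧-*-cong (suc l ℕP.≤? toℕ k) (λ l<k → cong (o *_) (trans (if-no (l ℕP.≟ toℕ k) (ℕP.<⇒≢ l<k))
         (cong (1/ (c ℕ.* s) ! *_) (sym (start l<k (suc l ℕP.≟ toℕ k)))))) ⟩
  i * (o * (1/ (c ℕ.* s) ! * runWeight s (suc l) 0 (k ∷ ks)))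
    ≡⟨ sym (ℚP.*-assoc i o (1/ (c ℕ.* s) ! * runWeight s (suc l) 0 (k ∷ ks))) ⟩
  i * o * (1/ (c ℕ.* s) ! * runWeight s (suc l) 0 (k ∷ ks)) ∎
  where
  open ≡-Reasoning
  k = key x
  ks = Vec.map key w
  i = ⟦ suc l ℕP.≤? toℕ k ⟧
  o = ordered key (toℕ k) w
  start : suc l ≤ toℕ k → Dec (suc l ≡ toℕ k) → runWeight s (suc l) 0 (k ∷ ks) ≡ runWeight s (toℕ k) 1 ks
  start _ (yes eq) = trans (if-yes (suc l ℕP.≟ toℕ k) eq) (cong (λ l → runWeight s l 1 ks) eq)
  start _ (no neq) = trans (if-no (suc l ℕP.≟ toℕ k) neq) (ℚP.*-identityˡ (runWeight s (toℕ k) 1 ks))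

runWeight-≥0 : ∀ {n d} s l c (ks : Vec (Fin n) d) → 0ℚ ℚ.≤ runWeight s l c ks
runWeight-≥0 s l c []       = 1/!-≥0 (c ℕ.* s)
runWeight-≥0 s l c (k ∷ ks) = by-cases (l ℕP.≟ toℕ k)
  where
  by-cases : Dec (l ≡ toℕ k) → 0ℚ ℚ.≤ runWeight s l c (k ∷ ks)
  by-cases (yes eq) = subst (0ℚ ℚ.≤_) (sym (if-yes (l ℕP.≟ toℕ k) eq)) (runWeight-≥0 s l (suc c) ks)
  by-cases (no neq) = subst (0ℚ ℚ.≤_) (sym (if-no (l ℕP.≟ toℕ k) neq)) (0≤* (1/!-≥0 (c ℕ.* s)) (runWeight-≥0 s (toℕ k) 1 ks))

module _ {n : ℕ} (m : ℕ) (H : Hypergraph n) where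

  private
    s = m ∸ 1
    Letter = Fin n × Vec (Fin n) s

  blocks : List (Vec (Fin n) s)
  blocks = words (allFin n) s

  starArcs : Letter → List (Arc n)
  starArcs (k , α) = map (k ,_) (toList α)

  letterWeight : Letter → ℚ
  letterWeight (k , α) = adjacencyTensor (suc s) H (k ∷ α)

  tupleWeight : ∀ {d} → Tuple n s d → ℚ
  tupleWeight []      = 1ℚ
  tupleWeight (x ∷ F) = letterWeight x * tupleWeight F

  keys : ∀ {d} → Tuple n s d → Vec (Fin n) d
  keys = Vec.map proj₁

  allLetters : List Letter
  allLetters = cartesianProduct (allFin n) blocks

  -- The effect on constant terms of the i-th power of the edge operator at k.
  iterated : Fin n → ℕ → (List (Arc n) → ℚ) → List (Arc n) → ℚ
  iterated k zero    Φ as = Φ as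
  iterated k (suc i) Φ as = ∑ blocks (λ α → letterWeight (k , α) * iterated k i Φ (starArcs (k , α) ++ as))

  iterated-cong : ∀ k i {Φ Ψ} → (∀ as → Φ as ≡ Ψ as) → ∀ as → iterated k i Φ as ≡ iterated k i Ψ as
  iterated-cong k zero    eq as = eq as
  iterated-cong k (suc i) eq as = ∑-cong blocks (λ α → cong (letterWeight (k , α) *_) (iterated-cong k i eq _))

  iterated-∑ : ∀ {A : Set} k i (xs : List A) (Φ : A → List (Arc n) → ℚ) as →
    ∑ xs (λ x → iterated k i (Φ x) as) ≡ iterated k i (λ bs → ∑ xs (λ x → Φ x bs)) as
  iterated-∑ k zero    xs Φ as = refl
  iterated-∑ k (suc i) xs Φ as = trans
    (∑-swap xs blocks (λ x α → letterWeight (k , α) * iterated k i (Φ x) (starArcs (k , α) ++ as)))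
    (∑-cong blocks (λ α → trans
      (∑-*ˡ xs (letterWeight (k , α)) (λ x → iterated k i (Φ x) (starArcs (k , α) ++ as)))
      (cong (letterWeight (k , α) *_) (iterated-∑ k i xs Φ (starArcs (k , α) ++ as)))))

  constantTerm-edgeOperator : ∀ as k p → constantTerm as (edgeOperator m H k p) ≡
    ∑ blocks (λ α → letterWeight (k , α) * constantTerm (starArcs (k , α) ++ as) p)
  constantTerm-edgeOperator as k p = trans
    (constantTerm-∑ᵖ as blocks (λ α → scale (letterWeight (k , α)) (∂-word k α p)))
    (∑-cong blocks (λ α → trans (constantTerm-scale as (letterWeight (k , α)) (∂-word k α p))
      (cong (letterWeight (k , α) *_) (constantTerm-∂-word as k α p))))

  constantTerm-iter : ∀ as k i p →
    constantTerm as (iter (Poly n) (edgeOperator m H k) i p) ≡ iterated k i (λ bs → constantTerm bs p) as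
  constantTerm-iter as k zero    p = refl
  constantTerm-iter as k (suc i) p = trans (constantTerm-edgeOperator as k (iter (Poly n) (edgeOperator m H k) i p))
    (∑-cong blocks (λ α → cong (letterWeight (k , α) *_) (constantTerm-iter (starArcs (k , α) ++ as) k i p)))

  constantTerm-vertexOperator : ∀ as k i p →
    constantTerm as (vertexOperator m H k i p) ≡ 1/ (i ℕ.* s) ! * iterated k i (λ bs → constantTerm bs p) as
  constantTerm-vertexOperator as k i p = trans (constantTerm-scale as (1/ (i ℕ.* s) !) (iter (Poly n) (edgeOperator m H k) i p))
    (cong (1/ (i ℕ.* s) ! *_) (constantTerm-iter as k i p))

  module _ (Φ : List (Arc n) → ℚ) (Φ-↭ : ∀ {as bs} → as ↭ bs → Φ as ≡ Φ bs) where

    orderedSum : ℕ → ℕ → ℕ → List (Arc n) → ℚ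
    orderedSum l c d as = ∑ (words allLetters d) (λ F →
      ordered proj₁ l F * (tupleWeight F * (runWeight s l c (keys F) * Φ (arcs F ++ as))))

    -- The share of the vertex `k` and all later ones in the sum over compositions, `i` being the
    -- entry at `k`. The letters `k` met before are counted by `c`, which is 0 at first and grows in
    -- the recursion, because the factorial sees only the complete run.
    runSum : Fin n → ℕ → ℕ → List (Arc n) → ℚ
    runSum k c d as = ∑ (upTo (suc d)) (λ i →
      1/ ((c ℕ.+ i) ℕ.* s) ! * iterated k i (orderedSum (suc (toℕ k)) 0 (d ∸ i)) as)

    -- Either the run of `k` closes at length `c`, or one more letter `k` is taken and the remaining
    -- multiplicity is again arbitrary.
    runSum-suc : ∀ k c d as → runSum k c (suc d) as ≡
      1/ (c ℕ.* s) ! * orderedSum (suc (toℕ k)) 0 (suc d) as +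
      ∑ blocks (λ α → letterWeight (k , α) * runSum k (suc c) d (starArcs (k , α) ++ as))
    runSum-suc k c d as = begin
      runSum k c (suc d) as
        ≡⟨ ∑-upTo-suc (suc d) (λ i → w (c ℕ.+ i) * iterated k i (Ψ (suc d ∸ i)) as) ⟩
      w (c ℕ.+ 0) * Ψ (suc d) as + ∑ (upTo (suc d)) (λ i → w (c ℕ.+ suc i) * iterated k (suc i) (Ψ (d ∸ i)) as)
        ≡⟨ cong₂ _+_ (cong (λ j → w j * Ψ (suc d) as) (ℕP.+-identityʳ c))
             (∑-cong (upTo (suc d)) (λ i → trans
               (cong (λ j → w j * iterated k (suc i) (Ψ (d ∸ i)) as) (ℕP.+-suc c i))
               (trans (sym (∑-*ˡ blocks (w (suc c ℕ.+ i)) (λ α → h α * iterated k i (Ψ (d ∸ i)) (starArcs (k , α) ++ as))))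
                 (∑-cong blocks (λ α → solve 3 (λ x y z → x :* (y :* z) := y :* (x :* z)) refl
                   (w (suc c ℕ.+ i)) (h α) (iterated k i (Ψ (d ∸ i)) (starArcs (k , α) ++ as))))))) ⟩
      w c * Ψ (suc d) as + ∑ (upTo (suc d)) (λ i → ∑ blocks (λ α → h α * T i α))
        ≡⟨ cong (w c * Ψ (suc d) as +_) (trans (∑-swap (upTo (suc d)) blocks (λ i α → h α * T i α))
             (∑-cong blocks (λ α → ∑-*ˡ (upTo (suc d)) (h α) (λ i → T i α)))) ⟩
      w c * Ψ (suc d) as + ∑ blocks (λ α → h α * runSum k (suc c) d (starArcs (k , α) ++ as)) ∎
      where
      open ≡-Reasoning
      w : ℕ → ℚ
      w j = 1/ (j ℕ.* s) !
      Ψ = orderedSum (suc (toℕ k)) 0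
      h : Vec (Fin n) s → ℚ
      h α = letterWeight (k , α)
      T : ℕ → Vec (Fin n) s → ℚ
      T i α = w (suc c ℕ.+ i) * iterated k i (Ψ (d ∸ i)) (starArcs (k , α) ++ as)

    -- Both sides obey the same recursion on the first letter, the left one by `runSum-suc` and the
    -- right one by `∑-ordered-peel`.
    runSum≡orderedSum : ∀ k d c as → runSum k c d as ≡ orderedSum (toℕ k) c d as
    runSum≡orderedSum k zero c as = trans (ℚP.+-identityʳ _) (trans
      (cong₂ _*_ (cong (λ j → 1/ (j ℕ.* s) !) (ℕP.+-identityʳ c))
        (solve 1 (λ x → con 1ℚ :* (con 1ℚ :* (con 1ℚ :* x)) :+ con 0ℚ := x) refl (Φ as)))
      (solve 2 (λ w x → w :* x := con 1ℚ :* (con 1ℚ :* (w :* x)) :+ con 0ℚ) refl (1/ (c ℕ.* s) !) (Φ as)))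
    runSum≡orderedSum k (suc d) c as = begin
      runSum k c (suc d) as
        ≡⟨ runSum-suc k c d as ⟩
      w c * Ψ (suc d) as + ∑ blocks (λ α → h (k , α) * runSum k (suc c) d (starArcs (k , α) ++ as))
        ≡⟨ cong₂ _+_ later (∑-cong blocks (λ α → cong (h (k , α) *_) (runSum≡orderedSum k d (suc c) (starArcs (k , α) ++ as)))) ⟩
      B + ∑ blocks (λ α → h (k , α) * orderedSum l (suc c) d (starArcs (k , α) ++ as))
        ≡⟨ cong (B +_) (sym (trans first (∑-allFin-pick k (λ v → ∑ blocks (λ α → h (v , α) * orderedSum l (suc c) d (starArcs (v , α) ++ as)))))) ⟩
      B + ∑ allLetters (λ x → ⟦ l ℕP.≟ toℕ (proj₁ x) ⟧ * ∑ (words allLetters d) (λ F → ordered proj₁ l F * f (x ∷ F)))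
        ≡⟨ ℚP.+-comm B _ ⟩
      ∑ allLetters (λ x → ⟦ l ℕP.≟ toℕ (proj₁ x) ⟧ * ∑ (words allLetters d) (λ F → ordered proj₁ l F * f (x ∷ F))) + B
        ≡⟨ sym (∑-ordered-peel proj₁ allLetters d l f) ⟩
      orderedSum l c (suc d) as ∎
      where
      open ≡-Reasoning
      l = toℕ k
      h = letterWeight
      w : ℕ → ℚ
      w j = 1/ (j ℕ.* s) !
      Ψ = orderedSum (suc l) 0
      f : Tuple n s (suc d) → ℚ
      f F = tupleWeight F * (runWeight s l c (keys F) * Φ (arcs F ++ as))
      B = ∑ (words allLetters (suc d)) (λ F → ordered proj₁ (suc l) F * f F)
      later : w c * Ψ (suc d) as ≡ B
      later = trans (sym (∑-*ˡ (words allLetters (suc d)) (w c) (λ F →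
          ordered proj₁ (suc l) F * (tupleWeight F * (runWeight s (suc l) 0 (keys F) * Φ (arcs F ++ as))))))
        (∑-cong (words allLetters (suc d)) (λ F → begin
          w c * (ordered proj₁ (suc l) F * (tupleWeight F * (runWeight s (suc l) 0 (keys F) * Φ (arcs F ++ as))))
            ≡⟨ solve 5 (λ w o t r φ → w :* (o :* (t :* (r :* φ))) := o :* (w :* r) :* (t :* φ)) refl
                 (w c) (ordered proj₁ (suc l) F) (tupleWeight F) (runWeight s (suc l) 0 (keys F)) (Φ (arcs F ++ as)) ⟩
          ordered proj₁ (suc l) F * (w c * runWeight s (suc l) 0 (keys F)) * (tupleWeight F * Φ (arcs F ++ as))
            ≡⟨ cong (_* (tupleWeight F * Φ (arcs F ++ as))) (sym (runWeight-next proj₁ s l c F)) ⟩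
          ordered proj₁ (suc l) F * runWeight s l c (keys F) * (tupleWeight F * Φ (arcs F ++ as))
            ≡⟨ solve 4 (λ o t r φ → o :* r :* (t :* φ) := o :* (t :* (r :* φ))) refl
                 (ordered proj₁ (suc l) F) (tupleWeight F) (runWeight s l c (keys F)) (Φ (arcs F ++ as)) ⟩
          ordered proj₁ (suc l) F * f F ∎))
      first : ∑ allLetters (λ x → ⟦ l ℕP.≟ toℕ (proj₁ x) ⟧ * ∑ (words allLetters d) (λ F → ordered proj₁ l F * f (x ∷ F))) ≡
        ∑ (allFin n) (λ v → ⟦ k FinP.≟ v ⟧ * ∑ blocks (λ α → h (v , α) * orderedSum l (suc c) d (starArcs (v , α) ++ as)))
      first = trans (∑-cartesianProduct (allFin n) blocks
          (λ x → ⟦ l ℕP.≟ toℕ (proj₁ x) ⟧ * ∑ (words allLetters d) (λ F → ordered proj₁ l F * f (x ∷ F))))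
        (∑-cong (allFin n) (λ v → trans (∑-*ˡ blocks ⟦ l ℕP.≟ toℕ v ⟧ (λ α → ∑ (words allLetters d) (λ F → ordered proj₁ l F * f ((v , α) ∷ F))))
          (trans (cong (_* ∑ blocks (λ α → ∑ (words allLetters d) (λ F → ordered proj₁ l F * f ((v , α) ∷ F))))
                   (⟦⟧-cong (l ℕP.≟ toℕ v) (k FinP.≟ v) FinP.toℕ-injective (cong toℕ)))
            (⟦⟧-*-cong (k FinP.≟ v) (λ { refl → ∑-cong blocks (λ α → same α) })))))
        where
        same : ∀ α → ∑ (words allLetters d) (λ F → ordered proj₁ l F * f ((k , α) ∷ F)) ≡
          h (k , α) * orderedSum l (suc c) d (starArcs (k , α) ++ as)
        same α = trans (∑-cong (words allLetters d) (λ F → begin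
          ordered proj₁ l F * (h (k , α) * tupleWeight F * (runWeight s l c (k ∷ keys F) * Φ ((starArcs (k , α) ++ arcs F) ++ as)))
            ≡⟨ cong₂ (λ r φ → ordered proj₁ l F * (h (k , α) * tupleWeight F * (r * φ)))
                 (if-yes (l ℕP.≟ toℕ k) refl) (Φ-↭ (move α F)) ⟩
          ordered proj₁ l F * (h (k , α) * tupleWeight F * (runWeight s l (suc c) (keys F) * Φ (arcs F ++ starArcs (k , α) ++ as)))
            ≡⟨ solve 4 (λ o x t r → o :* (x :* t :* r) := x :* (o :* (t :* r))) refl
                 (ordered proj₁ l F) (h (k , α)) (tupleWeight F) _ ⟩
          h (k , α) * (ordered proj₁ l F * (tupleWeight F * (runWeight s l (suc c) (keys F) * Φ (arcs F ++ starArcs (k , α) ++ as)))) ∎))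
          (∑-*ˡ (words allLetters d) (h (k , α)) (λ F →
            ordered proj₁ l F * (tupleWeight F * (runWeight s l (suc c) (keys F) * Φ (arcs F ++ starArcs (k , α) ++ as)))))
          where
          -- The iterated operator puts the arcs of each new letter in front of those collected
          -- before, whereas `arcs` lists them in the order of the tuple; this is where `Φ-↭` is
          -- needed.
          move : ∀ α (F : Tuple n s d) → (starArcs (k , α) ++ arcs F) ++ as ↭ arcs F ++ starArcs (k , α) ++ as
          move α F = ↭-trans (PermP.++⁺ʳ as (PermP.++-comm (starArcs (k , α)) (arcs F)))
            (↭-reflexive (ListP.++-assoc (arcs F) (starArcs (k , α)) as))

  -- From compositions to ascending tuples

  vertexOperators : ∀ {n′} → (Fin n′ → Fin n) → Vec ℕ n′ → Poly n → Poly n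
  vertexOperators {n′} ι ds p = foldr (λ k → vertexOperator m H (ι k) (Vec.lookup ds k)) p (allFin n′)

  vertexOperators-∷ : ∀ {n′} (ι : Fin (suc n′) → Fin n) i ds p →
    vertexOperators ι (i ∷ ds) p ≡ vertexOperator m H (ι zero) i (vertexOperators (ι ∘ suc) ds p)
  vertexOperators-∷ {n′} ι i ds p = cong (vertexOperator m H (ι zero) i)
    (trans (cong (foldr (λ k → vertexOperator m H (ι k) (Vec.lookup (i ∷ ds) k)) p) (sym (ListP.map-tabulate id suc)))
           (ListP.foldr-map (λ k → vertexOperator m H (ι k) (Vec.lookup (i ∷ ds) k)) suc p (allFin n′)))

  -- `ι` enumerates the vertices from `l` on, so that their operators can be treated by induction
  -- although the vertices stay in `Fin n`. Splitting off the entry at `l` produces `runSum`.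
  constantTerm-vertexOperators : ∀ n′ (ι : Fin n′ → Fin n) l → l ℕ.+ n′ ≡ n → (∀ i → toℕ (ι i) ≡ l ℕ.+ toℕ i) → ∀ d as p →
    ∑ (weakCompositions n′ d) (λ ds → constantTerm as (vertexOperators ι ds p)) ≡
    orderedSum (λ bs → constantTerm bs p) (λ q → constantTerm-↭ q p) l 0 d as
  constantTerm-vertexOperators zero ι l l+0≡n ι≡ zero as p =
    solve 1 (λ x → x :+ con 0ℚ := con 1ℚ :* (con 1ℚ :* (con 1ℚ :* x)) :+ con 0ℚ) refl (constantTerm as p)
  constantTerm-vertexOperators zero ι l l+0≡n ι≡ (suc d) as p = sym (∑-ordered-empty proj₁ allLetters d l
    (λ F → tupleWeight F * (runWeight s l 0 (keys F) * constantTerm (arcs F ++ as) p))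
    (ℕP.≤-reflexive (trans (sym l+0≡n) (ℕP.+-identityʳ l))))
  constantTerm-vertexOperators (suc n′) ι l eq ι≡ d as p = begin
    ∑ (weakCompositions (suc n′) d) (λ ds → constantTerm as (vertexOperators ι ds p))
      ≡⟨ ∑-concatMap (λ i → map (i ∷_) (weakCompositions n′ (d ∸ i))) (upTo (suc d)) (λ ds → constantTerm as (vertexOperators ι ds p)) ⟩
    ∑ (upTo (suc d)) (λ i → ∑ (map (i ∷_) (weakCompositions n′ (d ∸ i))) (λ ds → constantTerm as (vertexOperators ι ds p)))
      ≡⟨ ∑-cong (upTo (suc d)) (λ i → begin
           ∑ (map (i ∷_) (weakCompositions n′ (d ∸ i))) (λ ds → constantTerm as (vertexOperators ι ds p))
             ≡⟨ ∑-map (i ∷_) (weakCompositions n′ (d ∸ i)) (λ ds → constantTerm as (vertexOperators ι ds p)) ⟩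
           ∑ (weakCompositions n′ (d ∸ i)) (λ ds → constantTerm as (vertexOperators ι (i ∷ ds) p))
             ≡⟨ ∑-cong (weakCompositions n′ (d ∸ i)) (λ ds → trans (cong (constantTerm as) (vertexOperators-∷ ι i ds p))
                  (constantTerm-vertexOperator as (ι zero) i (vertexOperators (ι ∘ suc) ds p))) ⟩
           ∑ (weakCompositions n′ (d ∸ i)) (λ ds → 1/ (i ℕ.* s) ! * iterated (ι zero) i (λ bs → constantTerm bs (vertexOperators (ι ∘ suc) ds p)) as)
             ≡⟨ trans (∑-*ˡ (weakCompositions n′ (d ∸ i)) (1/ (i ℕ.* s) !) (λ ds → iterated (ι zero) i (λ bs → constantTerm bs (vertexOperators (ι ∘ suc) ds p)) as))
                  (cong (1/ (i ℕ.* s) ! *_) (iterated-∑ (ι zero) i (weakCompositions n′ (d ∸ i)) (λ ds bs → constantTerm bs (vertexOperators (ι ∘ suc) ds p)) as)) ⟩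
           1/ (i ℕ.* s) ! * iterated (ι zero) i (λ bs → ∑ (weakCompositions n′ (d ∸ i)) (λ ds → constantTerm bs (vertexOperators (ι ∘ suc) ds p))) as
             ≡⟨ cong (1/ (i ℕ.* s) ! *_) (iterated-cong (ι zero) i (λ bs → trans
                  (constantTerm-vertexOperators n′ (ι ∘ suc) (suc l) (trans (sym (ℕP.+-suc l n′)) eq)
                    (λ j → trans (ι≡ (suc j)) (ℕP.+-suc l (toℕ j))) (d ∸ i) bs p)
                  (cong (λ l → orderedSum Φ Φ-↭ (suc l) 0 (d ∸ i) bs) (sym ι0≡l))) as) ⟩
           1/ (i ℕ.* s) ! * iterated (ι zero) i (orderedSum Φ Φ-↭ (suc (toℕ (ι zero))) 0 (d ∸ i)) as ∎) ⟩
    runSum Φ Φ-↭ (ι zero) 0 d as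
      ≡⟨ runSum≡orderedSum Φ Φ-↭ (ι zero) d 0 as ⟩
    orderedSum Φ Φ-↭ (toℕ (ι zero)) 0 d as
      ≡⟨ cong (λ l → orderedSum Φ Φ-↭ l 0 d as) ι0≡l ⟩
    orderedSum Φ Φ-↭ l 0 d as ∎
    where
    open ≡-Reasoning
    Φ : List (Arc n) → ℚ
    Φ bs = constantTerm bs p
    Φ-↭ : ∀ {as bs} → as ↭ bs → Φ as ≡ Φ bs
    Φ-↭ q = constantTerm-↭ q p
    ι0≡l : toℕ (ι zero) ≡ l
    ι0≡l = trans (ι≡ zero) (ℕP.+-identityʳ l)

  length-arcs : ∀ {d} (F : Tuple n s d) → length (arcs F) ≡ d ℕ.* s
  length-arcs []            = refl
  length-arcs ((k , α) ∷ F) = trans (ListP.length-++ (starArcs (k , α)))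
    (cong₂ ℕ._+_ (trans (ListP.length-map (k ,_) (toList α)) (VecP.length-toList α)) (length-arcs F))

  μ-ordered : ∀ d j → μ m H d j ≡ ℕ→ℚ ((m ∸ 1) ^ (n ∸ 1)) * ∑ (words allLetters d) (λ F →
    ordered proj₁ 0 F * (tupleWeight F * (runWeight s 0 0 (keys F) * trails (d ℕ.* s) (arcs F) j j)))
  μ-ordered d j = begin
    μ m H d j
      ≡⟨ coefficient-constantTerm (μᵖ m H d j) ⟩
    constantTerm [] (μᵖ m H d j)
      ≡⟨ constantTerm-scale [] c (∑ᵖ (weakCompositions n d) (λ ds → vertexOperators id ds p)) ⟩
    c * constantTerm [] (∑ᵖ (weakCompositions n d) (λ ds → vertexOperators id ds p))
      ≡⟨ cong (c *_) (trans (constantTerm-∑ᵖ [] (weakCompositions n d) (λ ds → vertexOperators id ds p))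
           (trans (constantTerm-vertexOperators n id 0 refl (λ _ → refl) d [] p)
             (∑-cong (words allLetters d) (λ F → cong (λ t → ordered proj₁ 0 F * (tupleWeight F * (runWeight s 0 0 (keys F) * t)))
               (trans (cong (λ as → constantTerm as p) (ListP.++-identityʳ (arcs F)))
                      (constantTerm-matPow (d ℕ.* s) (arcs F) j j (length-arcs F))))))) ⟩
    c * ∑ (words allLetters d) (λ F →
      ordered proj₁ 0 F * (tupleWeight F * (runWeight s 0 0 (keys F) * trails (d ℕ.* s) (arcs F) j j))) ∎
    where
    open ≡-Reasoning
    c = ℕ→ℚ ((m ∸ 1) ^ (n ∸ 1))
    p = matPow var (d ℕ.* s) j j

-- Ascending words

module _ {A : Set} where

  wordSum : List A → ℕ → (List A → ℚ) → ℚ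
  wordSum xs t f = ∑ (words xs t) (f ∘ toList)

  -- The middle term between all words and ascending words: on functions that vanish at repeated
  -- letters both sums reduce to it.
  subsetSum : List A → ℕ → (List A → ℚ) → ℚ
  subsetSum xs       zero    f = f []
  subsetSum []       (suc t) f = 0ℚ
  subsetSum (x ∷ xs) (suc t) f = subsetSum xs (suc t) f + subsetSum xs t (f ∘ (x ∷_))

  Symmetric : (List A → ℚ) → Set
  Symmetric f = ∀ {xs ys} → xs ↭ ys → f xs ≡ f ys

  -- No sign is involved: together with `Symmetric` it says that `f` vanishes on every word with a
  -- repeated letter.
  Alternating : (List A → ℚ) → Set
  Alternating f = ∀ x xs → f (x ∷ x ∷ xs) ≡ 0ℚ

  Alternating-∷ : ∀ {f} x → Symmetric f → Alternating f → Alternating (f ∘ (x ∷_))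
  Alternating-∷ x f-↭ f-alt y xs = trans (f-↭ (↭-trans (swap x y ↭-refl) (prep y (swap x y ↭-refl)))) (f-alt y (x ∷ xs))

  wordSum-suc : ∀ xs t f → wordSum xs (suc t) f ≡ ∑ xs (λ x → wordSum xs t (f ∘ (x ∷_)))
  wordSum-suc xs t f = ∑-words-suc xs t (f ∘ toList)

  -- The letter x occurs at most once, in one of suc t positions.
  wordSum-∷ : ∀ x xs t (f : List A → ℚ) → Symmetric f → Alternating f →
    wordSum (x ∷ xs) (suc t) f ≡ wordSum xs (suc t) f + ℕ→ℚ (suc t) * wordSum xs t (f ∘ (x ∷_))
  wordSum-∷ x xs zero f f-↭ f-alt = begin
    wordSum (x ∷ xs) 1 f
      ≡⟨ wordSum-suc (x ∷ xs) 0 f ⟩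
    f (x ∷ []) + 0ℚ + ∑ xs (λ y → f (y ∷ []) + 0ℚ)
      ≡⟨ cong (f (x ∷ []) + 0ℚ +_) (sym (wordSum-suc xs 0 f)) ⟩
    f (x ∷ []) + 0ℚ + wordSum xs 1 f
      ≡⟨ solve 2 (λ a b → a :+ con 0ℚ :+ b := b :+ con 1ℚ :* (a :+ con 0ℚ)) refl (f (x ∷ [])) (wordSum xs 1 f) ⟩
    wordSum xs 1 f + 1ℚ * (f (x ∷ []) + 0ℚ) ∎
    where open ≡-Reasoning
  wordSum-∷ x xs (suc t) f f-↭ f-alt = begin
    wordSum (x ∷ xs) (suc (suc t)) f
      ≡⟨ wordSum-suc (x ∷ xs) (suc t) f ⟩
    wordSum (x ∷ xs) (suc t) (f ∘ (x ∷_)) + ∑ xs (λ y → wordSum (x ∷ xs) (suc t) (f ∘ (y ∷_)))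
      ≡⟨ cong₂ _+_ (wordSum-∷ x xs t (f ∘ (x ∷_)) (f-↭ ∘ prep x) (Alternating-∷ x f-↭ f-alt))
           (trans (∑-cong xs (λ y → wordSum-∷ x xs t (f ∘ (y ∷_)) (f-↭ ∘ prep y) (Alternating-∷ y f-↭ f-alt)))
             (∑-+ xs (λ y → wordSum xs (suc t) (f ∘ (y ∷_))) (λ y → T * wordSum xs t (f ∘ (y ∷_) ∘ (x ∷_))))) ⟩
    B + T * wordSum xs t (f ∘ (x ∷_) ∘ (x ∷_)) + (∑ xs (λ y → wordSum xs (suc t) (f ∘ (y ∷_))) + ∑ xs (λ y → T * wordSum xs t (f ∘ (y ∷_) ∘ (x ∷_))))
      ≡⟨ cong₂ _+_ (cong (λ z → B + T * z) (∑-zero (words xs t) (λ {w} _ → f-alt x (toList w))))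
           (cong₂ _+_ (sym (wordSum-suc xs (suc t) f))
             (trans (∑-*ˡ xs T (λ y → wordSum xs t (f ∘ (y ∷_) ∘ (x ∷_)))) (cong (T *_)
               (trans (∑-cong xs (λ y → ∑-cong (words xs t) (λ w → f-↭ (swap y x ↭-refl)))) (sym (wordSum-suc xs t (f ∘ (x ∷_)))))))) ⟩
    B + T * 0ℚ + (C + T * B)
      ≡⟨ solve 3 (λ b c t → b :+ t :* con 0ℚ :+ (c :+ t :* b) := c :+ (con 1ℚ :+ t) :* b) refl B C T ⟩
    C + (1ℚ + T) * B
      ≡⟨ cong (λ z → C + z * B) (sym (ℕ→ℚ-suc (suc t))) ⟩
    C + ℕ→ℚ (suc (suc t)) * B ∎
    where
    open ≡-Reasoning
    T = ℕ→ℚ (suc t)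
    B = wordSum xs (suc t) (f ∘ (x ∷_))
    C = wordSum xs (suc (suc t)) f

  -- Every set of `t` letters is spelled by t! words. In the induction `wordSum-∷` matches the
  -- recursion of `subsetSum`, the factor `suc t` completing t! to the next factorial.
  wordSum-subsetSum : ∀ xs t (f : List A → ℚ) → Symmetric f → Alternating f →
    wordSum xs t f ≡ ℕ→ℚ (t !) * subsetSum xs t f
  wordSum-subsetSum []       zero    f f-↭ f-alt = solve 1 (λ x → x :+ con 0ℚ := con 1ℚ :* x) refl (f [])
  wordSum-subsetSum (_ ∷ _)  zero    f f-↭ f-alt = solve 1 (λ x → x :+ con 0ℚ := con 1ℚ :* x) refl (f [])
  wordSum-subsetSum []       (suc t) f f-↭ f-alt = sym (ℚP.*-zeroʳ (ℕ→ℚ (suc t !)))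
  wordSum-subsetSum (x ∷ xs) (suc t) f f-↭ f-alt = begin
    wordSum (x ∷ xs) (suc t) f
      ≡⟨ wordSum-∷ x xs t f f-↭ f-alt ⟩
    wordSum xs (suc t) f + T * wordSum xs t (f ∘ (x ∷_))
      ≡⟨ cong₂ (λ y z → y + T * z) (wordSum-subsetSum xs (suc t) f f-↭ f-alt)
           (wordSum-subsetSum xs t (f ∘ (x ∷_)) (f-↭ ∘ prep x) (Alternating-∷ x f-↭ f-alt)) ⟩
    ℕ→ℚ (suc t !) * B + T * (ℕ→ℚ (t !) * C)
      ≡⟨ cong (λ y → y * B + T * (ℕ→ℚ (t !) * C)) (ℕ→ℚ-* (suc t) (t !)) ⟩
    T * ℕ→ℚ (t !) * B + T * (ℕ→ℚ (t !) * C)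
      ≡⟨ solve 4 (λ x y b c → x :* y :* b :+ x :* (y :* c) := x :* y :* (b :+ c)) refl T (ℕ→ℚ (t !)) B C ⟩
    T * ℕ→ℚ (t !) * (B + C)
      ≡⟨ cong (_* (B + C)) (sym (ℕ→ℚ-* (suc t) (t !))) ⟩
    ℕ→ℚ (suc t !) * (B + C) ∎
    where
    open ≡-Reasoning
    T = ℕ→ℚ (suc t)
    B = subsetSum xs (suc t) f
    C = subsetSum xs t (f ∘ (x ∷_))

module _ {n : ℕ} where

  ascendingSum : ℕ → ℕ → (List (Fin n) → ℚ) → ℚ
  ascendingSum l t f = ∑ (words (allFin n) t) (λ w → ordered id l w * f (toList w))

  ascendingSum-peel : ∀ k t f → ascendingSum (toℕ k) (suc t) f ≡
    ascendingSum (toℕ k) t (f ∘ (k ∷_)) + ascendingSum (suc (toℕ k)) (suc t) f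
  ascendingSum-peel k t f = trans (∑-ordered-peel id (allFin n) t (toℕ k) (f ∘ toList))
    (cong (_+ ascendingSum (suc (toℕ k)) (suc t) f) (trans
      (∑-cong (allFin n) (λ v → cong (_* ascendingSum (toℕ k) t (f ∘ (v ∷_)))
        (⟦⟧-cong (toℕ k ℕP.≟ toℕ v) (k FinP.≟ v) FinP.toℕ-injective (cong toℕ))))
      (∑-allFin-pick k (λ v → ascendingSum (toℕ k) t (f ∘ (v ∷_))))))

  -- Ascending words may repeat letters, but there `f` vanishes; the strictly ascending ones
  -- correspond to subsets. As before, `ι` enumerates the letters from `l` on.
  subsetSum-ascendingSum : ∀ n′ (ι : Fin n′ → Fin n) l → l ℕ.+ n′ ≡ n → (∀ i → toℕ (ι i) ≡ l ℕ.+ toℕ i) →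
    ∀ t f → Symmetric f → Alternating f → subsetSum (tabulate ι) t f ≡ ascendingSum l t f
  subsetSum-ascendingSum zero     ι l eq ι≡ zero f f-↭ f-alt = solve 1 (λ x → x := con 1ℚ :* x :+ con 0ℚ) refl (f [])
  subsetSum-ascendingSum (suc n′) ι l eq ι≡ zero f f-↭ f-alt = solve 1 (λ x → x := con 1ℚ :* x :+ con 0ℚ) refl (f [])
  subsetSum-ascendingSum zero     ι l eq ι≡ (suc t) f f-↭ f-alt = sym (∑-ordered-empty id (allFin n) t l (f ∘ toList)
    (ℕP.≤-reflexive (trans (sym eq) (ℕP.+-identityʳ l))))
  subsetSum-ascendingSum (suc n′) ι l eq ι≡ (suc t) f f-↭ f-alt = begin
    subsetSum (tabulate (ι ∘ suc)) (suc t) f + subsetSum (tabulate (ι ∘ suc)) t (f ∘ (k ∷_))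
      ≡⟨ cong₂ _+_ (IH (suc t) f f-↭ f-alt) (IH t (f ∘ (k ∷_)) (f-↭ ∘ prep k) (Alternating-∷ k f-↭ f-alt)) ⟩
    ascendingSum (suc l) (suc t) f + ascendingSum (suc l) t (f ∘ (k ∷_))
      ≡⟨ cong (λ l → ascendingSum (suc l) (suc t) f + ascendingSum (suc l) t (f ∘ (k ∷_))) (sym k≡l) ⟩
    ascendingSum (suc (toℕ k)) (suc t) f + ascendingSum (suc (toℕ k)) t (f ∘ (k ∷_))
      ≡⟨ ℚP.+-comm (ascendingSum (suc (toℕ k)) (suc t) f) (ascendingSum (suc (toℕ k)) t (f ∘ (k ∷_))) ⟩
    ascendingSum (suc (toℕ k)) t (f ∘ (k ∷_)) + ascendingSum (suc (toℕ k)) (suc t) f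
      ≡⟨ cong (_+ ascendingSum (suc (toℕ k)) (suc t) f) (sym (no-repeat t)) ⟩
    ascendingSum (toℕ k) t (f ∘ (k ∷_)) + ascendingSum (suc (toℕ k)) (suc t) f
      ≡⟨ sym (ascendingSum-peel k t f) ⟩
    ascendingSum (toℕ k) (suc t) f
      ≡⟨ cong (λ l → ascendingSum l (suc t) f) k≡l ⟩
    ascendingSum l (suc t) f ∎
    where
    open ≡-Reasoning
    k = ι zero
    k≡l : toℕ k ≡ l
    k≡l = trans (ι≡ zero) (ℕP.+-identityʳ l)
    IH : ∀ t f → Symmetric f → Alternating f → subsetSum (tabulate (ι ∘ suc)) t f ≡ ascendingSum (suc l) t f
    IH = subsetSum-ascendingSum n′ (ι ∘ suc) (suc l) (trans (sym (ℕP.+-suc l n′)) eq)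
      (λ j → trans (ι≡ (suc j)) (ℕP.+-suc l (toℕ j)))
    -- After a first letter `k`, the words gained by admitting `k` once more all start with `k`
    -- twice.
    no-repeat : ∀ t → ascendingSum (toℕ k) t (f ∘ (k ∷_)) ≡ ascendingSum (suc (toℕ k)) t (f ∘ (k ∷_))
    no-repeat zero    = refl
    no-repeat (suc t) = trans (ascendingSum-peel k t (f ∘ (k ∷_)))
      (trans (cong (_+ ascendingSum (suc (toℕ k)) (suc t) (f ∘ (k ∷_)))
               (∑-zero (words (allFin n) t) (λ {w} _ → trans (cong (ordered id (toℕ k) w *_) (f-alt k (toList w)))
                 (ℚP.*-zeroʳ (ordered id (toℕ k) w)))))
             (ℚP.+-identityˡ (ascendingSum (suc (toℕ k)) (suc t) (f ∘ (k ∷_)))))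

  -- The set of letters of a word

  ∣∪∣≤∣∣+∣∣ : ∀ {n} (p q : Subset n) → ∣ p ∪ q ∣ ≤ ∣ p ∣ ℕ.+ ∣ q ∣
  ∣∪∣≤∣∣+∣∣ []            []            = z≤n
  ∣∪∣≤∣∣+∣∣ (outside ∷ p) (outside ∷ q) = ∣∪∣≤∣∣+∣∣ p q
  ∣∪∣≤∣∣+∣∣ (inside  ∷ p) (outside ∷ q) = s≤s (∣∪∣≤∣∣+∣∣ p q)
  ∣∪∣≤∣∣+∣∣ (outside ∷ p) (inside  ∷ q) = ℕP.≤-trans (s≤s (∣∪∣≤∣∣+∣∣ p q)) (ℕP.≤-reflexive (sym (ℕP.+-suc ∣ p ∣ ∣ q ∣)))
  ∣∪∣≤∣∣+∣∣ (inside  ∷ p) (inside  ∷ q) = s≤s (ℕP.≤-trans (∣∪∣≤∣∣+∣∣ p q) (ℕP.+-monoʳ-≤ ∣ p ∣ (ℕP.n≤1+n ∣ q ∣)))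

  elements : List (Fin n) → Subset n
  elements xs = ⋃ (map ⁅_⁆ xs)

  elements-↭ : ∀ {xs ys} → xs ↭ ys → elements xs ≡ elements ys
  elements-↭ Perm.refl = refl
  elements-↭ (prep x p) = cong (⁅ x ⁆ ∪_) (elements-↭ p)
  elements-↭ (swap {xs} x y p) = trans (sym (SubP.∪-assoc ⁅ x ⁆ ⁅ y ⁆ (elements xs)))
    (trans (cong (_∪ elements xs) (SubP.∪-comm ⁅ x ⁆ ⁅ y ⁆))
      (trans (SubP.∪-assoc ⁅ y ⁆ ⁅ x ⁆ (elements xs)) (cong (λ p → ⁅ y ⁆ ∪ (⁅ x ⁆ ∪ p)) (elements-↭ p))))
  elements-↭ (Perm.trans p q) = trans (elements-↭ p) (elements-↭ q)

  ∣elements∣≤length : ∀ xs → ∣ elements xs ∣ ≤ length xs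
  ∣elements∣≤length []       = ℕP.≤-reflexive (SubP.∣⊥∣≡0 n)
  ∣elements∣≤length (x ∷ xs) = ℕP.≤-trans (∣∪∣≤∣∣+∣∣ ⁅ x ⁆ (elements xs))
    (ℕP.+-mono-≤ (ℕP.≤-reflexive (SubP.∣⁅x⁆∣≡1 x)) (∣elements∣≤length xs))

  elements-repeat : ∀ x xs → elements (x ∷ x ∷ xs) ≡ elements (x ∷ xs)
  elements-repeat x xs = trans (sym (SubP.∪-assoc ⁅ x ⁆ ⁅ x ⁆ (elements xs))) (cong (_∪ elements xs) (SubP.∪-idem ⁅ x ⁆))

module _ {n : ℕ} (m : ℕ) (H : Hypergraph n) (uniform : Uniform m H) where

  private
    s = m ∸ 1
    Letter = Fin n × Vec (Fin n) s

  m≡suc-s : m ≡ suc s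
  m≡suc-s = sym (ℕP.m+[n∸m]≡n (ℕP.≤-trans (s≤s z≤n) (proj₁ uniform)))

  Admissible : Letter → Set
  Admissible (k , α) = (k ∷ α) ∈E H × Ascending α

  admissible? : ∀ x → Dec (Admissible x)
  admissible? (k , α) = ((k ∷ α) ∈E? H) ×-dec linked? FinP._≤?_ α

  -- The entry 1/s! of the adjacency tensor cancels the s! orders of the letters of α. This count is
  -- exact because uniformity excludes repeated letters.
  ∑-block-ascending : ∀ k (f : List (Fin n) → ℚ) → Symmetric f →
    ∑ (blocks m H) (λ α → letterWeight m H (k , α) * f (toList α)) ≡
    ∑ (blocks m H) (λ α → ⟦ admissible? (k , α) ⟧ * f (toList α))
  ∑-block-ascending k f f-↭ = begin
    ∑ (blocks m H) (λ α → letterWeight m H (k , α) * f (toList α))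
      ≡⟨ ∑-cong (blocks m H) (λ α → trans (cong (_* f (toList α)) (weight (k ∷ α) ((k ∷ α) ∈E? H)))
           (trans (ℚP.*-assoc (1/ s !) ⟦ (k ∷ α) ∈E? H ⟧ (f (toList α))) (cong (λ i → 1/ s ! * (i * f (toList α))) (sym (guard α))))) ⟩
    ∑ (blocks m H) (λ α → 1/ s ! * g (toList α))
      ≡⟨ ∑-*ˡ (blocks m H) (1/ s !) (g ∘ toList) ⟩
    1/ s ! * wordSum (allFin n) s g
      ≡⟨ cong (1/ s ! *_) (wordSum-subsetSum (allFin n) s g g-↭ g-alt) ⟩
    1/ s ! * (ℕ→ℚ (s !) * subsetSum (allFin n) s g)
      ≡⟨ trans (sym (ℚP.*-assoc (1/ s !) (ℕ→ℚ (s !)) _)) (trans (cong (_* subsetSum (allFin n) s g) (1/!-*-! s)) (ℚP.*-identityˡ _)) ⟩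
    subsetSum (allFin n) s g
      ≡⟨ subsetSum-ascendingSum n id 0 refl (λ _ → refl) s g g-↭ g-alt ⟩
    ∑ (blocks m H) (λ α → ordered id 0 α * g (toList α))
      ≡⟨ ∑-cong (blocks m H) (λ α → begin
           ordered id 0 α * (⟦ good? (toList α) ⟧ * f (toList α))
             ≡⟨ cong₂ (λ o i → o * (i * f (toList α))) (ordered-linked id α (linked? FinP._≤?_ α)) (guard α) ⟩
           ⟦ linked? FinP._≤?_ α ⟧ * (⟦ (k ∷ α) ∈E? H ⟧ * f (toList α))
             ≡⟨ solve 3 (λ o i f → o :* (i :* f) := i :* o :* f) refl ⟦ linked? FinP._≤?_ α ⟧ ⟦ (k ∷ α) ∈E? H ⟧ (f (toList α)) ⟩
           ⟦ (k ∷ α) ∈E? H ⟧ * ⟦ linked? FinP._≤?_ α ⟧ * f (toList α)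
             ≡⟨ cong (_* f (toList α)) (sym (⟦⟧-× ((k ∷ α) ∈E? H) (linked? FinP._≤?_ α))) ⟩
           ⟦ admissible? (k , α) ⟧ * f (toList α) ∎) ⟩
    ∑ (blocks m H) (λ α → ⟦ admissible? (k , α) ⟧ * f (toList α)) ∎
    where
    open ≡-Reasoning
    -- The length is recorded because `Alternating` speaks of words of all lengths, while a repeated
    -- letter rules out an edge only in a word of the right length.
    Good : List (Fin n) → Set
    Good xs = Edge H (elements (k ∷ xs)) × length xs ≡ s
    good? : ∀ xs → Dec (Good xs)
    good? xs = edge? H (elements (k ∷ xs)) ×-dec (length xs ℕP.≟ s)
    g : List (Fin n) → ℚ
    g xs = ⟦ good? xs ⟧ * f xs
    weight : ∀ (w : Vec (Fin n) (suc s)) (e? : Dec (w ∈E H)) → (if does e? then 1/ s ! else 0ℚ) ≡ 1/ s ! * ⟦ e? ⟧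
    weight w (yes _) = sym (ℚP.*-identityʳ (1/ s !))
    weight w (no _)  = sym (ℚP.*-zeroʳ (1/ s !))
    guard : ∀ (α : Vec (Fin n) s) → ⟦ good? (toList α) ⟧ ≡ ⟦ (k ∷ α) ∈E? H ⟧
    guard α = ⟦⟧-cong (good? (toList α)) ((k ∷ α) ∈E? H) proj₁ (λ e → e , VecP.length-toList α)
    Good-↭ : ∀ {xs ys} → xs ↭ ys → Good xs → Good ys
    Good-↭ p (e , len) = subst (Edge H) (elements-↭ (prep k p)) e , trans (sym (PermP.↭-length p)) len
    g-↭ : Symmetric g
    g-↭ {xs} {ys} p = cong₂ _*_ (⟦⟧-cong (good? xs) (good? ys) (Good-↭ p) (Good-↭ (↭-sym p))) (f-↭ p)
    -- `k` and `s` letters two of which agree make up at most `s` vertices, one fewer than an edge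
    -- has.
    g-alt : Alternating g
    g-alt x xs = trans (cong (_* f (x ∷ x ∷ xs)) (⟦⟧-no (good? (x ∷ x ∷ xs)) λ (e , len) →
      ℕP.1+n≰n (ℕP.≤-trans (ℕP.≤-reflexive (trans (cong suc len) (trans (sym m≡suc-s)
          (trans (sym (proj₂ uniform _ e)) (cong (λ p → ∣ ⁅ k ⁆ ∪ p ∣) (elements-repeat x xs))))))
        (∣elements∣≤length (k ∷ x ∷ xs))))) (ℚP.*-zeroˡ (f (x ∷ x ∷ xs)))

  allAdmissible? : ∀ {d} (F : Tuple n s d) → Dec (All Admissible F)
  allAdmissible? = all? admissible?

  -- Each word α_k is permuted independently of the others, so that by
  -- ∑-block-ascending the factor 1/s! absorbs the s! orders of its letters.
  ∑-tuple-ascending : ∀ d (R : Vec (Fin n) d → ℚ) (Φ : List (Arc n) → ℚ) → Symmetric Φ →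
    ∑ (words (allLetters m H) d) (λ F → tupleWeight m H F * (R (keys m H F) * Φ (arcs F))) ≡
    ∑ (words (allLetters m H) d) (λ F → ⟦ allAdmissible? F ⟧ * (R (keys m H F) * Φ (arcs F)))
  ∑-tuple-ascending zero R Φ Φ-↭ = refl
  ∑-tuple-ascending (suc d) R Φ Φ-↭ = begin
    ∑ W⁺ (λ F → tupleWeight m H F * (R (keys m H F) * Φ (arcs F)))
      ≡⟨ ∑-words-suc (allLetters m H) d (λ F → tupleWeight m H F * (R (keys m H F) * Φ (arcs F))) ⟩
    ∑ (allLetters m H) (λ x → ∑ W (λ F → letterWeight m H x * tupleWeight m H F * (R (keys m H (x ∷ F)) * Φ (arcs (x ∷ F)))))
      ≡⟨ ∑-cartesianProduct (allFin n) (blocks m H) (λ x → ∑ W (λ F → letterWeight m H x * tupleWeight m H F * (R (keys m H (x ∷ F)) * Φ (arcs (x ∷ F))))) ⟩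
    ∑ (allFin n) (λ k → ∑ (blocks m H) (λ α → ∑ W (λ F → letterWeight m H (k , α) * tupleWeight m H F * (R (k ∷ keys m H F) * Φ (arcs ((k , α) ∷ F))))))
      ≡⟨ ∑-cong (allFin n) (λ k → begin
           ∑ (blocks m H) (λ α → ∑ W (λ F → letterWeight m H (k , α) * tupleWeight m H F * (R (k ∷ keys m H F) * Φ (arcs ((k , α) ∷ F)))))
             ≡⟨ ∑-cong (blocks m H) (λ α → trans
                  (∑-cong W (λ F → ℚP.*-assoc (letterWeight m H (k , α)) (tupleWeight m H F) (R (k ∷ keys m H F) * Φ (arcs ((k , α) ∷ F)))))
                  (trans (∑-*ˡ W (letterWeight m H (k , α)) (λ F → tupleWeight m H F * (R (k ∷ keys m H F) * Φ (arcs ((k , α) ∷ F)))))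
                    (cong (letterWeight m H (k , α) *_) (∑-tuple-ascending d (R ∘ (k ∷_)) (λ as → Φ (map (k ,_) (toList α) ++ as))
                      (λ p → Φ-↭ (PermP.++⁺ˡ (map (k ,_) (toList α)) p)))))) ⟩
           ∑ (blocks m H) (λ α → letterWeight m H (k , α) * f k (toList α))
             ≡⟨ ∑-block-ascending k (f k) (λ p → ∑-cong W (λ F → cong (λ φ → ⟦ allAdmissible? F ⟧ * (R (k ∷ keys m H F) * φ))
                  (Φ-↭ (PermP.++⁺ʳ (arcs F) (PermP.map⁺ (k ,_) p))))) ⟩
           ∑ (blocks m H) (λ α → ⟦ admissible? (k , α) ⟧ * f k (toList α))
             ≡⟨ ∑-cong (blocks m H) (λ α → trans
                  (sym (∑-*ˡ W ⟦ admissible? (k , α) ⟧ (λ F → ⟦ allAdmissible? F ⟧ * (R (k ∷ keys m H F) * Φ (arcs ((k , α) ∷ F))))))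
                  (∑-cong W (λ F → trans (sym (ℚP.*-assoc ⟦ admissible? (k , α) ⟧ ⟦ allAdmissible? F ⟧ (R (k ∷ keys m H F) * Φ (arcs ((k , α) ∷ F)))))
                    (cong (_* (R (k ∷ keys m H F) * Φ (arcs ((k , α) ∷ F)))) (merge (k , α) F))))) ⟩
           ∑ (blocks m H) (λ α → ∑ W (λ F → ⟦ allAdmissible? ((k , α) ∷ F) ⟧ * (R (k ∷ keys m H F) * Φ (arcs ((k , α) ∷ F))))) ∎) ⟩
    ∑ (allFin n) (λ k → ∑ (blocks m H) (λ α → ∑ W (λ F → ⟦ allAdmissible? ((k , α) ∷ F) ⟧ * (R (k ∷ keys m H F) * Φ (arcs ((k , α) ∷ F))))))
      ≡⟨ sym (∑-cartesianProduct (allFin n) (blocks m H) (λ x → ∑ W (λ F → ⟦ allAdmissible? (x ∷ F) ⟧ * (R (keys m H (x ∷ F)) * Φ (arcs (x ∷ F)))))) ⟩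
    ∑ (allLetters m H) (λ x → ∑ W (λ F → ⟦ allAdmissible? (x ∷ F) ⟧ * (R (keys m H (x ∷ F)) * Φ (arcs (x ∷ F)))))
      ≡⟨ sym (∑-words-suc (allLetters m H) d (λ F → ⟦ allAdmissible? F ⟧ * (R (keys m H F) * Φ (arcs F)))) ⟩
    ∑ W⁺ (λ F → ⟦ allAdmissible? F ⟧ * (R (keys m H F) * Φ (arcs F))) ∎
    where
    open ≡-Reasoning
    W = words (allLetters m H) d
    W⁺ = words (allLetters m H) (suc d)
    f : Fin n → List (Fin n) → ℚ
    f k xs = ∑ W (λ F → ⟦ allAdmissible? F ⟧ * (R (k ∷ keys m H F) * Φ (map (k ,_) xs ++ arcs F)))
    merge : ∀ x (F : Tuple n s d) → ⟦ admissible? x ⟧ * ⟦ allAdmissible? F ⟧ ≡ ⟦ allAdmissible? (x ∷ F) ⟧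
    merge x F = trans (sym (⟦⟧-× (admissible? x) (allAdmissible? F)))
      (⟦⟧-cong (admissible? x ×-dec allAdmissible? F) (allAdmissible? (x ∷ F)) (λ (p , q) → p ∷ q) (λ { (p ∷ q) → p , q }))

-- The run weights in terms of outdegrees

⟦⟧-*-≢0 : ∀ {P : Set} (P? : Dec P) {x} → ⟦ P? ⟧ * x ≢ 0ℚ → P × x ≢ 0ℚ
⟦⟧-*-≢0 (yes p) {x} neq = p , λ x≡0 → neq (trans (ℚP.*-identityˡ x) x≡0)
⟦⟧-*-≢0 (no _)  {x} neq = ⊥-elim (neq (ℚP.*-zeroˡ x))

*-cong-≢0 : ∀ x {y z} → (x ≢ 0ℚ → y ≡ z) → x * y ≡ x * z
*-cong-≢0 x {y} {z} eq with x ℚP.≟ 0ℚ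
... | yes refl = trans (ℚP.*-zeroˡ y) (sym (ℚP.*-zeroˡ z))
... | no x≢0   = cong (x *_) (eq x≢0)

module _ {n : ℕ} where

  occurrences : ∀ {d} → Fin n → Vec (Fin n) d → ℕ
  occurrences k ks = count FinP._≟_ k (toList ks)

  ordered-below : ∀ {d} (l : Fin n) b (ks : Vec (Fin n) d) → ordered id b ks ≢ 0ℚ → toℕ l < b → occurrences l ks ≡ 0
  ordered-below l b []       neq l<b = refl
  ordered-below l b (k ∷ ks) neq l<b with ⟦⟧-*-≢0 (b ℕP.≤? toℕ k) neq
  ... | b≤k , neq′ = trans (count-no FinP._≟_ (toList ks) λ { refl → ℕP.<⇒≱ l<b b≤k })
    (ordered-below l (toℕ k) ks neq′ (ℕP.<-≤-trans l<b b≤k))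

  at : Fin n → ℕ → Fin n → ℕ
  at l c k = if does (k FinP.≟ l) then c else 0

  occurrences-∷ : ∀ {d} l k (ks : Vec (Fin n) d) → at l 1 k ℕ.+ occurrences k ks ≡ occurrences k (l ∷ ks)
  occurrences-∷ l k ks with k FinP.≟ l
  ... | yes _ = refl
  ... | no _  = refl

  at-∷ : ∀ {d} l c k (ks : Vec (Fin n) d) → at l (suc c) k ℕ.+ occurrences k ks ≡ at l c k ℕ.+ occurrences k (l ∷ ks)
  at-∷ l c k ks with k FinP.≟ l
  ... | yes _ = sym (ℕP.+-suc c _)
  ... | no _  = refl

  at-0 : ∀ l k → at l 0 k ≡ 0
  at-0 l k with k FinP.≟ l
  ... | yes _ = refl
  ... | no _  = refl

  -- In an ascending word equal letters are consecutive, so there is one run per occurring letter,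
  -- and an absent letter contributes 1/0!. The term `at l c` adds the `c` letters `l` that the
  -- current run had before `ks`.
  runWeight-product : ∀ s {d} l c (ks : Vec (Fin n) d) → ordered id (toℕ l) ks ≢ 0ℚ →
    runWeight s (toℕ l) c ks ≡ ∏ (allFin n) (λ k → 1/ ((at l c k ℕ.+ occurrences k ks) ℕ.* s) !)
  runWeight-product s l c [] neq = begin
    1/ (c ℕ.* s) !                ≡⟨ cong (λ a → 1/ (a ℕ.* s) !) (sym (trans (ℕP.+-identityʳ (at l c l)) (if-yes (l FinP.≟ l) refl))) ⟩
    f l                           ≡⟨ sym (trans (cong (f l *_) (∏-one (allFin n) (λ _ → refl))) (ℚP.*-identityʳ (f l))) ⟩
    f l * ∏ (allFin n) (const 1ℚ) ≡⟨ sym (∏-allFin-replace l f (const 1ℚ) (λ k k≢l → cong (λ a → 1/ (a ℕ.* s) !) (trans (ℕP.+-identityʳ (at l c k)) (if-no (k FinP.≟ l) k≢l)))) ⟩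
    ∏ (allFin n) f * 1ℚ           ≡⟨ ℚP.*-identityʳ (∏ (allFin n) f) ⟩
    ∏ (allFin n) f                ∎
    where
    open ≡-Reasoning
    f : Fin n → ℚ
    f k = 1/ ((at l c k ℕ.+ 0) ℕ.* s) !
  runWeight-product s l c (k₀ ∷ ks) neq with ⟦⟧-*-≢0 (toℕ l ℕP.≤? toℕ k₀) neq
  ... | l≤k₀ , neq′ = by-cases (l FinP.≟ k₀)
    where
    open ≡-Reasoning
    by-cases : Dec (l ≡ k₀) → runWeight s (toℕ l) c (k₀ ∷ ks) ≡
      ∏ (allFin n) (λ k → 1/ ((at l c k ℕ.+ occurrences k (k₀ ∷ ks)) ℕ.* s) !)
    by-cases (yes refl) = trans (if-yes (toℕ l ℕP.≟ toℕ l) refl) (trans (runWeight-product s l (suc c) ks neq′)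
      (∏-cong (allFin n) (λ k → cong (λ a → 1/ (a ℕ.* s) !) (at-∷ l c k ks))))
    by-cases (no l≢k₀) = begin
      runWeight s (toℕ l) c (k₀ ∷ ks)
        ≡⟨ if-no (toℕ l ℕP.≟ toℕ k₀) (l≢k₀ ∘ FinP.toℕ-injective) ⟩
      1/ (c ℕ.* s) ! * runWeight s (toℕ k₀) 1 ks
        ≡⟨ cong₂ _*_ (cong (λ a → 1/ (a ℕ.* s) !) (sym f-l)) (trans (runWeight-product s k₀ 1 ks neq′)
             (∏-cong (allFin n) (λ k → cong (λ a → 1/ (a ℕ.* s) !) (occurrences-∷ k₀ k ks)))) ⟩
      f l * ∏ (allFin n) g
        ≡⟨ sym (∏-allFin-replace l f g (λ k k≢l → cong (λ a → 1/ ((a ℕ.+ occurrences k (k₀ ∷ ks)) ℕ.* s) !) (if-no (k FinP.≟ l) k≢l))) ⟩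
      ∏ (allFin n) f * g l
        ≡⟨ trans (cong (λ a → ∏ (allFin n) f * 1/ (a ℕ.* s) !) none) (ℚP.*-identityʳ (∏ (allFin n) f)) ⟩
      ∏ (allFin n) f ∎
      where
      f g : Fin n → ℚ
      f k = 1/ ((at l c k ℕ.+ occurrences k (k₀ ∷ ks)) ℕ.* s) !
      g k = 1/ (occurrences k (k₀ ∷ ks) ℕ.* s) !
      none : occurrences l (k₀ ∷ ks) ≡ 0
      none = trans (count-no FinP._≟_ (toList ks) l≢k₀)
        (ordered-below l (toℕ k₀) ks neq′ (ℕP.≤∧≢⇒< l≤k₀ (l≢k₀ ∘ FinP.toℕ-injective)))
      f-l : at l c l ℕ.+ occurrences l (k₀ ∷ ks) ≡ c
      f-l = trans (cong₂ ℕ._+_ (if-yes (l FinP.≟ l) refl) none) (ℕP.+-identityʳ c)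

  -- `runWeight-product` takes its bound from a vertex; `j` shows that there is one, so 0 is the
  -- number of the first vertex.
  runWeight-0 : ∀ s {d} → Fin n → (ks : Vec (Fin n) d) → ordered id 0 ks ≢ 0ℚ →
    runWeight s 0 0 ks ≡ ∏ (allFin n) (λ k → 1/ (occurrences k ks ℕ.* s) !)
  runWeight-0 s j ks neq with least j
    where
    least : ∀ {n} → Fin n → ∃ λ (l : Fin n) → toℕ l ≡ 0
    least {suc n} _ = zero , refl
  ... | l , l≡0 = trans (cong (λ b → runWeight s b 0 ks) (sym l≡0))
    (trans (runWeight-product s l 0 ks (subst (λ b → ordered id b ks ≢ 0ℚ) (sym l≡0) neq))
      (∏-cong (allFin n) (λ k → cong (λ a → 1/ ((a ℕ.+ occurrences k ks) ℕ.* s) !) (at-0 l k))))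

  ordered-map : ∀ {X : Set} (key : X → Fin n) {d} l (w : Vec X d) → ordered id l (Vec.map key w) ≡ ordered key l w
  ordered-map key l []      = refl
  ordered-map key l (x ∷ w) = cong (⟦ l ℕP.≤? toℕ (key x) ⟧ *_) (ordered-map key (toℕ (key x)) w)

  count-++ : ∀ (k : Fin n) xs ys → count FinP._≟_ k (xs ++ ys) ≡ count FinP._≟_ k xs ℕ.+ count FinP._≟_ k ys
  count-++ k xs ys = trans (cong length (ListP.filter-++ (k FinP.≟_) xs ys)) (ListP.length-++ (filter (k FinP.≟_) xs))

  out-star : ∀ k i (xs : List (Fin n)) → out (map (i ,_) xs) k ≡ at i (length xs) k
  out-star k i xs = by-cases (k FinP.≟ i) xs
    where
    by-cases : Dec (k ≡ i) → ∀ xs → out (map (i ,_) xs) k ≡ at i (length xs) k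
    by-cases (yes eq) []       = sym (if-yes (k FinP.≟ i) eq)
    by-cases (yes eq) (x ∷ xs) = trans (count-yes FinP._≟_ (map src (map (i ,_) xs)) eq)
      (trans (cong suc (trans (by-cases (yes eq) xs) (if-yes (k FinP.≟ i) eq))) (sym (if-yes (k FinP.≟ i) eq)))
    by-cases (no neq) []       = sym (if-no (k FinP.≟ i) neq)
    by-cases (no neq) (x ∷ xs) = trans (count-no FinP._≟_ (map src (map (i ,_) xs)) neq)
      (trans (by-cases (no neq) xs) (trans (if-no (k FinP.≟ i) neq) (sym (if-no (k FinP.≟ i) neq))))

  -- Each block with first letter `k` supplies `s` arcs leaving `k`; this turns the factorials of
  -- run lengths into factorials of outdegrees.
  occurrences-out : ∀ {s d} (F : Tuple n s d) k → occurrences k (Vec.map proj₁ F) ℕ.* s ≡ out (arcs F) k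
  occurrences-out []            k = refl
  occurrences-out {s} ((i , α) ∷ F) k = begin
    occurrences k (i ∷ Vec.map proj₁ F) ℕ.* s
      ≡⟨ cong (ℕ._* s) (sym (occurrences-∷ i k (Vec.map proj₁ F))) ⟩
    (at i 1 k ℕ.+ occurrences k (Vec.map proj₁ F)) ℕ.* s
      ≡⟨ ℕP.*-distribʳ-+ s (at i 1 k) (occurrences k (Vec.map proj₁ F)) ⟩
    at i 1 k ℕ.* s ℕ.+ occurrences k (Vec.map proj₁ F) ℕ.* s
      ≡⟨ cong₂ ℕ._+_ (trans at-* (sym (out-star k i (toList α)))) (occurrences-out F k) ⟩
    out (map (i ,_) (toList α)) k ℕ.+ out (arcs F) k
      ≡⟨ sym (count-++ k (map src (map (i ,_) (toList α))) (map src (arcs F))) ⟩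
    count FinP._≟_ k (map src (map (i ,_) (toList α)) ++ map src (arcs F))
      ≡⟨ cong (count FinP._≟_ k) (sym (ListP.map-++ src (map (i ,_) (toList α)) (arcs F))) ⟩
    out (arcs ((i , α) ∷ F)) k ∎
    where
    open ≡-Reasoning
    at-* : at i 1 k ℕ.* s ≡ at i (length (toList α)) k
    at-* with k FinP.≟ i
    ... | yes _ = trans (ℕP.+-identityʳ s) (sym (VecP.length-toList α))
    ... | no _  = refl

  outWeight : List (Arc n) → ℚ
  outWeight as = ∏ (allFin n) (λ v → 1/ (out as v) !)

  outWeight-≥0 : ∀ as → 0ℚ ℚ.≤ outWeight as
  outWeight-≥0 as = ∏-≥0 (allFin n) (λ v → 1/!-≥0 (out as v))

  outWeight-outOrders : ∀ as → outWeight as * outOrders as ≡ 1ℚ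
  outWeight-outOrders as = trans (sym (∏-* (allFin n) (λ v → 1/ (out as v) !) (λ v → ℕ→ℚ (out as v !))))
    (∏-one (allFin n) (λ v → 1/!-*-! (out as v)))

  runWeight-outWeight : ∀ {s d} → Fin n → (F : Tuple n s d) →
    ordered proj₁ 0 F * runWeight s 0 0 (Vec.map proj₁ F) ≡ ordered proj₁ 0 F * outWeight (arcs F)
  runWeight-outWeight {s} j F = *-cong-≢0 (ordered proj₁ 0 F) λ neq → trans
    (runWeight-0 s j (Vec.map proj₁ F) (subst (_≢ 0ℚ) (sym (ordered-map proj₁ 0 F)) neq))
    (∏-cong (allFin n) (λ k → cong 1/_! (occurrences-out F k)))

module _ {n : ℕ} (m : ℕ) (H : Hypergraph n) (uniform : Uniform m H) where

  private
    s = m ∸ 1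

  μ-outWeight : ∀ d j → μ m H d j ≡ ℕ→ℚ ((m ∸ 1) ^ (n ∸ 1)) * ∑ (words (allLetters m H) d) (λ F →
    ordered proj₁ 0 F * (⟦ allAdmissible? m H uniform F ⟧ * (outWeight (arcs F) * trails (d ℕ.* s) (arcs F) j j)))
  μ-outWeight d j = trans (μ-ordered m H d j) (cong (ℕ→ℚ ((m ∸ 1) ^ (n ∸ 1)) *_) (begin
    ∑ W (λ F → ordered proj₁ 0 F * (tupleWeight m H F * (runWeight s 0 0 (keys m H F) * trails L (arcs F) j j)))
      ≡⟨ ∑-cong W (λ F → trans
           (solve 4 (λ o x r t → o :* (x :* (r :* t)) := x :* (o :* r :* t)) refl
             (ordered proj₁ 0 F) (tupleWeight m H F) (runWeight s 0 0 (keys m H F)) (trails L (arcs F) j j))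
           (cong (λ o → tupleWeight m H F * (o * runWeight s 0 0 (keys m H F) * trails L (arcs F) j j)) (sym (ordered-map proj₁ 0 F)))) ⟩
    ∑ W (λ F → tupleWeight m H F * (ordered id 0 (keys m H F) * runWeight s 0 0 (keys m H F) * trails L (arcs F) j j))
      ≡⟨ restrict ⟩
    ∑ W (λ F → ⟦ allAdmissible? m H uniform F ⟧ * (ordered id 0 (keys m H F) * runWeight s 0 0 (keys m H F) * trails L (arcs F) j j))
      ≡⟨ ∑-cong W (λ F → trans
           (cong (λ x → ⟦ allAdmissible? m H uniform F ⟧ * (x * trails L (arcs F) j j))
             (trans (cong (_* runWeight s 0 0 (keys m H F)) (ordered-map proj₁ 0 F)) (runWeight-outWeight j F)))
           (solve 4 (λ a o x t → a :* (o :* x :* t) := o :* (a :* (x :* t))) refl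
             ⟦ allAdmissible? m H uniform F ⟧ (ordered proj₁ 0 F) (outWeight (arcs F)) (trails L (arcs F) j j))) ⟩
    ∑ W (λ F → ordered proj₁ 0 F * (⟦ allAdmissible? m H uniform F ⟧ * (outWeight (arcs F) * trails L (arcs F) j j))) ∎))
    where
    open ≡-Reasoning
    W = words (allLetters m H) d
    L = d ℕ.* s
    p = matPow var L j j
    -- `∑-tuple-ascending` needs a function of the multiset of arcs. `constantTerm` is one because
    -- derivatives commute, so the trails are rewritten as constant terms and back.
    as-constantTerm : ∀ F → trails L (arcs F) j j ≡ constantTerm (arcs F) p
    as-constantTerm F = sym (constantTerm-matPow L (arcs F) j j (length-arcs m H F))
    restrict : ∑ W (λ F → tupleWeight m H F * (ordered id 0 (keys m H F) * runWeight s 0 0 (keys m H F) * trails L (arcs F) j j)) ≡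
      ∑ W (λ F → ⟦ allAdmissible? m H uniform F ⟧ * (ordered id 0 (keys m H F) * runWeight s 0 0 (keys m H F) * trails L (arcs F) j j))
    restrict = trans
      (∑-cong W (λ F → cong (λ t → tupleWeight m H F * (ordered id 0 (keys m H F) * runWeight s 0 0 (keys m H F) * t)) (as-constantTerm F)))
      (trans (∑-tuple-ascending m H uniform d (λ ks → ordered id 0 ks * runWeight s 0 0 ks) (λ as → constantTerm as p) (λ q → constantTerm-↭ q p))
        (∑-cong W (λ F → cong (λ t → ⟦ allAdmissible? m H uniform F ⟧ * (ordered id 0 (keys m H F) * runWeight s 0 0 (keys m H F) * t)) (sym (as-constantTerm F)))))

-- Arborescences and Eulerian walks of D(F)

module _ {A : Set} where

  pick : (as : List A) → Subset (length as) → List A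
  pick []       []            = []
  pick (a ∷ as) (outside ∷ T) = pick as T
  pick (a ∷ as) (inside  ∷ T) = a ∷ pick as T

  ∑-pick : ∀ as (f : List A → ℚ) →
    ∑ (words (outside ∷ inside ∷ []) (length as)) (f ∘ pick as) ≡ ∑ (sublists as) f
  ∑-pick []       f = refl
  ∑-pick (a ∷ as) f = begin
    ∑ (words (outside ∷ inside ∷ []) (suc (length as))) (f ∘ pick (a ∷ as))
      ≡⟨ ∑-words-suc (outside ∷ inside ∷ []) (length as) (f ∘ pick (a ∷ as)) ⟩
    ∑ W (f ∘ pick as) + (∑ W (λ T → f (a ∷ pick as T)) + 0ℚ)
      ≡⟨ cong₂ _+_ (∑-pick as f) (trans (ℚP.+-identityʳ _) (∑-pick as (f ∘ (a ∷_)))) ⟩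
    ∑ (sublists as) f + ∑ (sublists as) (λ T → f (a ∷ T))
      ≡⟨ sym (∑-sublists-∷ a as f) ⟩
    ∑ (sublists (a ∷ as)) f ∎
    where
    open ≡-Reasoning
    W = words (outside ∷ inside ∷ []) (length as)

  pick-∈⁺ : ∀ as T k → k ∈ T → lookup as k ∈ˡ pick as T
  pick-∈⁺ (a ∷ as) (inside  ∷ T) zero    Vec.here      = here refl
  pick-∈⁺ (a ∷ as) (inside  ∷ T) (suc k) (Vec.there p) = there (pick-∈⁺ as T k p)
  pick-∈⁺ (a ∷ as) (outside ∷ T) (suc k) (Vec.there p) = pick-∈⁺ as T k p

  pick-∈⁻ : ∀ as T {a} → a ∈ˡ pick as T → ∃ λ k → k ∈ T × lookup as k ≡ a
  pick-∈⁻ []       []            ()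
  pick-∈⁻ (a ∷ as) (inside  ∷ T) (here refl) = zero , Vec.here , refl
  pick-∈⁻ (a ∷ as) (inside  ∷ T) (there p) with pick-∈⁻ as T p
  ... | k , q , eq = suc k , Vec.there q , eq
  pick-∈⁻ (a ∷ as) (outside ∷ T) p with pick-∈⁻ as T p
  ... | k , q , eq = suc k , Vec.there q , eq

  count-≡⇒↭ : ∀ (_≟_ : DecidableEquality A) xs ys → (∀ x → count _≟_ x xs ≡ count _≟_ x ys) → xs ↭ ys
  count-≡⇒↭ _≟_ []       []       eq = ↭-refl
  count-≡⇒↭ _≟_ []       (y ∷ ys) eq = ⊥-elim (∈⇒count≢0 _≟_ {xs = y ∷ ys} (here refl) (sym (eq y)))
  count-≡⇒↭ _≟_ (x ∷ xs) ys       eq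
    with ∈P.∈-∃++ (count≢0⇒∈ _≟_ x ys (∈⇒count≢0 _≟_ {xs = x ∷ xs} (here refl) ∘ trans (eq x)))
  ... | as , bs , refl = ↭-trans (prep x (count-≡⇒↭ _≟_ xs (as ++ bs) rest)) (↭-sym (PermP.shift x as bs))
    where
    cons : ∀ y → count _≟_ y (x ∷ xs) ≡ count _≟_ y (x ∷ as ++ bs)
    cons y = trans (eq y) (count-↭ _≟_ y (PermP.shift x as bs))
    rest : ∀ y → count _≟_ y xs ≡ count _≟_ y (as ++ bs)
    rest y with y ≟ x
    ... | yes y≡x = ℕP.suc-injective (trans (sym (count-yes _≟_ xs y≡x)) (trans (cons y) (count-yes _≟_ (as ++ bs) y≡x)))
    ... | no y≢x  = trans (sym (count-no _≟_ xs y≢x)) (trans (cons y) (count-no _≟_ (as ++ bs) y≢x))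

length-filter-tabulate-suc : ∀ {n} {P : Fin (suc n) → Set} {Q : Fin n → Set} (P? : Decidable P) (Q? : Decidable Q) →
  (∀ {k} → P (suc k) → Q k) → (∀ {k} → Q k → P (suc k)) →
  length (filter P? (tabulate suc)) ≡ length (filter Q? (allFin n))
length-filter-tabulate-suc {n} P? Q? f g = trans
  (cong (length ∘ filter P?) (sym (ListP.map-tabulate id suc))) (go (allFin n))
  where
  go : ∀ ks → length (filter P? (map suc ks)) ≡ length (filter Q? ks)
  go [] = refl
  go (k ∷ ks) with P? (suc k) | Q? k
  ... | yes _ | yes _ = cong suc (go ks)
  ... | no _  | no _  = go ks
  ... | yes p | no ¬q = ⊥-elim (¬q (f p))
  ... | no ¬p | yes q = ⊥-elim (¬p (g q))

x∉p-x : ∀ {n} (p : Subset n) x → ¬ (x ∈ p - x)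
x∉p-x (outside ∷ p) zero    ()
x∉p-x (inside  ∷ p) zero    ()
x∉p-x (_       ∷ p) (suc x) (Vec.there x∈) = x∉p-x p x x∈

module _ {n : ℕ} where

  inTree? : ∀ (as : List (Arc n)) (T : Subset (length as)) v → Decidable (λ k → k ∈ T × proj₁ (lookup as k) ≡ v)
  inTree? as T v k = (k SubP.∈? T) ×-dec (proj₁ (lookup as k) FinP.≟ v)

  out-pick : ∀ (as : List (Arc n)) T v → length (filter (inTree? as T v) (allFin (length as))) ≡ out (pick as T) v
  out-pick []       []      v = refl
  out-pick (a ∷ as) (t ∷ T) v = step t (proj₁ a FinP.≟ v)
    where
    tail : ∀ t → length (filter (inTree? (a ∷ as) (t ∷ T) v) (tabulate suc)) ≡ out (pick as T) v
    tail t = trans (length-filter-tabulate-suc (inTree? (a ∷ as) (t ∷ T) v) (inTree? as T v)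
      (λ { (Vec.there p , eq) → p , eq }) (λ { (p , eq) → Vec.there p , eq })) (out-pick as T v)
    step : ∀ t → Dec (proj₁ a ≡ v) → length (filter (inTree? (a ∷ as) (t ∷ T) v) (allFin (suc (length as)))) ≡ out (pick (a ∷ as) (t ∷ T)) v
    step outside _ = trans (cong length (ListP.filter-reject (inTree? (a ∷ as) (outside ∷ T) v) {zero} {tabulate suc} λ { (() , _) }))
      (tail outside)
    step inside (yes eq) = trans (cong length (ListP.filter-accept (inTree? (a ∷ as) (inside ∷ T) v) {zero} {tabulate suc} (Vec.here , eq)))
      (trans (cong suc (tail inside)) (sym (count-yes FinP._≟_ (map src (pick as T)) (sym eq))))
    step inside (no neq) = trans (cong length (ListP.filter-reject (inTree? (a ∷ as) (inside ∷ T) v) {zero} {tabulate suc} (neq ∘ proj₂)))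
      (trans (tail inside) (sym (count-no FinP._≟_ (map src (pick as T)) (neq ∘ sym))))

  module _ {s d : ℕ} (F : Tuple n s d) where

    ∈vertices⇒endpoint : ∀ {v} → v ∈ vertices F → v IsEndpointOf arcs F
    ∈vertices⇒endpoint = go (arcs F)
      where
      go : ∀ as {v} → v ∈ ⋃ (map (λ (u , v) → ⁅ u ⁆ ∪ ⁅ v ⁆) as) → v IsEndpointOf as
      go []             p = ⊥-elim (SubP.∉⊥ p)
      go ((u , w) ∷ as) {v} p with SubP.x∈p∪q⁻ (⁅ u ⁆ ∪ ⁅ w ⁆) (⋃ (map (λ (u , v) → ⁅ u ⁆ ∪ ⁅ v ⁆) as)) p
      ... | inj₂ q with go as q
      ...   | x , inj₁ e = x , inj₁ (there e)
      ...   | x , inj₂ e = x , inj₂ (there e)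
      go ((u , w) ∷ as) {v} p | inj₁ q with SubP.x∈p∪q⁻ ⁅ u ⁆ ⁅ w ⁆ q
      ... | inj₁ r with SubP.x∈⁅y⁆⇒x≡y u r
      ...   | refl = w , inj₁ (here refl)
      go ((u , w) ∷ as) {v} p | inj₁ q | inj₂ r with SubP.x∈⁅y⁆⇒x≡y w r
      ...   | refl = u , inj₂ (here refl)

    src∈vertices : ∀ {v w} → (v , w) ∈ˡ arcs F → v ∈ vertices F
    src∈vertices = go (arcs F)
      where
      go : ∀ as {v w} → (v , w) ∈ˡ as → v ∈ ⋃ (map (λ (u , v) → ⁅ u ⁆ ∪ ⁅ v ⁆) as)
      go ((u , w) ∷ as) (here refl) = SubP.x∈p∪q⁺ (inj₁ (SubP.x∈p∪q⁺ (inj₁ (SubP.x∈⁅x⁆ u))))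
      go ((u , w) ∷ as) (there e)   = SubP.x∈p∪q⁺ {p = ⁅ u ⁆ ∪ ⁅ w ⁆} (inj₂ (go as e))

    eulerian⇒closedWalk : Eulerian F → ∃ λ u → ∃ λ ws → walkEnd u ws ≡ u × walkArcs u ws ↭ arcs F
    eulerian⇒closedWalk (u , ws , end , eq) = u , ws , end ,
      count-≡⇒↭ _≟ᵃ_ (walkArcs u ws) (arcs F) (λ (a , b) → eq a b)

    closedWalk⇒eulerian : ∀ {u ws} → walkEnd u ws ≡ u → walkArcs u ws ↭ arcs F → Eulerian F
    closedWalk⇒eulerian {u} {ws} end p = u , ws , end , (λ a b → count-↭ _≟ᵃ_ (a , b) p)

    eulerian⇒balanced : Eulerian F → map src (arcs F) ↭ map tgt (arcs F)
    eulerian⇒balanced eul with eulerian⇒closedWalk eul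
    ... | u , ws , end , p = closedWalk-balanced end p

    -- By balance a vertex that is entered is also left. The vertices of D(F) are thus those that
    -- `tree` has to span.
    ∈vertices⇒out≢0 : Eulerian F → ∀ {v} → v ∈ vertices F → out (arcs F) v ≢ 0
    ∈vertices⇒out≢0 eul {v} v∈V with ∈vertices⇒endpoint v∈V
    ... | _ , inj₁ e = ∈⇒out≢0 e
    ... | _ , inj₂ e = ∈⇒inn≢0 e ∘ trans (sym (count-↭ FinP._≟_ v (eulerian⇒balanced eul)))

    out≢0⇒∈vertices : ∀ {v} → out (arcs F) v ≢ 0 → v ∈ vertices F
    out≢0⇒∈vertices {v} o = src∈vertices (proj₂ (out≢0⇒∈ (arcs F) v o))

    t-tree : Eulerian F → ∀ r → ℕ→ℚ (t F r) ≡ tree r (arcs F)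
    t-tree eul r = begin
      ℕ→ℚ (t F r)
        ≡⟨ length-filter (isArborescence? F r) (words (outside ∷ inside ∷ []) (length as)) ⟩
      ∑ (words (outside ∷ inside ∷ []) (length as)) (λ T → ⟦ isArborescence? F r T ⟧)
        ≡⟨ ∑-cong (words (outside ∷ inside ∷ []) (length as)) (λ T →
             ⟦⟧-cong (isArborescence? F r T) (arborescence? r (out as) (pick as T)) (to T) (from T)) ⟩
      ∑ (words (outside ∷ inside ∷ []) (length as)) (λ T → ⟦ arborescence? r (out as) (pick as T) ⟧)
        ≡⟨ ∑-pick as (λ T → ⟦ arborescence? r (out as) T ⟧) ⟩
      tree r as ∎
      where
      open ≡-Reasoning
      as = arcs F
      module _ (T : Subset (length as)) where
        degree : ∀ v → outdegreeIn F T v ≡ out (pick as T) v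
        degree = out-pick as T
        to-path : ∀ {u v} → Star (ArcOf F T) u v → Path (pick as T) u v
        to-path ε                    = ε
        to-path ((k , k∈T , eq) ◅ p) = subst (_∈ˡ pick as T) eq (pick-∈⁺ as T k k∈T) ◅ to-path p
        from-path : ∀ {u v} → Path (pick as T) u v → Star (ArcOf F T) u v
        from-path ε       = ε
        from-path (e ◅ p) = pick-∈⁻ as T e ◅ from-path p
        to : IsArborescence F r T → Arborescence r (out as) (pick as T)
        to (root , one , path) = trans (sym (degree r)) root ,
          (λ v o v≢r → trans (sym (degree v)) (one v (out≢0⇒∈vertices o) v≢r)) ,
          (λ v o v≢r → to-path (path v (out≢0⇒∈vertices o)))
        from : Arborescence r (out as) (pick as T) → IsArborescence F r T
        from (root , one , path) = trans (degree r) root ,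
          (λ v v∈V v≢r → trans (degree v) (one v (∈vertices⇒out≢0 eul v∈V) v≢r)) ,
          (λ v v∈V → path′ v v∈V (v FinP.≟ r))
          where
          path′ : ∀ v → v ∈ vertices F → Dec (v ≡ r) → Star (ArcOf F T) v r
          path′ v v∈V (yes refl) = ε
          path′ v v∈V (no v≢r)   = from-path (path v (∈vertices⇒out≢0 eul v∈V) v≢r)

    private
      as = arcs F

    ∏-filter : ∀ {P : Fin n → Set} (P? : Decidable P) (f : Fin n → ℕ) (xs : List (Fin n)) →
      ℕ→ℚ (∏ℕ (filter P? xs) f) ≡ ∏ xs (λ v → if does (P? v) then ℕ→ℚ (f v) else 1ℚ)
    ∏-filter P? f []       = refl
    ∏-filter P? f (x ∷ xs) with P? x
    ... | yes _ = trans (ℕ→ℚ-* (f x) (∏ℕ (filter P? xs) f)) (cong (ℕ→ℚ (f x) *_) (∏-filter P? f xs))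
    ... | no _  = trans (∏-filter P? f xs) (sym (ℚP.*-identityˡ _))

    -- Holds vertex by vertex, with d the outdegree: at `j` the factors are 1/d! and d!, at any
    -- other vertex of D(F) they are 1/d!, (d - 1)! and d. At a vertex other than `j` outside D(F)
    -- the truncated 0 ∸ 1 gives 0! and all factors are 1.
    outWeight-exitOrders : Eulerian F → ∀ j →
      outWeight as * exitOrders j as * ℕ→ℚ (∏-outdegrees F (vertices F - j)) ≡ 1ℚ
    outWeight-exitOrders eul j = begin
      outWeight as * exitOrders j as * ℕ→ℚ (∏-outdegrees F (vertices F - j))
        ≡⟨ cong₂ _*_ (sym (∏-* (allFin n) (λ v → 1/ (out as v) !) (λ v → ℕ→ℚ (exits j v (out as v) !))))
             (∏-filter in? (outdegree F) (allFin n)) ⟩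
      ∏ (allFin n) (λ v → 1/ (out as v) ! * ℕ→ℚ (exits j v (out as v) !)) * ∏ (allFin n) (λ v → if does (in? v) then ℕ→ℚ (out as v) else 1ℚ)
        ≡⟨ sym (∏-* (allFin n) (λ v → 1/ (out as v) ! * ℕ→ℚ (exits j v (out as v) !)) (λ v → if does (in? v) then ℕ→ℚ (out as v) else 1ℚ)) ⟩
      ∏ (allFin n) (λ v → 1/ (out as v) ! * ℕ→ℚ (exits j v (out as v) !) * (if does (in? v) then ℕ→ℚ (out as v) else 1ℚ))
        ≡⟨ ∏-one (allFin n) (λ v → factor v (v FinP.≟ j) (out as v) refl) ⟩
      1ℚ ∎
      where
      open ≡-Reasoning
      in? : ∀ v → Dec (v ∈ (vertices F - j))
      in? v = v SubP.∈? (vertices F - j)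
      factor : ∀ v → Dec (v ≡ j) → ∀ k → out as v ≡ k →
        1/ (out as v) ! * ℕ→ℚ (exits j v (out as v) !) * (if does (in? v) then ℕ→ℚ (out as v) else 1ℚ) ≡ 1ℚ
      factor v (yes refl) k o = trans (cong₂ (λ l x → 1/ (out as v) ! * ℕ→ℚ (l !) * x)
        (exits-root j (out as v) refl) (if-no (in? v) (x∉p-x (vertices F) v)))
        (trans (ℚP.*-identityʳ _) (1/!-*-! (out as v)))
      factor v (no v≢j) zero o = trans (cong₂ (λ l x → 1/ (out as v) ! * ℕ→ℚ (l !) * x)
        (trans (exits-other j (out as v) v≢j) (cong (_∸ 1) o))
        (if-no (in? v) (λ v∈ → ∈vertices⇒out≢0 eul (SubP.p─q⊆p (vertices F) ⁅ j ⁆ v∈) o)))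
        (cong (λ k → 1/ k ! * 1ℚ * 1ℚ) o)
      factor v (no v≢j) (suc k) o = begin
        1/ (out as v) ! * ℕ→ℚ (exits j v (out as v) !) * (if does (in? v) then ℕ→ℚ (out as v) else 1ℚ)
          ≡⟨ cong₂ (λ l x → 1/ (out as v) ! * ℕ→ℚ (l !) * x)
               (trans (exits-other j (out as v) v≢j) (cong (_∸ 1) o))
               (if-yes (in? v) (SubP.x∈p∧x≢y⇒x∈p-y (out≢0⇒∈vertices (λ eq → ℕP.1+n≢0 (trans (sym o) eq))) v≢j)) ⟩
        1/ (out as v) ! * ℕ→ℚ (k !) * ℕ→ℚ (out as v)
          ≡⟨ cong (λ l → 1/ l ! * ℕ→ℚ (k !) * ℕ→ℚ l) o ⟩
        1/ (suc k) ! * ℕ→ℚ (k !) * ℕ→ℚ (suc k)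
          ≡⟨ solve 3 (λ x y z → x :* y :* z := x :* (z :* y)) refl (1/ (suc k) !) (ℕ→ℚ (k !)) (ℕ→ℚ (suc k)) ⟩
        1/ (suc k) ! * (ℕ→ℚ (suc k) * ℕ→ℚ (k !))
          ≡⟨ cong (1/ (suc k) ! *_) (sym (ℕ→ℚ-* (suc k) (k !))) ⟩
        1/ (suc k) ! * ℕ→ℚ (suc k !)
          ≡⟨ 1/!-*-! (suc k) ⟩
        1ℚ ∎

    -- The equation excludes `b ≡ 0`, so the default value of `ratio` never enters.
    ratio-unique : ∀ a b x → x * ℕ→ℚ b ≡ 1ℚ → ratio a b ≡ ℕ→ℚ a * x
    ratio-unique a zero    x eq = ⊥-elim (ℚP.1≢0 (trans (sym eq) (ℚP.*-zeroʳ x)))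
    ratio-unique a (suc b) x eq = *-cancelʳ-≢0 (ℕ→ℚ (suc b)) (ℕ→ℚ-≢0 (suc b)) (begin
      ratio a (suc b) * ℕ→ℚ (suc b)     ≡⟨ fraction-*-denominator a (suc b) ⟩
      ℕ→ℚ a                             ≡⟨ sym (ℚP.*-identityʳ (ℕ→ℚ a)) ⟩
      ℕ→ℚ a * 1ℚ                        ≡⟨ cong (ℕ→ℚ a *_) (sym eq) ⟩
      ℕ→ℚ a * (x * ℕ→ℚ (suc b))         ≡⟨ sym (ℚP.*-assoc (ℕ→ℚ a) x (ℕ→ℚ (suc b))) ⟩
      ℕ→ℚ a * x * ℕ→ℚ (suc b)           ∎)
      where open ≡-Reasoning

    -- The BEST theorem yields arborescences rooted at the start `j` of the trails; `tree-root`
    -- moves the root to the prescribed `r`.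
    trails-eulerian : Eulerian F → ∀ {j r} → j ∈ vertices F → r ∈ vertices F → ∀ L → length as ≡ L →
      outWeight as * trails L as j j ≡ ratio (t F r) (∏-outdegrees F (vertices F - j))
    trails-eulerian eul {j} {r} j∈V r∈V L len = begin
      outWeight as * trails L as j j
        ≡⟨ cong (outWeight as *_) (best L as j j len (prep j (eulerian⇒balanced eul))) ⟩
      outWeight as * (tree j as * exitOrders j as)
        ≡⟨ solve 3 (λ x y z → x :* (y :* z) := y :* (x :* z)) refl (outWeight as) (tree j as) (exitOrders j as) ⟩
      tree j as * (outWeight as * exitOrders j as)
        ≡⟨ cong (_* (outWeight as * exitOrders j as)) (trans same-tree (sym (t-tree eul r))) ⟩
      ℕ→ℚ (t F r) * (outWeight as * exitOrders j as)
        ≡⟨ sym (ratio-unique (t F r) (∏-outdegrees F (vertices F - j)) (outWeight as * exitOrders j as) (outWeight-exitOrders eul j)) ⟩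
      ratio (t F r) (∏-outdegrees F (vertices F - j)) ∎
      where
      open ≡-Reasoning
      same-tree : tree j as ≡ tree r as
      same-tree with eulerian⇒closedWalk eul
      ... | u , ws , end , p = tree-root end p (∈vertices⇒endpoint j∈V) (∈vertices⇒endpoint r∈V)

    -- A nonempty closed walk at `j` through all arcs makes D(F) Eulerian and puts `j` on its first
    -- arc. The empty walk shows why `L ≢ 0` is required and degree 0 is separate.
    trails-not-eulerian : ∀ {j} → ¬ (Eulerian F × j ∈ vertices F) → ∀ L → length as ≡ L → L ≢ 0 → trails L as j j ≡ 0ℚ
    trails-not-eulerian {j} no-euler L len L≢0 = trails-no-walk L as j j len no-walk
      where
      no-walk : ∀ ws → walkEnd j ws ≡ j → walkArcs j ws ↭ as → ⊥
      no-walk []       end p = L≢0 (trans (sym len) (sym (PermP.↭-length p)))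
      no-walk (w ∷ ws) end p = no-euler (closedWalk⇒eulerian {j} {w ∷ ws} end p , src∈vertices (PermP.∈-resp-↭ p (here refl)))

-- The formula for μ

module _ {n : ℕ} (m : ℕ) (H : Hypergraph n) (uniform : Uniform m H) where

  private
    s = m ∸ 1

  μ-family : ∀ d j (root : Tuple n s d → Fin n) → 1 ≤ d → (∀ F → InFamily F H j → root F ∈ vertices F) →
    μ m H d j ≡ ℕ→ℚ ((m ∸ 1) ^ (n ∸ 1)) *
      ∑ (family m d H j) (λ F → ratio (t F (root F)) (∏-outdegrees F (vertices F - j)))
  μ-family d j root 1≤d root∈ = trans (μ-outWeight m H uniform d j) (cong (ℕ→ℚ ((m ∸ 1) ^ (n ∸ 1)) *_) (begin
    ∑ W (λ F → ordered proj₁ 0 F * (⟦ allAdmissible? m H uniform F ⟧ * term F))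
      ≡⟨ ∑-cong W (λ F → begin
           ordered proj₁ 0 F * (⟦ A? F ⟧ * term F)
             ≡⟨ cong (_* (⟦ A? F ⟧ * term F)) (ordered-linked proj₁ F (P? F)) ⟩
           ⟦ P? F ⟧ * (⟦ A? F ⟧ * term F)
             -- The terms are compared under both conditions at once, since `root F` is known to be
             -- a vertex only for members of the family.
             ≡⟨ ⟦⟧-*-cong (P? F) (λ p → ⟦⟧-*-cong (A? F) (λ a → term-value F p a (E? F))) ⟩
           ⟦ P? F ⟧ * (⟦ A? F ⟧ * (⟦ E? F ⟧ * value F))
             ≡⟨ solve 4 (λ p a e v → p :* (a :* (e :* v)) := p :* (a :* e) :* v) refl ⟦ P? F ⟧ ⟦ A? F ⟧ ⟦ E? F ⟧ (value F) ⟩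
           ⟦ P? F ⟧ * (⟦ A? F ⟧ * ⟦ E? F ⟧) * value F
             ≡⟨ cong (_* value F) (sym (trans (⟦⟧-× (P? F) (A? F ×-dec E? F)) (cong (⟦ P? F ⟧ *_) (⟦⟧-× (A? F) (E? F))))) ⟩
           ⟦ P? F ×-dec (A? F ×-dec E? F) ⟧ * value F
             ≡⟨ cong (_* value F) (⟦⟧-cong (P? F ×-dec (A? F ×-dec E? F)) (inFamily? H j F) id id) ⟩
           ⟦ inFamily? H j F ⟧ * value F ∎) ⟩
    ∑ W (λ F → ⟦ inFamily? H j F ⟧ * value F)
      ≡⟨ sym (∑-filter (inFamily? H j) W value) ⟩
    ∑ (family m d H j) value ∎))
    where
    open ≡-Reasoning
    W = words (allLetters m H) d
    L = d ℕ.* s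
    term value : Tuple n s d → ℚ
    term F = outWeight (arcs F) * trails L (arcs F) j j
    value F = ratio (t F (root F)) (∏-outdegrees F (vertices F - j))
    P? : ∀ (F : Tuple n s d) → Dec (Linked (Fin._≤_ on proj₁) F)
    P? F = linked? (λ x y → proj₁ x FinP.≤? proj₁ y) F
    A? : ∀ (F : Tuple n s d) → Dec (All (Admissible m H uniform) F)
    A? F = allAdmissible? m H uniform F
    E? : ∀ (F : Tuple n s d) → Dec (Eulerian F × j ∈ vertices F)
    E? F = eulerian? F ×-dec (j SubP.∈? vertices F)
    -- Here `1 ≤ d` and the bound 2 ≤ m in uniformity make D(F) have at least one arc.
    L≢0 : L ≢ 0
    L≢0 L≡0 with ℕP.m*n≡0⇒m≡0∨n≡0 d L≡0
    ... | inj₁ d≡0 = ℕP.1+n≰n (subst (1 ≤_) d≡0 1≤d)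
    ... | inj₂ s≡0 = ℕP.1+n≰n (subst (1 ≤_) s≡0 (ℕP.∸-monoˡ-≤ 1 (proj₁ uniform)))
    term-value : ∀ F → Linked (Fin._≤_ on proj₁) F → All (Admissible m H uniform) F →
      (e? : Dec (Eulerian F × j ∈ vertices F)) → term F ≡ ⟦ e? ⟧ * value F
    term-value F p a (yes (eul , j∈V)) = trans
      (trails-eulerian F eul j∈V (root∈ F (p , a , eul , j∈V)) L (length-arcs m H F)) (sym (ℚP.*-identityˡ (value F)))
    term-value F p a (no ¬e) = trans
      (trans (cong (outWeight (arcs F) *_) (trails-not-eulerian F ¬e L (length-arcs m H F) L≢0)) (ℚP.*-zeroʳ (outWeight (arcs F))))
      (sym (ℚP.*-zeroˡ (value F)))

  -- Degree zero and the growth of μ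

  μ-zero : ∀ j → μ m H 0 j ≡ ℕ→ℚ ((m ∸ 1) ^ (n ∸ 1))
  μ-zero j = trans (μ-ordered m H 0 j) (trans
    (cong (λ t → c * (1ℚ * (1ℚ * (1ℚ * t)) + 0ℚ)) (⟦⟧-yes (j FinP.≟ j) refl)) (ℚP.*-identityʳ c))
    where c = ℕ→ℚ ((m ∸ 1) ^ (n ∸ 1))

  ∑-words-one : ∀ {A : Set} (xs : List A) d → ∑ (words xs d) (const 1ℚ) ≡ ℕ→ℚ (length xs ^ d)
  ∑-words-one xs zero    = refl
  ∑-words-one xs (suc d) = trans (∑-words-suc xs d (const 1ℚ)) (trans (∑-const xs (∑ (words xs d) (const 1ℚ)))
    (trans (cong (ℕ→ℚ (length xs) *_) (∑-words-one xs d)) (sym (ℕ→ℚ-* (length xs) (length xs ^ d)))))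

  private
    c = ℕ→ℚ ((m ∸ 1) ^ (n ∸ 1))

  μ-≥0 : ∀ d j → 0ℚ ℚ.≤ μ m H d j
  μ-≥0 d j = subst (0ℚ ℚ.≤_) (sym (μ-outWeight m H uniform d j)) (0≤* (0≤ℕ→ℚ ((m ∸ 1) ^ (n ∸ 1)))
    (∑-≥0 (words (allLetters m H) d) λ F → 0≤* (ordered-≥0 proj₁ 0 F) (0≤* (⟦⟧-≥0 (allAdmissible? m H uniform F))
      (0≤* (outWeight-≥0 (arcs F)) (trails-≥0 (d ℕ.* s) (arcs F) j j)))))

  -- By trails-≤-outOrders every tuple contributes at most 1.
  μ-≤ : ∀ d j → μ m H d j ℚ.≤ c * ℕ→ℚ (suc (length (allLetters m H)) ^ d)
  μ-≤ d j = begin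
    μ m H d j
      ≡⟨ μ-outWeight m H uniform d j ⟩
    c * ∑ W (λ F → ordered proj₁ 0 F * (⟦ allAdmissible? m H uniform F ⟧ * (outWeight (arcs F) * trails L (arcs F) j j)))
      ≤⟨ ℚP.*-monoˡ-≤-nonNeg c {{ℚ.nonNegative 0≤c}} (∑-mono-≤-∈ W (λ {F} _ → bound F)) ⟩
    c * ∑ W (const 1ℚ)
      ≡⟨ cong (c *_) (∑-words-one (allLetters m H) d) ⟩
    c * ℕ→ℚ (length (allLetters m H) ^ d)
      -- The successor makes the base of the power evidently nonzero, as the comparison with the
      -- exponential series requires.
      ≤⟨ ℚP.*-monoˡ-≤-nonNeg c {{ℚ.nonNegative 0≤c}} (ℕ→ℚ-mono-≤ (ℕP.^-monoˡ-≤ d (ℕP.n≤1+n (length (allLetters m H))))) ⟩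
    c * ℕ→ℚ (suc (length (allLetters m H)) ^ d) ∎
    where
    open ℚP.≤-Reasoning
    W = words (allLetters m H) d
    L = d ℕ.* s
    0≤c = 0≤ℕ→ℚ ((m ∸ 1) ^ (n ∸ 1))
    0≤1 : 0ℚ ℚ.≤ 1ℚ
    0≤1 = ℚP.nonNegative⁻¹ 1ℚ
    bound : ∀ F → ordered proj₁ 0 F * (⟦ allAdmissible? m H uniform F ⟧ * (outWeight (arcs F) * trails L (arcs F) j j)) ℚ.≤ 1ℚ
    bound F = *-mono-≤-nonNeg (ordered-≥0 proj₁ 0 F) 0≤1 (ordered-≤1 proj₁ 0 F)
      (*-mono-≤-nonNeg (⟦⟧-≥0 (allAdmissible? m H uniform F)) 0≤1 (⟦⟧-≤1 (allAdmissible? m H uniform F))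
        (subst (outWeight (arcs F) * trails L (arcs F) j j ℚ.≤_) (outWeight-outOrders (arcs F))
          (ℚP.*-monoˡ-≤-nonNeg (outWeight (arcs F)) {{ℚ.nonNegative (outWeight-≥0 (arcs F))}}
            (trails-≤-outOrders L (arcs F) j j (length-arcs m H F)))))

-- Series dominated by an exponential series

archimedean : ∀ x → ∃ λ N → x ℚ.< ℕ→ℚ N
archimedean x@(ℚ.mkℚ p d _) = suc ℤ.∣ p ∣ , ℚP.toℚᵘ-cancel-<
  (ℚᵘP.<-respʳ-≃ (ℚᵘP.≃-sym (ℕ→ℚ-toℚᵘ (suc ℤ.∣ p ∣))) (ℚᵘ.*<* (begin-strict
    p ℤ.* ℤ.+ 1                          ≡⟨ ℤP.*-identityʳ p ⟩
    p                                    ≤⟨ p≤∣p∣ p ⟩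
    ℤ.+ ℤ.∣ p ∣                          <⟨ ℤ.+<+ (ℕP.n<1+n ℤ.∣ p ∣) ⟩
    ℤ.+ suc ℤ.∣ p ∣                      ≤⟨ ℤ.+≤+ (ℕP.m≤m*n (suc ℤ.∣ p ∣) (suc d)) ⟩
    ℤ.+ (suc ℤ.∣ p ∣ ℕ.* suc d)          ≡⟨ ℤP.pos-* (suc ℤ.∣ p ∣) (suc d) ⟩
    ℤ.+ suc ℤ.∣ p ∣ ℤ.* ℤ.+ suc d        ∎)))
  where
  open ℤP.≤-Reasoning
  p≤∣p∣ : ∀ p → p ℤ.≤ ℤ.+ ℤ.∣ p ∣
  p≤∣p∣ (ℤ.+ k)      = ℤP.≤-refl
  p≤∣p∣ (ℤ.-[1+ k ]) = ℤ.-≤+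

archimedean-* : ∀ e x → 0ℚ ℚ.< e → ∃ λ N → x ℚ.< ℕ→ℚ N * e
archimedean-* e x 0<e = scale-up (archimedean (x * e⁻¹))
  where
  instance
    e-positive : ℚ.Positive e
    e-positive = ℚ.positive 0<e
    e-nonZero : ℚ.NonZero e
    e-nonZero = ℚP.pos⇒nonZero e
  e⁻¹ = ℚ.1/ e
  cancel : x * e⁻¹ * e ≡ x
  cancel = trans (ℚP.*-assoc x e⁻¹ e) (trans (cong (x *_) (ℚP.*-inverseˡ e)) (ℚP.*-identityʳ x))
  scale-up : (∃ λ N → x * e⁻¹ ℚ.< ℕ→ℚ N) → ∃ λ N → x ℚ.< ℕ→ℚ N * e
  scale-up (N , lt) = N , subst (ℚ._< ℕ→ℚ N * e) cancel (ℚP.*-monoˡ-<-pos e {x * e⁻¹} {ℕ→ℚ N} lt)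

partialSum-suc : ∀ a d → partialSum a (suc d) ≡ partialSum a d + a d
partialSum-suc a d = trans (cong (λ xs → ∑ xs a) (sym (ListP.upTo-∷ʳ d)))
  (trans (∑-++ (upTo d) (d ∷ []) a) (cong (partialSum a d +_) (ℚP.+-identityʳ (a d))))

∣-∣≤ : ∀ {x y lo δ} → lo ℚ.≤ x → x ℚ.≤ lo + δ → lo ℚ.≤ y → y ℚ.≤ lo + δ → ℚ.∣ x ℚ.- y ∣ ℚ.≤ δ
∣-∣≤ {x} {y} {lo} {δ} lo≤x x≤ lo≤y y≤ with ℚP.∣p∣≡p∨∣p∣≡-p (x ℚ.- y)
... | inj₁ eq = subst (ℚ._≤ δ) (sym eq) (difference x≤ lo≤y)
  where
  difference : ∀ {x y} → x ℚ.≤ lo + δ → lo ℚ.≤ y → x ℚ.- y ℚ.≤ δ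
  difference {x} {y} x≤ lo≤y = subst (x ℚ.- y ℚ.≤_)
    (solve 2 (λ l d → l :+ d :- l := d) refl lo δ) (ℚP.+-mono-≤ x≤ (ℚP.neg-antimono-≤ lo≤y))
... | inj₂ eq = subst (ℚ._≤ δ) (sym (trans eq (solve 2 (λ x y → :- (x :- y) := y :- x) refl x y))) (subst (y ℚ.- x ℚ.≤_)
    (solve 2 (λ l d → l :+ d :- l := d) refl lo δ) (ℚP.+-mono-≤ y≤ (ℚP.neg-antimono-≤ lo≤x)))

-- This recurrence and nonnegativity are all that the convergence proof knows about the dominating
-- series.
exponential-suc : ∀ C k d →
  ℕ→ℚ (suc d) * (C * ℕ→ℚ (k ^ suc d) * 1/ (suc d) !) ≡ ℕ→ℚ k * (C * ℕ→ℚ (k ^ d) * 1/ d !)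
exponential-suc C k d = *-cancelʳ-≢0 (ℕ→ℚ (d !)) (!≢0 d) (begin
  ℕ→ℚ (suc d) * (C * ℕ→ℚ (k ^ suc d) * 1/ (suc d) !) * ℕ→ℚ (d !)
    ≡⟨ rearrange₁ (ℕ→ℚ (suc d)) C (ℕ→ℚ (k ^ suc d)) (1/ (suc d) !) (ℕ→ℚ (d !)) ⟩
  C * ℕ→ℚ (k ^ suc d) * (1/ (suc d) ! * (ℕ→ℚ (suc d) * ℕ→ℚ (d !)))
    ≡⟨ cong₂ (λ x y → C * x * y) (ℕ→ℚ-* k (k ^ d))
         (trans (cong (1/ (suc d) ! *_) (sym (ℕ→ℚ-* (suc d) (d !)))) (trans (1/!-*-! (suc d)) (sym (1/!-*-! d)))) ⟩
  C * (ℕ→ℚ k * ℕ→ℚ (k ^ d)) * (1/ d ! * ℕ→ℚ (d !))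
    ≡⟨ rearrange₂ C (ℕ→ℚ k) (ℕ→ℚ (k ^ d)) (1/ d !) (ℕ→ℚ (d !)) ⟩
  ℕ→ℚ k * (C * ℕ→ℚ (k ^ d) * 1/ d !) * ℕ→ℚ (d !) ∎)
  where
  open ≡-Reasoning
  rearrange₁ : ∀ s c x w f → s * (c * x * w) * f ≡ c * x * (w * (s * f))
  rearrange₁ = solve 5 (λ s c x w f → s :* (c :* x :* w) :* f := c :* x :* (w :* (s :* f))) refl
  rearrange₂ : ∀ c k x w f → c * (k * x) * (w * f) ≡ k * (c * x * w) * f
  rearrange₂ = solve 5 (λ c k x w f → c :* (k :* x) :* (w :* f) := k :* (c :* x :* w) :* f) refl

module _ (a b : ℕ → ℚ) (κ : ℕ) .{{_ : ℕ.NonZero κ}} (a≥0 : ∀ d → 0ℚ ℚ.≤ a d) (a≤b : ∀ d → a d ℚ.≤ b d)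
  (b≥0 : ∀ d → 0ℚ ℚ.≤ b d) (b-suc : ∀ d → ℕ→ℚ (suc d) * b (suc d) ≡ ℕ→ℚ κ * b d) where

  private
    K = ℕ→ℚ κ
    A = partialSum a
    -- From index 2κ on the quotient κ/(d + 1) of consecutive terms is below 1/2.
    N₀ = κ ℕ.+ κ

    b-halves : ∀ d → N₀ ≤ d → b (suc d) + b (suc d) ℚ.≤ b d
    b-halves d N₀≤d = ℚP.*-cancelˡ-≤-pos K {{ℚ.positive (0<ℕ→ℚ κ)}} (begin
      K * (b (suc d) + b (suc d))       ≡⟨ solve 2 (λ k x → k :* (x :+ x) := (k :+ k) :* x) refl K (b (suc d)) ⟩
      (K + K) * b (suc d)               ≡⟨ cong (_* b (suc d)) (sym (ℕ→ℚ-+ κ κ)) ⟩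
      ℕ→ℚ N₀ * b (suc d)                ≤⟨ ℚP.*-monoʳ-≤-nonNeg (b (suc d)) {{ℚ.nonNegative (b≥0 (suc d))}} (ℕ→ℚ-mono-≤ (ℕP.m≤n⇒m≤1+n N₀≤d)) ⟩
      ℕ→ℚ (suc d) * b (suc d)           ≡⟨ b-suc d ⟩
      K * b d                           ∎)
      where open ℚP.≤-Reasoning

    b-decreasing : ∀ i → b (N₀ ℕ.+ i) ℚ.≤ b N₀
    b-decreasing zero    = ℚP.≤-reflexive (cong b (ℕP.+-identityʳ N₀))
    b-decreasing (suc i) = begin
      b (N₀ ℕ.+ suc i)      ≡⟨ cong b (ℕP.+-suc N₀ i) ⟩
      b (suc (N₀ ℕ.+ i))    ≡⟨ sym (ℚP.+-identityʳ _) ⟩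
      b (suc (N₀ ℕ.+ i)) + 0ℚ ≤⟨ ℚP.+-monoʳ-≤ (b (suc (N₀ ℕ.+ i))) (b≥0 (suc (N₀ ℕ.+ i))) ⟩
      b (suc (N₀ ℕ.+ i)) + b (suc (N₀ ℕ.+ i)) ≤⟨ b-halves (N₀ ℕ.+ i) (ℕP.m≤m+n N₀ i) ⟩
      b (N₀ ℕ.+ i)          ≤⟨ b-decreasing i ⟩
      b N₀                  ∎
      where open ℚP.≤-Reasoning

    A-increasing : ∀ N i → A N ℚ.≤ A (N ℕ.+ i)
    A-increasing N zero    = ℚP.≤-reflexive (cong A (sym (ℕP.+-identityʳ N)))
    A-increasing N (suc i) = begin
      A N                          ≤⟨ A-increasing N i ⟩
      A (N ℕ.+ i)                  ≡⟨ sym (ℚP.+-identityʳ (A (N ℕ.+ i))) ⟩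
      A (N ℕ.+ i) + 0ℚ             ≤⟨ ℚP.+-monoʳ-≤ (A (N ℕ.+ i)) (a≥0 (N ℕ.+ i)) ⟩
      A (N ℕ.+ i) + a (N ℕ.+ i)    ≡⟨ sym (partialSum-suc a (N ℕ.+ i)) ⟩
      A (suc (N ℕ.+ i))            ≡⟨ cong A (sym (ℕP.+-suc N i)) ⟩
      A (N ℕ.+ suc i)              ∎
      where open ℚP.≤-Reasoning

    -- A d + 2 b d decreases from N₀ on, because a d + 2 b (d + 1) ≤ 2 b d.
    A+2b-decreasing : ∀ N → N₀ ≤ N → ∀ i → A (N ℕ.+ i) + (b (N ℕ.+ i) + b (N ℕ.+ i)) ℚ.≤ A N + (b N + b N)
    A+2b-decreasing N N₀≤N zero    = ℚP.≤-reflexive (cong (λ d → A d + (b d + b d)) (ℕP.+-identityʳ N))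
    A+2b-decreasing N N₀≤N (suc i) = begin
      A (N ℕ.+ suc i) + (b (N ℕ.+ suc i) + b (N ℕ.+ suc i)) ≡⟨ cong (λ d → A d + (b d + b d)) (ℕP.+-suc N i) ⟩
      A (suc d) + (b (suc d) + b (suc d))          ≡⟨ cong (_+ (b (suc d) + b (suc d))) (partialSum-suc a d) ⟩
      A d + a d + (b (suc d) + b (suc d))          ≤⟨ ℚP.+-mono-≤ (ℚP.+-monoʳ-≤ (A d) (a≤b d)) (b-halves d (ℕP.≤-trans N₀≤N (ℕP.m≤m+n N i))) ⟩
      A d + b d + b d                              ≡⟨ ℚP.+-assoc (A d) (b d) (b d) ⟩
      A d + (b d + b d)                            ≤⟨ A+2b-decreasing N N₀≤N i ⟩
      A N + (b N + b N)                            ∎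
      where
      open ℚP.≤-Reasoning
      d = N ℕ.+ i

    A-bounded : ∀ N → N₀ ≤ N → ∀ i → A (N ℕ.+ i) ℚ.≤ A N + (b N + b N)
    A-bounded N N₀≤N i = begin
      A (N ℕ.+ i)                                     ≡⟨ sym (ℚP.+-identityʳ (A (N ℕ.+ i))) ⟩
      A (N ℕ.+ i) + 0ℚ                                ≤⟨ ℚP.+-monoʳ-≤ (A (N ℕ.+ i)) (ℚP.+-mono-≤ (b≥0 (N ℕ.+ i)) (b≥0 (N ℕ.+ i))) ⟩
      A (N ℕ.+ i) + (b (N ℕ.+ i) + b (N ℕ.+ i))       ≤⟨ A+2b-decreasing N N₀≤N i ⟩
      A N + (b N + b N)                               ∎
      where open ℚP.≤-Reasoning

    -- `b` does not grow beyond `N₀`, so one further use of the recurrence gives decay of order 1/N.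
    -- This suffices for the archimedean property, and no powers of 2 are needed.
    b-bounded : ∀ i → ℕ→ℚ (suc (N₀ ℕ.+ i)) * (b (suc (N₀ ℕ.+ i)) + b (suc (N₀ ℕ.+ i))) ℚ.≤ K * b N₀ + K * b N₀
    b-bounded i = begin
      ℕ→ℚ (suc d) * (b (suc d) + b (suc d))                ≡⟨ ℚP.*-distribˡ-+ (ℕ→ℚ (suc d)) (b (suc d)) (b (suc d)) ⟩
      ℕ→ℚ (suc d) * b (suc d) + ℕ→ℚ (suc d) * b (suc d)    ≡⟨ cong (λ x → x + x) (b-suc d) ⟩
      K * b d + K * b d                                    ≤⟨ ℚP.+-mono-≤ Kb≤ Kb≤ ⟩
      K * b N₀ + K * b N₀                                  ∎
      where
      open ℚP.≤-Reasoning
      d = N₀ ℕ.+ i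
      Kb≤ : K * b d ℚ.≤ K * b N₀
      Kb≤ = ℚP.*-monoˡ-≤-nonNeg K {{ℚ.nonNegative (0≤ℕ→ℚ κ)}} (b-decreasing i)

    b-small : ∀ e → 0ℚ ℚ.< e → ∃ λ N → N₀ ≤ N × b N + b N ℚ.< e
    b-small e 0<e = beyond (archimedean-* e M 0<e)
      where
      M = K * b N₀ + K * b N₀
      beyond : (∃ λ i → M ℚ.< ℕ→ℚ i * e) → ∃ λ N → N₀ ≤ N × b N + b N ℚ.< e
      beyond (i , M<ie) = N , ℕP.m≤n⇒m≤1+n (ℕP.m≤m+n N₀ i) ,
        ℚP.*-cancelˡ-<-nonNeg (ℕ→ℚ N) {{ℚ.nonNegative (0≤ℕ→ℚ N)}} {b N + b N} {e} (begin-strict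
          ℕ→ℚ N * (b N + b N)    ≤⟨ b-bounded i ⟩
          M                      <⟨ M<ie ⟩
          ℕ→ℚ i * e              ≤⟨ ℚP.*-monoʳ-≤-nonNeg e {{ℚ.nonNegative (ℚP.<⇒≤ 0<e)}} {ℕ→ℚ i} {ℕ→ℚ N} (ℕ→ℚ-mono-≤ {i} {N} (ℕP.m≤n⇒m≤1+n (ℕP.m≤n+m i N₀))) ⟩
          ℕ→ℚ N * e              ∎)
        where
        open ℚP.≤-Reasoning
        N = suc (N₀ ℕ.+ i)

  -- From `N` on all partial sums lie in the interval of length 2 b N that starts at `A N`.
  partialSum-cauchy : IsCauchy (partialSum a)
  partialSum-cauchy e 0<e = beyond (b-small e 0<e)
    where
    beyond : (∃ λ N → N₀ ≤ N × b N + b N ℚ.< e) → ∃ λ N → ∀ p q → N ≤ p → N ≤ q → ℚ.∣ A p ℚ.- A q ∣ ℚ.< e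
    beyond (N , N₀≤N , small) = N , λ p q N≤p N≤q → ℚP.≤-<-trans
      (∣-∣≤ {A p} {A q} {A N} {b N + b N} (lower p N≤p) (upper p N≤p) (lower q N≤q) (upper q N≤q)) small
      where
      lower : ∀ p → N ≤ p → A N ℚ.≤ A p
      lower p N≤p = subst (λ p → A N ℚ.≤ A p) (ℕP.m+[n∸m]≡n N≤p) (A-increasing N (p ∸ N))
      upper : ∀ p → N ≤ p → A p ℚ.≤ A N + (b N + b N)
      upper p N≤p = subst (λ p → A p ℚ.≤ A N + (b N + b N)) (ℕP.m+[n∸m]≡n N≤p) (A-bounded N N₀≤N (p ∸ N))

  hasSum : ∃ (HasSum a)
  -- The limit is represented by the partial sums themselves, so every difference to be estimated is
  -- 0 and the threshold 0 works.
  hasSum = record { seq = partialSum a ; cauchy = partialSum-cauchy } ,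
    λ e 0<e → 0 , λ p _ → subst (λ x → ℚ.∣ x ∣ ℚ.< e) (sym (ℚP.+-inverseʳ (A p))) 0<e

theorem4p3 : ∀ {n m : ℕ} (H : Hypergraph n) → Uniform m H → (j : Fin n) →
    (root : ∀ d → Tuple n (m ∸ 1) d → Fin n) →
    (∀ d (F : Tuple n (m ∸ 1) d) → 1 ≤ d → InFamily F H j → root d F ∈ vertices F) →
    (∃[ C ] IsSubgraphCentrality m H j C)
    × μ m H 0 j ≡ ℕ→ℚ ((m ∸ 1) ^ (n ∸ 1))
    × (∀ d → 1 ≤ d →
    μ m H d j ≡ ℕ→ℚ ((m ∸ 1) ^ (n ∸ 1)) *
    ∑ (family m d H j) (λ F →
    ratio (t F (root d F)) (∏-outdegrees F (vertices F - j))))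
theorem4p3 {n} {m} H uniform j root root∈ =
  hasSum (λ d → μ m H d j * 1/ d !) (λ d → c * ℕ→ℚ (κ ^ d) * 1/ d !) κ
    (λ d → 0≤* (μ-≥0 m H uniform d j) (1/!-≥0 d))
    (λ d → ℚP.*-monoʳ-≤-nonNeg (1/ d !) {{ℚ.nonNegative (1/!-≥0 d)}} (μ-≤ m H uniform d j))
    (λ d → 0≤* (0≤* (0≤ℕ→ℚ ((m ∸ 1) ^ (n ∸ 1))) (0≤ℕ→ℚ (κ ^ d))) (1/!-≥0 d))
    (exponential-suc c κ) ,
  μ-zero m H uniform j ,
  λ d 1≤d → μ-family m H uniform d j (root d) 1≤d (λ F → root∈ d F 1≤d)
  where
  c = ℕ→ℚ ((m ∸ 1) ^ (n ∸ 1))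
  κ = suc (length (allLetters m H))
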